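{- Let $\mu$ be an inductive valuation on $K(x)$ equipped with a MacLane chain of length $r$, and let $\Delta=\Delta(\mu)$. With the data $\mathbb{F}_r,e_r,h_r,\lambda_r,\varphi_r(\alpha)$ attached to the chain, there is an isomorphism of graded $\mathbb{F}_r$-algebras $$\mathcal{G}r(\mu)=\bigoplus_{\alpha\in\Gamma(\mu)}\varphi_r(\alpha)\Delta\;\simeq\;\mathbb{F}_r[\mathsf y,\mathsf p,\mathsf p^{ -1}][\mathsf x],$$ where $\mathsf y,\mathsf p$ are indeterminates and $\mathsf x$ is an algebraic element satisfying $\mathsf x^{e_r}=\mathsf p^{h_r}\mathsf y$. As elements of the graded algebra, these elements are homogeneous of degree $\deg \mathsf y=0$, $\deg \mathsf p=1/e(\mu_{r-1})$, $\deg \mathsf x=\lambda_r$.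
   Context: **Valuations.** $K$ is a field with a discrete valuation $v\colon K^*\to\mathbb{Z}$, $v(K^*)=\mathbb{Z}$, valuation ring $\mathcal{O}$, maximal ideal $\mathfrak m=\pi\mathcal{O}$, residue field $\mathbb{F}=\mathcal{O}/\mathfrak m$. $\mathbb{V}$ is the set of discrete valuations $\mu\colon K(x)^*\to\mathbb{Q}$ with $\mu|_K=v$, $\mu(x)\ge0$; put $\mu(0)=\infty$. $\Gamma(\mu)=\mu(K(x)^*)$, and $e(\mu)$ is the positive integer with $e(\mu)\Gamma(\mu)=\mathbb{Z}$. $\mu\le\mu'$ means $\mu(g)\le\mu'(g)$ for all $g\in K[x]$. $\mu_0\in\mathbb{V}$ is given by $\mu_0(\sum_s a_sx^s)=\min_s v(a_s)$. **Graded algebra.** For $\alpha\in\Gamma(\mu)$, $\mathcal P_\alpha=\{g\in K[x]:\mu(g)\ge\alpha\}$, $\mathcal P_\alpha^+=\{g\in K[x]:\mu(g)>\alpha\}$; $\mathcal{G}r(\mu)=\bigoplus_{\alpha\in\Gamma(\mu)}\mathcal P_\alpha/\mathcal P_\alpha^+$ (an integral domain); $\Delta(\mu)=\mathcal P_0/\mathcal P_0^+$, which is an $\mathbb{F}$-algebra. $H_\mu(0)=0$ and $H_\mu(g)=g+\mathcal P^+_{\mu(g)}$ for $g\neq0$. If $\mu\le\mu'$, there is a canonical homomorphism $\mathcal{G}r(\mu)\to\mathcal{G}r(\mu')$, sending $H_\mu(g)$ to $H_{\mu'}(g)$ if $\mu(g)=\mu'(g)$ and to $0$ otherwise. $g\sim_\mu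 h$ means $H_\mu(g)=H_\mu(h)$; $h\mid_\mu g$ means that $H_\mu(h)$ divides $H_\mu(g)$ in $\mathcal{G}r(\mu)$. **Key polynomials and augmentations.** A key polynomial for $\mu$ is a monic $\phi\in K[x]$ of positive degree such that $H_\mu(\phi)\mathcal{G}r(\mu)$ is a non-zero prime ideal and $\phi\nmid_\mu g$ for all non-zero $g$ with $\deg g<\deg\phi$. For such $\phi$ and $\lambda\in\mathbb{Q}_{>0}$, the augmented valuation $[\mu;(\phi,\lambda)]\in\mathbb V$ is $\sum_s g_s\phi^s\mapsto\min_s\{\mu(g_s\phi^s)+s\lambda\}$ on $\phi$-expansions ($\deg g_s<\deg\phi$). A valuation $\mu$ is inductive if it is obtained from $\mu_0$ by finitely many augmentations $\mu_i=[\mu_{i-1};(\phi_i,\lambda_i)]$, $1\le i\le r$, $\mu_r=\mu$. Such a chain is a MacLane chain of length $r$ if $\phi_{i+1}\not\sim_{\mu_i}\phi_i$ for $1\le i<r$. **Data of a MacLane chain.** Put $\phi_0=x$, $\lambda_0=0$, $\mu_{ -1}=\mu_0$. For $0\le i\le r$: $\Delta_i=\Delta(\mu_i)$; $\mathbb{F}_0=\mathrm{Im}(\mathbb{F}\to\Delta_0)$, and $\mathbb{F}_i=\mathrm{Im}(\Delta_{i-1}\to\Delta_i)$ for $i\ge1$ (a field, finite over $\mathbb{F}$); so $\mathcal{G}r(\mu)$ is an $\mathbb{F}_r$-algebra. $e_i=e(\mu_i)/e(\mu_{i-1})$, $h_i=e(\mu_i)\lambda_i$ (coprime integers), $V_i=e(\mu_{i-1})\mu_{i-1}(\phi_i)\in\mathbb{Z}$;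 $\ell_i,\ell_i'$ are the integers with $\ell_ih_i+\ell_i'e_i=1$, $0\le\ell_i<e_i$. Rational functions: $\pi_0=\pi_1=\pi$, $\Phi_0=x$, and for $1\le i\le r$, $\Phi_i=\phi_i\pi_i^{ -V_i}$, $\pi_{i+1}=\Phi_i^{\ell_i}\pi_i^{\ell_i'}$. For $i\ge 1$, $\Phi_i$ is $\phi_i$ times a Laurent monomial in $\pi,\phi_1,\dots,\phi_{i-1}$, and $\pi_i$ is a Laurent monomial in $\pi,\phi_1,\dots,\phi_{i-1}$; since $H_{\mu_i}(\pi)$ and $H_{\mu_i}(\phi_k)$ ($1\le k<i$) are units in $\mathcal{G}r(\mu_i)$, one defines $x_i=H_{\mu_i}(\Phi_i)$ and $p_i=H_{\mu_i}(\pi_i)$ (a unit) in $\mathcal{G}r(\mu_i)$ by applying $H_{\mu_i}$ to each factor. For $\alpha\in\Gamma(\mu_i)$, integers $s(\alpha),u(\alpha)$ are determined by $u(\alpha)e_i+s(\alpha)h_i=e(\mu_i)\alpha$, $0\le s(\alpha)<e_i$, and $\varphi_i(\alpha)=x_i^{s(\alpha)}p_i^{u(\alpha)}\in\mathcal{G}r(\mu_i)$. -}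

module Defs where

open import Level using (Level; 0ℓ; _⊔_) renaming (suc to lsuc)
open import Algebra.Bundles using (CommutativeRing; module Semiring)
open import Algebra.Definitions using (Invertible)
open import Algebra.Morphism.Structures using (module RingMorphisms)
import Algebra.Definitions.RawSemiring as RawSemiringDefinitions
import Algebra.Morphism.Construct.Identity as Identity
import Algebra.Properties.CommutativeSemigroup as CommutativeSemigroupProperties
import Algebra.Properties.Ring as RingProperties
open import Data.Bool.Base using (if_then_else_)
open import Data.Empty using (⊥-elim)
open import Data.Integer.Base as ℤ using (ℤ; +_; -[1+_])
open import Data.List.Base using (List; []; _∷_; _++_; map; foldr)
open import Data.List.Relation.Unary.All using (All)
open import Data.Nat.Base as ℕ using (ℕ; zero; suc; z≤n; s≤s)
open import Data.Sum.Base using (_⊎_; inj₁; inj₂)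
import Data.Nat.Properties as ℕ
open import Data.Product.Base using (Σ; ∃; ∃-syntax; _×_; _,_; proj₁; proj₂)
open import Data.Rational.Base as ℚ using (ℚ; 0ℚ; _/_)
import Data.Rational.Properties as ℚ
open import Data.Unit.Polymorphic.Base using (⊤; tt)
open import Function.Base using (_∘_; id)
open import Function.Bundles using (_⇔_; module Equivalence)
open import Relation.Binary.Definitions using (tri<; tri≈; tri>)
open import Relation.Binary.PropositionalEquality.Core as ≡ using (_≡_; _≢_)
import Relation.Binary.Reasoning.Setoid as SetoidReasoning
open import Relation.Nullary.Decidable.Core using (yes; no; does)
open import Relation.Nullary.Negation.Core using (¬_)
open import Relation.Unary using (Pred)
open import Relation.Nullary.Construct.Add.Supremum using (_⁺; ⊤⁺; [_]; []-injective)
import Relation.Binary.Construct.Add.Supremum.NonStrict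
import Relation.Binary.Construct.Add.Supremum.Strict

open Relation.Binary.Construct.Add.Supremum.NonStrict ℚ._≤_ public
  using (_≤⁺_; [_]; _≤⊤⁺; ≤⁺-trans)
open Relation.Binary.Construct.Add.Supremum.Strict ℚ._<_ public
  using (_<⁺_; [_]; [_]<⊤⁺; <⁺-transʳ; <⁺-transˡ)

infixl 6 _+⁺_
infixl 7 _⊓⁺_ _·⁺_

-- ℚ ⁺ is ℚ ∪ {∞}, with ⊤⁺ in the role of ∞.

_+⁺_ : ℚ ⁺ → ℚ ⁺ → ℚ ⁺
[ p ] +⁺ [ q ] = [ p ℚ.+ q ]
[ p ] +⁺ ⊤⁺    = ⊤⁺
⊤⁺    +⁺ _     = ⊤⁺

_⊓⁺_ : ℚ ⁺ → ℚ ⁺ → ℚ ⁺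
[ p ] ⊓⁺ [ q ] = [ p ℚ.⊓ q ]
[ p ] ⊓⁺ ⊤⁺    = [ p ]
⊤⁺    ⊓⁺ q     = q

_·⁺_ : ℚ → ℚ ⁺ → ℚ ⁺
p ·⁺ [ q ] = [ p ℚ.* q ]
p ·⁺ ⊤⁺    = ⊤⁺

fromℤ : ℤ → ℚ
fromℤ n = n / 1

fromℕ : ℕ → ℚ
fromℕ n = fromℤ (+ n)

module RingFacts {c ℓ : Level} (R : CommutativeRing c ℓ) where
  open CommutativeRing R
  open RingProperties ring public
  open SetoidReasoning setoid
  private
    module +S = CommutativeSemigroupProperties +-commutativeSemigroup

  interchange : ∀ a b x y → (a + b) + (x + y) ≈ (a + x) + (b + y)
  interchange = +S.interchange

  diff-refl : ∀ {x y} → x ≈ y → x - y ≈ 0#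
  diff-refl = x≈y⇒x∙y⁻¹≈ε

  diff-neg : ∀ x y → (- x) - (- y) ≈ - (x - y)
  diff-neg x y = -‿+-comm x (- y)

  diff-sym : ∀ x y → y - x ≈ - (x - y)
  diff-sym x y = sym (⁻¹-anti-homo‿- x y)

  diff-+ : ∀ a b x y → (a + b) - (x + y) ≈ (a - x) + (b - y)
  diff-+ a b x y = begin
    (a + b) + - (x + y)     ≈⟨ +-congˡ (-‿+-comm x y) ⟨
    (a + b) + (- x + - y)   ≈⟨ interchange a b (- x) (- y) ⟩
    (a - x) + (b - y)       ∎

  cancel : ∀ y z → - y + (y + z) ≈ z
  cancel y z = begin
    - y + (y + z)   ≈⟨ +-assoc (- y) y z ⟨
    (- y + y) + z   ≈⟨ +-congʳ (-‿inverseˡ y) ⟩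
    0# + z          ≈⟨ +-identityˡ z ⟩
    z               ∎

  diff-trans : ∀ x y z → x - z ≈ (x - y) + (y - z)
  diff-trans x y z = begin
    x - z                   ≈⟨ +-congˡ (cancel y (- z)) ⟨
    x + (- y + (y - z))     ≈⟨ +-assoc x (- y) (y - z) ⟨
    (x - y) + (y - z)       ∎

  diff-* : ∀ a b x y → a * b - x * y ≈ a * (b - y) + y * (a - x)
  diff-* a b x y = begin
    a * b - x * y                       ≈⟨ diff-trans (a * b) (a * y) (x * y) ⟩
    (a * b - a * y) + (a * y - x * y)   ≈⟨ +-cong (sym (x[y-z]≈xy-xz a b y)) (sym ([y-z]x≈yx-zx y a x)) ⟩
    a * (b - y) + (a - x) * y           ≈⟨ +-congˡ (*-comm (a - x) y) ⟩
    a * (b - y) + y * (a - x)           ∎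

record Field (c ℓ : Level) : Set (lsuc (c ⊔ ℓ)) where
  field
    commutativeRing : CommutativeRing c ℓ
  open CommutativeRing commutativeRing public
  field
    1≉0     : ¬ 1# ≈ 0#
    inverse : ∀ a → ¬ a ≈ 0# → Invertible _≈_ 1# _*_ a

-- The ring P / Q, for a subring P of R and an ideal Q of P.

record SubquotientData {c ℓ : Level} (R : CommutativeRing c ℓ) (p q : Level) : Set (c ⊔ ℓ ⊔ lsuc (p ⊔ q)) where
  open CommutativeRing R
  field
    P : Pred Carrier p
    Q : Pred Carrier q
    P-0# : P 0#
    P-1# : P 1#
    P-+  : ∀ {x y} → P x → P y → P (x + y)
    P-*  : ∀ {x y} → P x → P y → P (x * y)
    P-‿  : ∀ {x} → P x → P (- x)
    Q-0# : Q 0#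
    Q-+  : ∀ {x y} → Q x → Q y → Q (x + y)
    Q-‿  : ∀ {x} → Q x → Q (- x)
    Q-*  : ∀ {x y} → P x → Q y → Q (x * y)
    Q-resp : ∀ {x y} → x ≈ y → Q x → Q y

module _ {c ℓ p q : Level} {R : CommutativeRing c ℓ} (S : SubquotientData R p q) where
  private module R = CommutativeRing R
  open RingFacts R
  open SubquotientData S

  infix 4 _≈/_

  record _≈/_ (x y : Σ R.Carrier P) : Set q where
    constructor modulo
    field diff : Q (proj₁ x R.- proj₁ y)
  open _≈/_ public

  subquotient : CommutativeRing (c ⊔ p) q
  subquotient = record
    { Carrier = Σ R.Carrier P
    ; _≈_ = _≈/_
    ; _+_ = λ x y → proj₁ x R.+ proj₁ y , P-+ (proj₂ x) (proj₂ y)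
    ; _*_ = λ x y → proj₁ x R.* proj₁ y , P-* (proj₂ x) (proj₂ y)
    ; -_ = λ x → R.- proj₁ x , P-‿ (proj₂ x)
    ; 0# = R.0# , P-0#
    ; 1# = R.1# , P-1#
    ; isCommutativeRing = record
      { isRing = record
        { +-isAbelianGroup = record
          { isGroup = record
            { isMonoid = record
              { isSemigroup = record
                { isMagma = record
                  { isEquivalence = record
                    { refl = lift R.refl
                    ; sym = λ {x} {y} h → modulo (Q-resp (R.sym (diff-sym (proj₁ x) (proj₁ y))) (Q-‿ (diff h)))
                    ; trans = λ {x} {y} {z} h k → modulo
                        (Q-resp (R.sym (diff-trans (proj₁ x) (proj₁ y) (proj₁ z))) (Q-+ (diff h) (diff k)))
                    }
                  ; ∙-cong = λ {x} {y} {u} {v} h k → modulo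
                      (Q-resp (R.sym (diff-+ (proj₁ x) (proj₁ u) (proj₁ y) (proj₁ v))) (Q-+ (diff h) (diff k)))
                  }
                ; assoc = λ x y z → lift (R.+-assoc (proj₁ x) (proj₁ y) (proj₁ z))
                }
              ; identity = (λ x → lift (R.+-identityˡ (proj₁ x))) , (λ x → lift (R.+-identityʳ (proj₁ x)))
              }
            ; inverse = (λ x → lift (R.-‿inverseˡ (proj₁ x))) , (λ x → lift (R.-‿inverseʳ (proj₁ x)))
            ; ⁻¹-cong = λ {x} {y} h → modulo (Q-resp (R.sym (diff-neg (proj₁ x) (proj₁ y))) (Q-‿ (diff h)))
            }
          ; comm = λ x y → lift (R.+-comm (proj₁ x) (proj₁ y))
          }
        ; *-cong = λ {x} {y} {u} {v} h k → modulo
            (Q-resp (R.sym (diff-* (proj₁ x) (proj₁ u) (proj₁ y) (proj₁ v)))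
                    (Q-+ (Q-* (proj₂ x) (diff k)) (Q-* (proj₂ v) (diff h))))
        ; *-assoc = λ x y z → lift (R.*-assoc (proj₁ x) (proj₁ y) (proj₁ z))
        ; *-identity = (λ x → lift (R.*-identityˡ (proj₁ x))) , (λ x → lift (R.*-identityʳ (proj₁ x)))
        ; distrib = (λ x y z → lift (R.distribˡ (proj₁ x) (proj₁ y) (proj₁ z)))
                  , (λ x y z → lift (R.distribʳ (proj₁ x) (proj₁ y) (proj₁ z)))
        }
      ; *-comm = λ x y → lift (R.*-comm (proj₁ x) (proj₁ y))
      }
    }
    where
    lift : ∀ {x y} → proj₁ x R.≈ proj₁ y → x ≈/ y
    lift h = modulo (Q-resp (R.sym (diff-refl h)) Q-0#)

-- The quotient of R by the principal ideal generated by f.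

module Quotient {c ℓ : Level} (R : CommutativeRing c ℓ) (f : CommutativeRing.Carrier R) where
  open CommutativeRing R
  open RawSemiringDefinitions (Semiring.rawSemiring semiring) using (_∣_)
  open RingFacts R

  ring/f : CommutativeRing c (c ⊔ ℓ)
  ring/f = subquotient {p = 0ℓ} {q = c ⊔ ℓ} {R = R} record
    { P = λ _ → ⊤
    ; Q = λ g → f ∣ g
    ; P-0# = tt
    ; P-1# = tt
    ; P-+ = λ _ _ → tt
    ; P-* = λ _ _ → tt
    ; P-‿ = λ _ → tt
    ; Q-0# = record { quotient = 0# ; equality = zeroˡ f }
    ; Q-+ = λ (record { quotient = a ; equality = h }) (record { quotient = b ; equality = k }) →
        record { quotient = a + b ; equality = trans (distribʳ f a b) (+-cong h k) }
    ; Q-‿ = λ (record { quotient = a ; equality = h }) →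
        record { quotient = - a ; equality = trans (sym (-‿distribˡ-* a f)) (-‿cong h) }
    ; Q-* = λ {x} _ (record { quotient = a ; equality = h }) →
        record { quotient = x * a ; equality = trans (*-assoc x a f) (*-congˡ h) }
    ; Q-resp = λ h (record { quotient = a ; equality = k }) →
        record { quotient = a ; equality = trans k h }
    }

  [_]/ : Carrier → CommutativeRing.Carrier ring/f
  [ g ]/ = g , tt

-- Polynomials in one variable: lists of coefficients starting with the
-- constant one, possibly with trailing zeros, compared coefficientwise.

module Polynomial {c ℓ : Level} (R : CommutativeRing c ℓ) where
  private module R = CommutativeRing R
  open R using (Carrier; 0#; 1#)

  Poly : Set c
  Poly = List Carrier

  coeff : Poly → ℕ → Carrier
  coeff []      _       = 0#
  coeff (a ∷ f) zero    = a
  coeff (a ∷ f) (suc n) = coeff f n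

  infix 4 _≈_
  infixl 6 _+_
  infixl 7 _*_ _⊛_
  infix 8 -_

  record _≈_ (f g : Poly) : Set ℓ where
    constructor pointwise
    field at : ∀ n → coeff f n R.≈ coeff g n
  open _≈_ public

  _+_ : Poly → Poly → Poly
  []      + g       = g
  (a ∷ f) + []      = a ∷ f
  (a ∷ f) + (b ∷ g) = (a R.+ b) ∷ (f + g)

  -_ : Poly → Poly
  - f = map (λ a → R.- a) f

  _⊛_ : Carrier → Poly → Poly
  a ⊛ g = map (a R.*_) g

  _*_ : Poly → Poly → Poly
  []      * g = []
  (a ∷ f) * g = (a ⊛ g) + (0# ∷ (f * g))

  constant : Carrier → Poly
  constant a = a ∷ []

  X : Poly
  X = 0# ∷ 1# ∷ []

  open RingFacts R using (-0#≈0#; interchange)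

  ≈-refl : ∀ {f} → f ≈ f
  ≈-refl .at n = R.refl

  ≈-sym : ∀ {f g} → f ≈ g → g ≈ f
  ≈-sym h .at n = R.sym (h .at n)

  ≈-trans : ∀ {f g k} → f ≈ g → g ≈ k → f ≈ k
  ≈-trans h k .at n = R.trans (h .at n) (k .at n)

  coeff-+ : ∀ f g n → coeff (f + g) n R.≈ coeff f n R.+ coeff g n
  coeff-+ []      g       n       = R.sym (R.+-identityˡ _)
  coeff-+ (a ∷ f) []      n       = R.sym (R.+-identityʳ _)
  coeff-+ (a ∷ f) (b ∷ g) zero    = R.refl
  coeff-+ (a ∷ f) (b ∷ g) (suc n) = coeff-+ f g n

  coeff-neg : ∀ f n → coeff (- f) n R.≈ R.- coeff f n
  coeff-neg []      n       = R.sym -0#≈0#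
  coeff-neg (a ∷ f) zero    = R.refl
  coeff-neg (a ∷ f) (suc n) = coeff-neg f n

  coeff-⊛ : ∀ a g n → coeff (a ⊛ g) n R.≈ a R.* coeff g n
  coeff-⊛ a []      n       = R.sym (R.zeroʳ a)
  coeff-⊛ a (b ∷ g) zero    = R.refl
  coeff-⊛ a (b ∷ g) (suc n) = coeff-⊛ a g n

  +-cong : ∀ {f g h k} → f ≈ g → h ≈ k → (f + h) ≈ (g + k)
  +-cong {f} {g} {h} {k} p q .at n =
    R.trans (coeff-+ f h n) (R.trans (R.+-cong (p .at n) (q .at n)) (R.sym (coeff-+ g k n)))

  +-assoc : ∀ f g h → ((f + g) + h) ≈ (f + (g + h))
  +-assoc f g h .at n = begin
    coeff ((f + g) + h) n                         ≈⟨ coeff-+ (f + g) h n ⟩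
    coeff (f + g) n R.+ coeff h n                 ≈⟨ R.+-congʳ (coeff-+ f g n) ⟩
    (coeff f n R.+ coeff g n) R.+ coeff h n       ≈⟨ R.+-assoc _ _ _ ⟩
    coeff f n R.+ (coeff g n R.+ coeff h n)       ≈⟨ R.+-congˡ (coeff-+ g h n) ⟨
    coeff f n R.+ coeff (g + h) n                 ≈⟨ coeff-+ f (g + h) n ⟨
    coeff (f + (g + h)) n                         ∎
    where open SetoidReasoning R.setoid

  +-comm : ∀ f g → (f + g) ≈ (g + f)
  +-comm f g .at n = R.trans (coeff-+ f g n) (R.trans (R.+-comm _ _) (R.sym (coeff-+ g f n)))

  +-interchange : ∀ f g h k → ((f + g) + (h + k)) ≈ ((f + h) + (g + k))
  +-interchange f g h k .at n = begin
    coeff ((f + g) + (h + k)) n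
      ≈⟨ R.trans (coeff-+ (f + g) (h + k) n) (R.+-cong (coeff-+ f g n) (coeff-+ h k n)) ⟩
    (coeff f n R.+ coeff g n) R.+ (coeff h n R.+ coeff k n)
      ≈⟨ interchange _ _ _ _ ⟩
    (coeff f n R.+ coeff h n) R.+ (coeff g n R.+ coeff k n)
      ≈⟨ R.trans (coeff-+ (f + h) (g + k) n) (R.+-cong (coeff-+ f h n) (coeff-+ g k n)) ⟨
    coeff ((f + h) + (g + k)) n ∎
    where open SetoidReasoning R.setoid

  shift-cong : ∀ {a b f g} → a R.≈ b → f ≈ g → (a ∷ f) ≈ (b ∷ g)
  shift-cong h k .at zero    = h
  shift-cong h k .at (suc n) = k .at n

  shift-+ : ∀ f g → (0# ∷ (f + g)) ≈ ((0# ∷ f) + (0# ∷ g))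
  shift-+ f g .at zero    = R.sym (R.+-identityˡ 0#)
  shift-+ f g .at (suc n) = R.refl

  shift-[] : (0# ∷ []) ≈ []
  shift-[] .at zero    = R.refl
  shift-[] .at (suc n) = R.refl

  ⊛-cong : ∀ {a b f g} → a R.≈ b → f ≈ g → (a ⊛ f) ≈ (b ⊛ g)
  ⊛-cong {a} {b} {f} {g} h k .at n =
    R.trans (coeff-⊛ a f n) (R.trans (R.*-cong h (k .at n)) (R.sym (coeff-⊛ b g n)))

  ⊛-+ : ∀ a f g → (a ⊛ (f + g)) ≈ ((a ⊛ f) + (a ⊛ g))
  ⊛-+ a f g .at n = begin
    coeff (a ⊛ (f + g)) n                       ≈⟨ R.trans (coeff-⊛ a (f + g) n) (R.*-congˡ (coeff-+ f g n)) ⟩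
    a R.* (coeff f n R.+ coeff g n)             ≈⟨ R.distribˡ _ _ _ ⟩
    a R.* coeff f n R.+ a R.* coeff g n         ≈⟨ R.+-cong (coeff-⊛ a f n) (coeff-⊛ a g n) ⟨
    coeff (a ⊛ f) n R.+ coeff (a ⊛ g) n         ≈⟨ coeff-+ (a ⊛ f) (a ⊛ g) n ⟨
    coeff ((a ⊛ f) + (a ⊛ g)) n                 ∎
    where open SetoidReasoning R.setoid

  ⊛-distribʳ : ∀ a b f → ((a R.+ b) ⊛ f) ≈ ((a ⊛ f) + (b ⊛ f))
  ⊛-distribʳ a b f .at n = begin
    coeff ((a R.+ b) ⊛ f) n                     ≈⟨ coeff-⊛ (a R.+ b) f n ⟩
    (a R.+ b) R.* coeff f n                     ≈⟨ R.distribʳ _ _ _ ⟩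
    a R.* coeff f n R.+ b R.* coeff f n         ≈⟨ R.+-cong (coeff-⊛ a f n) (coeff-⊛ b f n) ⟨
    coeff (a ⊛ f) n R.+ coeff (b ⊛ f) n         ≈⟨ coeff-+ (a ⊛ f) (b ⊛ f) n ⟨
    coeff ((a ⊛ f) + (b ⊛ f)) n                 ∎
    where open SetoidReasoning R.setoid

  ⊛-⊛ : ∀ a b f → (a ⊛ (b ⊛ f)) ≈ ((a R.* b) ⊛ f)
  ⊛-⊛ a b f .at n = begin
    coeff (a ⊛ (b ⊛ f)) n         ≈⟨ R.trans (coeff-⊛ a (b ⊛ f) n) (R.*-congˡ (coeff-⊛ b f n)) ⟩
    a R.* (b R.* coeff f n)       ≈⟨ R.*-assoc _ _ _ ⟨
    (a R.* b) R.* coeff f n       ≈⟨ coeff-⊛ (a R.* b) f n ⟨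
    coeff ((a R.* b) ⊛ f) n       ∎
    where open SetoidReasoning R.setoid

  0⊛ : ∀ f → (0# ⊛ f) ≈ []
  0⊛ f .at n = R.trans (coeff-⊛ 0# f n) (R.zeroˡ _)

  1⊛ : ∀ f → (1# ⊛ f) ≈ f
  1⊛ f .at n = R.trans (coeff-⊛ 1# f n) (R.*-identityˡ _)

  ⊛-shift : ∀ a f → (a ⊛ (0# ∷ f)) ≈ (0# ∷ (a ⊛ f))
  ⊛-shift a f .at zero    = R.zeroʳ a
  ⊛-shift a f .at (suc n) = R.refl

  *-congˡ : ∀ f {g h} → g ≈ h → (f * g) ≈ (f * h)
  *-congˡ []      p = ≈-refl
  *-congˡ (a ∷ f) p =
    +-cong (⊛-cong R.refl p) (shift-cong R.refl (*-congˡ f p))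

  *-[] : ∀ f → (f * []) ≈ []
  *-[] []      = ≈-refl
  *-[] (a ∷ f) = ≈-trans (shift-cong R.refl (*-[] f)) shift-[]

  *-shiftʳ : ∀ f b g → (f * (b ∷ g)) ≈ ((b ⊛ f) + (0# ∷ (f * g)))
  *-shiftʳ []      b g = ≈-sym shift-[]
  *-shiftʳ (a ∷ f) b g = shift-cong (R.+-congʳ (R.*-comm a b)) tail
    where
    tail : ((a ⊛ g) + (f * (b ∷ g))) ≈ ((b ⊛ f) + ((a ⊛ g) + (0# ∷ (f * g))))
    tail = ≈-trans
      (+-cong ≈-refl (*-shiftʳ f b g))
      (≈-trans
        (≈-sym (+-assoc (a ⊛ g) (b ⊛ f) (0# ∷ (f * g))))
        (≈-trans
          (+-cong (+-comm (a ⊛ g) (b ⊛ f)) ≈-refl)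
          (+-assoc (b ⊛ f) (a ⊛ g) (0# ∷ (f * g)))))

  *-comm : ∀ f g → (f * g) ≈ (g * f)
  *-comm []      g = ≈-sym (*-[] g)
  *-comm (a ∷ f) g = ≈-trans
    (+-cong ≈-refl (shift-cong R.refl (*-comm f g)))
    (≈-sym (*-shiftʳ g a f))

  *-cong : ∀ {f g h k} → f ≈ g → h ≈ k → (f * h) ≈ (g * k)
  *-cong {f} {g} {h} {k} p q =
    ≈-trans (*-congˡ f q)
      (≈-trans (*-comm f k)
        (≈-trans (*-congˡ k p) (*-comm k g)))

  *-distribˡ : ∀ f g h → (f * (g + h)) ≈ ((f * g) + (f * h))
  *-distribˡ []      g h = ≈-refl
  *-distribˡ (a ∷ f) g h =
    ≈-trans
      (+-cong (⊛-+ a g h)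
        (≈-trans
          (shift-cong R.refl (*-distribˡ f g h)) (shift-+ (f * g) (f * h))))
      (+-interchange (a ⊛ g) (a ⊛ h) (0# ∷ (f * g)) (0# ∷ (f * h)))

  *-distribʳ : ∀ f g h → ((g + h) * f) ≈ ((g * f) + (h * f))
  *-distribʳ f g h = ≈-trans (*-comm (g + h) f)
    (≈-trans (*-distribˡ f g h)
      (+-cong (*-comm f g) (*-comm f h)))

  ⊛-* : ∀ a f g → ((a ⊛ f) * g) ≈ (a ⊛ (f * g))
  ⊛-* a []      g = ≈-refl
  ⊛-* a (b ∷ f) g =
    ≈-trans
      (+-cong (≈-sym (⊛-⊛ a b g))
        (≈-trans
          (shift-cong R.refl (⊛-* a f g)) (≈-sym (⊛-shift a (f * g)))))
      (≈-sym (⊛-+ a (b ⊛ g) (0# ∷ (f * g))))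

  shift-* : ∀ f g → ((0# ∷ f) * g) ≈ (0# ∷ (f * g))
  shift-* f g = +-cong (0⊛ g) ≈-refl

  *-assoc : ∀ f g h → ((f * g) * h) ≈ (f * (g * h))
  *-assoc []      g h = ≈-refl
  *-assoc (a ∷ f) g h =
    ≈-trans
      (*-distribʳ h (a ⊛ g) (0# ∷ (f * g)))
      (+-cong (⊛-* a g h)
        (≈-trans (shift-* (f * g) h)
          (shift-cong R.refl (*-assoc f g h))))

  1* : ∀ f → (constant 1# * f) ≈ f
  1* f = ≈-trans (+-cong (1⊛ f) shift-[]) (+-comm f [])

  polyRing : CommutativeRing c ℓ
  polyRing = record
    { Carrier = Poly
    ; _≈_ = _≈_
    ; _+_ = _+_
    ; _*_ = _*_
    ; -_ = -_
    ; 0# = []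
    ; 1# = constant 1#
    ; isCommutativeRing = record
      { isRing = record
        { +-isAbelianGroup = record
          { isGroup = record
            { isMonoid = record
              { isSemigroup = record
                { isMagma = record
                  { isEquivalence = record
                    { refl = ≈-refl
                    ; sym = ≈-sym
                    ; trans = ≈-trans
                    }
                  ; ∙-cong = +-cong
                  }
                ; assoc = +-assoc
                }
              ; identity = (λ f → ≈-refl) , (λ f → +-comm f [])
              }
            ; inverse = (λ f → pointwise λ n → R.trans (coeff-+ (- f) f n)
                          (R.trans (R.+-congʳ (coeff-neg f n)) (R.-‿inverseˡ _)))
                      , (λ f → pointwise λ n → R.trans (coeff-+ f (- f) n)
                          (R.trans (R.+-congˡ (coeff-neg f n)) (R.-‿inverseʳ _)))
            ; ⁻¹-cong = λ {f} {g} h → pointwise λ n →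
                R.trans (coeff-neg f n) (R.trans (R.-‿cong (h .at n)) (R.sym (coeff-neg g n)))
            }
          ; comm = +-comm
          }
        ; *-cong = *-cong
        ; *-assoc = *-assoc
        ; *-identity = 1* , (λ f → ≈-trans (*-comm f (constant 1#)) (1* f))
        ; distrib = *-distribˡ , *-distribʳ
        }
      ; *-comm = *-comm
      }
    }

  HasDegree : Poly → ℕ → Set ℓ
  HasDegree f n = ¬ (coeff f n R.≈ 0#) × (∀ m → n ℕ.< m → coeff f m R.≈ 0#)

  -- deg f < deg g, where deg 0 = -∞.
  _deg<_ : Poly → Poly → Set ℓ
  f deg< g = ∃[ n ] HasDegree g n × (∀ m → n ℕ.≤ m → coeff f m R.≈ 0#)

  MonicOfPositiveDegree : Poly → Set ℓ
  MonicOfPositiveDegree f = ∃[ n ] 0 ℕ.< n × coeff f n R.≈ 1# × (∀ m → n ℕ.< m → coeff f m R.≈ 0#)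

  fromExpansion : Poly → List Poly → Poly
  fromExpansion φ []       = []
  fromExpansion φ (g ∷ gs) = g + φ * fromExpansion φ gs

  IsExpansion : Poly → Poly → List Poly → Set (c ⊔ ℓ)
  IsExpansion φ f gs = All (_deg< φ) gs × f ≈ fromExpansion φ gs

  constant-isRingHomomorphism :
    RingMorphisms.IsRingHomomorphism R.rawRing (CommutativeRing.rawRing polyRing) constant
  constant-isRingHomomorphism = record
    { isSemiringHomomorphism = record
      { isNearSemiringHomomorphism = record
        { +-isMonoidHomomorphism = record
          { isMagmaHomomorphism = record
            { isRelHomomorphism = record { cong = λ h → shift-cong h ≈-refl }
            ; homo = λ _ _ → ≈-refl
            }
          ; ε-homo = shift-[]
          }
        ; *-homo = λ _ _ → shift-cong (R.sym (R.+-identityʳ _)) ≈-refl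
        }
      ; 1#-homo = ≈-refl
      }
    ; -‿homo = λ _ → ≈-refl
    }

record Valuation {c ℓ : Level} (R : CommutativeRing c ℓ) : Set (c ⊔ ℓ) where
  open CommutativeRing R
  field
    val      : Carrier → ℚ ⁺
    val-cong : ∀ {x y} → x ≈ y → val x ≡ val y
    val-∞    : ∀ x → val x ≡ ⊤⁺ ⇔ x ≈ 0#
    val-1#   : val 1# ≡ [ 0ℚ ]
    val-*    : ∀ x y → val (x * y) ≡ val x +⁺ val y
    val-+    : ∀ x y → val x ⊓⁺ val y ≤⁺ val (x + y)

  infix 4 _∈𝒫_ _∈𝒫⁺_

  _∈𝒫_ _∈𝒫⁺_ : Carrier → ℚ → Set
  x ∈𝒫  α = [ α ] ≤⁺ val x
  x ∈𝒫⁺ α = [ α ] <⁺ val x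

  -- The value group of the fraction field of R; elements of this field are
  -- written f / g, with value val f - val g.
  Γ : Pred ℚ c
  Γ α = ∃[ f ] ∃[ g ] ∃[ a ] ∃[ b ] val f ≡ [ a ] × val g ≡ [ b ] × α ≡ a ℚ.- b

module ValuationFacts {c ℓ : Level} {R : CommutativeRing c ℓ} (V : Valuation R) where
  open CommutativeRing R
  open Valuation V
  open RingFacts R

  private
    ≤-∞ : ∀ {p} → p ≤⁺ ⊤⁺
    ≤-∞ {p} = p ≤⊤⁺

    ⊓-glb : ∀ {p} a b → p ≤⁺ a → p ≤⁺ b → p ≤⁺ a ⊓⁺ b
    ⊓-glb [ a ] [ b ] [ h ] [ k ] = [ ℚ.⊓-glb h k ]
    ⊓-glb [ a ] ⊤⁺    h     k     = h
    ⊓-glb ⊤⁺    b     h     k     = k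

    ⊓-glb-< : ∀ {p} a b → p <⁺ a → p <⁺ b → p <⁺ a ⊓⁺ b
    ⊓-glb-< [ a ] [ b ] [ h ] [ k ] with ℚ.⊓-sel a b
    ... | inj₁ e = [ ≡.subst (_ ℚ.<_) (≡.sym e) h ]
    ... | inj₂ e = [ ≡.subst (_ ℚ.<_) (≡.sym e) k ]
    ⊓-glb-< [ a ] ⊤⁺    h     k     = h
    ⊓-glb-< ⊤⁺    b     h     k     = k

    +-≤ : ∀ {α β} a b → [ α ] ≤⁺ a → [ β ] ≤⁺ b → [ α ℚ.+ β ] ≤⁺ a +⁺ b
    +-≤ [ a ] [ b ] [ h ] [ k ] = [ ℚ.+-mono-≤ h k ]
    +-≤ [ a ] ⊤⁺    h     k     = ≤-∞
    +-≤ ⊤⁺    b     h     k     = ≤-∞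

    +-< : ∀ {α β} a b → [ α ] ≤⁺ a → [ β ] <⁺ b → [ α ℚ.+ β ] <⁺ a +⁺ b
    +-< [ a ] [ b ] [ h ] [ k ] = [ ℚ.+-mono-≤-< h k ]
    +-< [ a ] ⊤⁺    h     k     = [ _ ]<⊤⁺
    +-< ⊤⁺    b     h     k     = [ _ ]<⊤⁺

    double≡0 : ∀ q → q ℚ.+ q ≡ 0ℚ → q ≡ 0ℚ
    double≡0 q h with ℚ.<-cmp q 0ℚ
    ... | tri< q<0 _ _ = ⊥-elim (ℚ.<-irrefl h (ℚ.+-mono-< q<0 q<0))
    ... | tri≈ _ q≡0 _ = q≡0
    ... | tri> _ _ q>0 = ⊥-elim (ℚ.<-irrefl (≡.sym h) (ℚ.+-mono-< q>0 q>0))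

    double⁺≡0 : ∀ w → w +⁺ w ≡ [ 0ℚ ] → w ≡ [ 0ℚ ]
    double⁺≡0 [ q ] h = ≡.cong [_] (double≡0 q ([]-injective h))

    0+⁺ : ∀ w → [ 0ℚ ] +⁺ w ≡ w
    0+⁺ [ q ] = ≡.cong [_] (ℚ.+-identityˡ q)
    0+⁺ ⊤⁺    = ≡.refl

    val-neg1 : val (- 1#) ≡ [ 0ℚ ]
    val-neg1 = double⁺≡0 _ (≡.trans (≡.sym (val-* (- 1#) (- 1#)))
      (≡.trans (val-cong (trans (-1*x≈-x (- 1#)) (-‿involutive 1#))) val-1#))

  val-neg : ∀ x → val (- x) ≡ val x
  val-neg x = ≡.trans (val-cong (sym (-1*x≈-x x)))
    (≡.trans (val-* (- 1#) x) (≡.trans (≡.cong (_+⁺ val x) val-neg1) (0+⁺ (val x))))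

  val-0# : val 0# ≡ ⊤⁺
  val-0# = Equivalence.from (val-∞ 0#) refl

  𝒫-0# : ∀ {α} → 0# ∈𝒫 α
  𝒫-0# = ≡.subst (_ ≤⁺_) (≡.sym val-0#) ≤-∞

  𝒫-1# : 1# ∈𝒫 0ℚ
  𝒫-1# = ≡.subst (_ ≤⁺_) (≡.sym val-1#) [ ℚ.≤-refl ]

  𝒫-+ : ∀ {α x y} → x ∈𝒫 α → y ∈𝒫 α → x + y ∈𝒫 α
  𝒫-+ {α} {x} {y} h k = ≤⁺-trans ℚ.≤-trans (⊓-glb _ _ h k) (val-+ x y)

  𝒫-* : ∀ {α β x y} → x ∈𝒫 α → y ∈𝒫 β → x * y ∈𝒫 α ℚ.+ β
  𝒫-* {x = x} {y} h k = ≡.subst (_ ≤⁺_) (≡.sym (val-* x y)) (+-≤ _ _ h k)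

  𝒫-‿ : ∀ {α x} → x ∈𝒫 α → - x ∈𝒫 α
  𝒫-‿ {x = x} = ≡.subst (_ ≤⁺_) (≡.sym (val-neg x))

  𝒫⁺-0# : ∀ {α} → 0# ∈𝒫⁺ α
  𝒫⁺-0# = ≡.subst (_ <⁺_) (≡.sym val-0#) [ _ ]<⊤⁺

  𝒫⁺-+ : ∀ {α x y} → x ∈𝒫⁺ α → y ∈𝒫⁺ α → x + y ∈𝒫⁺ α
  𝒫⁺-+ {α} {x} {y} h k = <⁺-transˡ ℚ.<-≤-trans (⊓-glb-< _ _ h k) (val-+ x y)

  𝒫⁺-‿ : ∀ {α x} → x ∈𝒫⁺ α → - x ∈𝒫⁺ α
  𝒫⁺-‿ {x = x} = ≡.subst (_ <⁺_) (≡.sym (val-neg x))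

  𝒫⁺-* : ∀ {α β x y} → x ∈𝒫 α → y ∈𝒫⁺ β → x * y ∈𝒫⁺ α ℚ.+ β
  𝒫⁺-* {x = x} {y} h k = ≡.subst (_ <⁺_) (≡.sym (val-* x y)) (+-< _ _ h k)

  𝒫⁺-resp : ∀ {α x y} → x ≈ y → x ∈𝒫⁺ α → y ∈𝒫⁺ α
  𝒫⁺-resp h = ≡.subst (_ <⁺_) (val-cong h)

  𝒫⁺⇒𝒫 : ∀ {α x} → x ∈𝒫⁺ α → x ∈𝒫 α
  𝒫⁺⇒𝒫 {x = x} h with val x | h
  ... | _ | [ p ]    = [ ℚ.<⇒≤ p ]
  ... | _ | [ _ ]<⊤⁺ = ≤-∞

  𝒫-resp : ∀ {α x y} → x ≈ y → x ∈𝒫 α → y ∈𝒫 α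
  𝒫-resp h = ≡.subst (_ ≤⁺_) (val-cong h)

  Γ-0 : Γ 0ℚ
  Γ-0 = 1# , 1# , 0ℚ , 0ℚ , val-1# , val-1# , ≡.refl

  Γ-val : ∀ {α x} → val x ≡ [ α ] → Γ α
  Γ-val {α} {x} h = x , 1# , α , 0ℚ , h , val-1# , ≡.sym (ℚ.+-identityʳ α)

  Γ-+ : ∀ {α β} → Γ α → Γ β → Γ (α ℚ.+ β)
  Γ-+ (f , g , a , b , hf , hg , ≡.refl) (f′ , g′ , a′ , b′ , hf′ , hg′ , ≡.refl) =
    f * f′ , g * g′ , a ℚ.+ a′ , b ℚ.+ b′ , mul f f′ hf hf′ , mul g g′ hg hg′ ,
    ≡.sym (RingFacts.diff-+ ℚ.+-*-commutativeRing a a′ b b′)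
    where
    mul : ∀ x y {p q} → val x ≡ [ p ] → val y ≡ [ q ] → val (x * y) ≡ [ p ℚ.+ q ]
    mul x y h k = ≡.trans (val-* x y) (≡.cong₂ _+⁺_ h k)

-- 𝒫₀ / 𝒫₀⁺: the residue field for a valuation on a field, and Δ(μ) for a
-- valuation μ on K[x].

residueRing : ∀ {c ℓ} {R : CommutativeRing c ℓ} → Valuation R → CommutativeRing c 0ℓ
residueRing {R = R} V = subquotient {R = R} record
  { P = _∈𝒫 0ℚ
  ; Q = _∈𝒫⁺ 0ℚ
  ; P-0# = 𝒫-0#
  ; P-1# = 𝒫-1#
  ; P-+ = 𝒫-+
  ; P-* = 𝒫-*
  ; P-‿ = 𝒫-‿
  ; Q-0# = 𝒫⁺-0#
  ; Q-+ = 𝒫⁺-+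
  ; Q-‿ = 𝒫⁺-‿
  ; Q-* = 𝒫⁺-*
  ; Q-resp = 𝒫⁺-resp
  }
  where
  open Valuation V
  open ValuationFacts V

-- The direct sum of the 𝒫α / 𝒫α⁺ for α ∈ Γ: an element is a finite formal
-- sum of classes of elements of the 𝒫α, and two formal sums are equal when
-- their components agree in every degree.

module GradedRing {c ℓ : Level} {R : CommutativeRing c ℓ} (V : Valuation R) where
  private module R = CommutativeRing R
  open Valuation V
  open ValuationFacts V
  private module F = RingFacts R
  private module ℚF = RingFacts ℚ.+-*-commutativeRing

  record Term : Set c where
    field
      degree : ℚ
      ∈Γ     : Γ degree
      repr   : R.Carrier
      bound  : repr ∈𝒫 degree
  open Term public

  Gr : Set c
  Gr = List Term

  component : ℚ → Gr → R.Carrier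
  component γ []      = R.0#
  component γ (t ∷ a) = (if does (degree t ℚ.≟ γ) then repr t else R.0#) R.+ component γ a

  infix 4 _≈_
  infixl 7 _·_ _*_

  record _≈_ (a b : Gr) : Set where
    constructor componentwise
    field at : ∀ γ → component γ a R.- component γ b ∈𝒫⁺ γ
  open _≈_ public

  _·_ : Term → Term → Term
  degree (s · t) = degree s ℚ.+ degree t
  ∈Γ     (s · t) = Γ-+ (∈Γ s) (∈Γ t)
  repr   (s · t) = repr s R.* repr t
  bound  (s · t) = 𝒫-* (bound s) (bound t)

  -ᵗ_ : Term → Term
  degree (-ᵗ t) = degree t
  ∈Γ     (-ᵗ t) = ∈Γ t
  repr   (-ᵗ t) = R.- repr t
  bound  (-ᵗ t) = 𝒫-‿ (bound t)

  _*_ : Gr → Gr → Gr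
  []      * b = []
  (t ∷ a) * b = map (t ·_) b ++ a * b

  1ᵗ : Term
  1ᵗ = record { degree = 0ℚ ; ∈Γ = Γ-0 ; repr = R.1# ; bound = 𝒫-1# }

  part : ℚ → Term → R.Carrier
  part γ t = if does (degree t ℚ.≟ γ) then repr t else R.0#

  part-∈𝒫 : ∀ γ t → part γ t ∈𝒫 γ
  part-∈𝒫 γ t with degree t ℚ.≟ γ
  ... | yes ≡.refl = bound t
  ... | no  _      = 𝒫-0#

  part-neg : ∀ γ t → part γ (-ᵗ t) R.≈ R.- part γ t
  part-neg γ t with degree t ℚ.≟ γ
  ... | yes _ = R.refl
  ... | no  _ = R.sym F.-0#≈0#

  shift⇒ : ∀ δ ε γ → δ ℚ.+ ε ≡ γ → ε ≡ γ ℚ.- δ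
  shift⇒ δ ε γ ≡.refl = ≡.sym (ℚF.xyx⁻¹≈y δ ε)

  shift⇐ : ∀ δ ε γ → ε ≡ γ ℚ.- δ → δ ℚ.+ ε ≡ γ
  shift⇐ δ ε γ ≡.refl = ≡.trans (≡.cong (δ ℚ.+_) (ℚ.+-comm γ (ℚ.- δ)))
    (≡.trans (≡.sym (ℚ.+-assoc δ (ℚ.- δ) γ))
      (≡.trans (≡.cong (ℚ._+ γ) (ℚ.+-inverseʳ δ)) (ℚ.+-identityˡ γ)))

  part-· : ∀ γ t s → part γ (t · s) R.≈ repr t R.* part (γ ℚ.- degree t) s
  part-· γ t s with degree t ℚ.+ degree s ℚ.≟ γ | degree s ℚ.≟ γ ℚ.- degree t
  ... | yes _ | yes _ = R.refl
  ... | no  _ | no  _ = R.sym (R.zeroʳ _)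
  ... | yes h | no ¬k = ⊥-elim (¬k (shift⇒ (degree t) (degree s) γ h))
  ... | no ¬h | yes k = ⊥-elim (¬h (shift⇐ (degree t) (degree s) γ k))

  component-∈𝒫 : ∀ γ a → component γ a ∈𝒫 γ
  component-∈𝒫 γ []      = 𝒫-0#
  component-∈𝒫 γ (t ∷ a) = 𝒫-+ (part-∈𝒫 γ t) (component-∈𝒫 γ a)

  component-++ : ∀ γ a b → component γ (a ++ b) R.≈ component γ a R.+ component γ b
  component-++ γ []      b = R.sym (R.+-identityˡ _)
  component-++ γ (t ∷ a) b = R.trans (R.+-congˡ (component-++ γ a b)) (R.sym (R.+-assoc _ _ _))

  component-neg : ∀ γ a → component γ (map -ᵗ_ a) R.≈ R.- component γ a
  component-neg γ []      = R.sym F.-0#≈0#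
  component-neg γ (t ∷ a) =
    R.trans (R.+-cong (part-neg γ t) (component-neg γ a)) (F.-‿+-comm (part γ t) (component γ a))

  component-· : ∀ γ t b → component γ (map (t ·_) b) R.≈ repr t R.* component (γ ℚ.- degree t) b
  component-· γ t []      = R.sym (R.zeroʳ _)
  component-· γ t (s ∷ b) =
    R.trans (R.+-cong (part-· γ t s) (component-· γ t b)) (R.sym (R.distribˡ _ _ _))

  component-resp : ∀ {γ δ} a → γ ≡ δ → component γ a R.≈ component δ a
  component-resp a ≡.refl = R.refl

  infix 4 _≋_
  record _≋_ (a b : Gr) : Set ℓ where
    constructor strictly
    field at′ : ∀ γ → component γ a R.≈ component γ b
  open _≋_

  ≋⇒≈ : ∀ {a b} → a ≋ b → a ≈ b
  ≋⇒≈ h .at γ = 𝒫⁺-resp (R.sym (F.diff-refl (h .at′ γ))) 𝒫⁺-0#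

  ≋-refl : ∀ {a} → a ≋ a
  ≋-refl .at′ γ = R.refl

  ≋-sym : ∀ {a b} → a ≋ b → b ≋ a
  ≋-sym h .at′ γ = R.sym (h .at′ γ)

  ≋-trans : ∀ {a b d} → a ≋ b → b ≋ d → a ≋ d
  ≋-trans h k .at′ γ = R.trans (h .at′ γ) (k .at′ γ)

  ≈-sym : ∀ {a b} → a ≈ b → b ≈ a
  ≈-sym {a} {b} h .at γ =
    𝒫⁺-resp (R.sym (F.diff-sym (component γ a) (component γ b))) (𝒫⁺-‿ (h .at γ))

  ≈-trans : ∀ {a b d} → a ≈ b → b ≈ d → a ≈ d
  ≈-trans {a} {b} {d} h k .at γ =
    𝒫⁺-resp (R.sym (F.diff-trans (component γ a) (component γ b) (component γ d))) (𝒫⁺-+ (h .at γ) (k .at γ))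

  ++-cong≋ : ∀ {a a′ b b′} → a ≋ a′ → b ≋ b′ → a ++ b ≋ a′ ++ b′
  ++-cong≋ {a} {a′} {b} {b′} h k .at′ γ =
    R.trans (component-++ γ a b) (R.trans (R.+-cong (h .at′ γ) (k .at′ γ)) (R.sym (component-++ γ a′ b′)))

  ++-cong : ∀ {a a′ b b′} → a ≈ a′ → b ≈ b′ → a ++ b ≈ a′ ++ b′
  ++-cong {a} {a′} {b} {b′} h k .at γ = 𝒫⁺-resp (R.sym eq) (𝒫⁺-+ (h .at γ) (k .at γ))
    where
    eq : component γ (a ++ b) R.- component γ (a′ ++ b′) R.≈
         (component γ a R.- component γ a′) R.+ (component γ b R.- component γ b′)
    eq = R.trans (R.+-cong (component-++ γ a b) (R.-‿cong (component-++ γ a′ b′)))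
                 (F.diff-+ (component γ a) (component γ b) (component γ a′) (component γ b′))

  ++-assoc : ∀ a b d → (a ++ b) ++ d ≋ a ++ (b ++ d)
  ++-assoc []      b d = ≋-refl
  ++-assoc (t ∷ a) b d .at′ γ = R.+-congˡ (++-assoc a b d .at′ γ)

  ++-comm : ∀ a b → a ++ b ≋ b ++ a
  ++-comm a b .at′ γ =
    R.trans (component-++ γ a b) (R.trans (R.+-comm _ _) (R.sym (component-++ γ b a)))

  ++-interchange : ∀ a b d e → (a ++ b) ++ (d ++ e) ≋ (a ++ d) ++ (b ++ e)
  ++-interchange a b d e .at′ γ = R.trans (expand a b d e)
    (R.trans (F.interchange _ _ _ _) (R.sym (expand a d b e)))
    where
    expand : ∀ a b d e → component γ ((a ++ b) ++ (d ++ e)) R.≈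
      (component γ a R.+ component γ b) R.+ (component γ d R.+ component γ e)
    expand a b d e = R.trans (component-++ γ (a ++ b) (d ++ e))
      (R.+-cong (component-++ γ a b) (component-++ γ d e))

  ·-comm : ∀ s t a b → a ≋ b → s · t ∷ a ≋ t · s ∷ b
  ·-comm s t a b h .at′ γ = R.+-cong (term γ) (h .at′ γ)
    where
    term : ∀ γ → part γ (s · t) R.≈ part γ (t · s)
    term γ with degree s ℚ.+ degree t ℚ.≟ γ | degree t ℚ.+ degree s ℚ.≟ γ
    ... | yes _ | yes _ = R.*-comm _ _
    ... | no  _ | no  _ = R.refl
    ... | yes h | no ¬k = ⊥-elim (¬k (≡.trans (ℚ.+-comm (degree t) (degree s)) h))
    ... | no ¬h | yes k = ⊥-elim (¬h (≡.trans (ℚ.+-comm (degree s) (degree t)) k))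

  *-[] : ∀ a → a * [] ≋ []
  *-[] []      = ≋-refl
  *-[] (t ∷ a) = *-[] a

  *-∷ʳ : ∀ a t b → a * (t ∷ b) ≋ map (t ·_) a ++ a * b
  *-∷ʳ []      t b = ≋-refl
  *-∷ʳ (s ∷ a) t b = ·-comm s t _ _
    (≋-trans (++-cong≋ (≋-refl {map (s ·_) b}) (*-∷ʳ a t b))
      (≋-trans (≋-sym (++-assoc (map (s ·_) b) (map (t ·_) a) (a * b)))
        (≋-trans (++-cong≋ (++-comm (map (s ·_) b) (map (t ·_) a)) (≋-refl {a * b}))
          (++-assoc (map (t ·_) a) (map (s ·_) b) (a * b)))))

  *-comm : ∀ a b → a * b ≋ b * a
  *-comm []      b = ≋-sym (*-[] b)
  *-comm (t ∷ a) b =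
    ≋-trans (++-cong≋ (≋-refl {map (t ·_) b}) (*-comm a b)) (≋-sym (*-∷ʳ b t a))

  ·-cong : ∀ t {a b} → a ≈ b → map (t ·_) a ≈ map (t ·_) b
  ·-cong t {a} {b} h .at γ = 𝒫⁺-resp (R.sym eq)
    (≡.subst (repr t R.* (component δ a R.- component δ b) ∈𝒫⁺_)
      (shift⇐ (degree t) δ γ ≡.refl) (𝒫⁺-* (bound t) (h .at δ)))
    where
    δ : ℚ
    δ = γ ℚ.- degree t
    eq : component γ (map (t ·_) a) R.- component γ (map (t ·_) b) R.≈
         repr t R.* (component δ a R.- component δ b)
    eq = R.trans (R.+-cong (component-· γ t a) (R.-‿cong (component-· γ t b)))
      (R.sym (F.x[y-z]≈xy-xz (repr t) (component δ a) (component δ b)))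

  *-congˡ : ∀ a {b d} → b ≈ d → a * b ≈ a * d
  *-congˡ []      h = ≋⇒≈ ≋-refl
  *-congˡ (t ∷ a) h = ++-cong (·-cong t h) (*-congˡ a h)

  *-cong : ∀ {a a′ b b′} → a ≈ a′ → b ≈ b′ → a * b ≈ a′ * b′
  *-cong {a} {a′} {b} {b′} h k = ≈-trans (*-congˡ a k)
    (≈-trans (≋⇒≈ (*-comm a b′)) (≈-trans (*-congˡ b′ h) (≋⇒≈ (*-comm b′ a′))))

  *-distribʳ : ∀ a b d → (b ++ d) * a ≋ b * a ++ d * a
  *-distribʳ a []      d = ≋-refl
  *-distribʳ a (t ∷ b) d =
    ≋-trans (++-cong≋ (≋-refl {map (t ·_) a}) (*-distribʳ a b d))
      (≋-sym (++-assoc (map (t ·_) a) (b * a) (d * a)))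

  *-distribˡ : ∀ a b d → a * (b ++ d) ≋ a * b ++ a * d
  *-distribˡ a b d = ≋-trans (*-comm a (b ++ d))
    (≋-trans (*-distribʳ a b d) (++-cong≋ (*-comm b a) (*-comm d a)))

  ·-· : ∀ t s b → map (t · s ·_) b ≋ map (t ·_) (map (s ·_) b)
  ·-· t s b .at′ γ = begin
    component γ (map (t · s ·_) b)
      ≈⟨ component-· γ (t · s) b ⟩
    (repr t R.* repr s) R.* component (γ ℚ.- (degree t ℚ.+ degree s)) b
      ≈⟨ R.*-congˡ (component-resp b degrees) ⟩
    (repr t R.* repr s) R.* component (γ ℚ.- degree t ℚ.- degree s) b
      ≈⟨ R.*-assoc _ _ _ ⟩
    repr t R.* (repr s R.* component (γ ℚ.- degree t ℚ.- degree s) b)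
      ≈⟨ R.*-congˡ (component-· (γ ℚ.- degree t) s b) ⟨
    repr t R.* component (γ ℚ.- degree t) (map (s ·_) b)
      ≈⟨ component-· γ t (map (s ·_) b) ⟨
    component γ (map (t ·_) (map (s ·_) b)) ∎
    where
    open SetoidReasoning R.setoid
    degrees : γ ℚ.- (degree t ℚ.+ degree s) ≡ γ ℚ.- degree t ℚ.- degree s
    degrees = ≡.trans (≡.cong (γ ℚ.+_) (ℚ.neg-distrib-+ (degree t) (degree s)))
      (≡.sym (ℚ.+-assoc γ (ℚ.- degree t) (ℚ.- degree s)))

  ·-cong≋ : ∀ t {a b} → a ≋ b → map (t ·_) a ≋ map (t ·_) b
  ·-cong≋ t {a} {b} h .at′ γ = R.trans (component-· γ t a)
    (R.trans (R.*-congˡ (h .at′ _)) (R.sym (component-· γ t b)))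

  ·-++ : ∀ t a b → map (t ·_) (a ++ b) ≋ map (t ·_) a ++ map (t ·_) b
  ·-++ t []      b = ≋-refl
  ·-++ t (s ∷ a) b .at′ γ = R.+-congˡ (·-++ t a b .at′ γ)

  ·-* : ∀ t a b → map (t ·_) a * b ≋ map (t ·_) (a * b)
  ·-* t []      b = ≋-refl
  ·-* t (s ∷ a) b = ≋-trans (++-cong≋ (·-· t s b) (·-* t a b))
    (≋-sym (·-++ t (map (s ·_) b) (a * b)))

  *-assoc : ∀ a b d → (a * b) * d ≋ a * (b * d)
  *-assoc []      b d = ≋-refl
  *-assoc (t ∷ a) b d = ≋-trans (*-distribʳ d (map (t ·_) b) (a * b))
    (++-cong≋ (·-* t b d) (*-assoc a b d))

  1* : ∀ a → (1ᵗ ∷ []) * a ≋ a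
  1* a = ≋-trans (++-comm (map (1ᵗ ·_) a) []) (strictly λ γ → R.trans (component-· γ 1ᵗ a)
    (R.trans (R.*-identityˡ _) (component-resp a (ℚ.+-identityʳ γ))))

  neg-inverse : ∀ a → map -ᵗ_ a ++ a ≋ []
  neg-inverse a .at′ γ = R.trans (component-++ γ (map -ᵗ_ a) a)
    (R.trans (R.+-congʳ (component-neg γ a)) (R.-‿inverseˡ _))

  neg-cong : ∀ {a b} → a ≈ b → map -ᵗ_ a ≈ map -ᵗ_ b
  neg-cong {a} {b} h .at γ = 𝒫⁺-resp
    (R.sym (R.trans (R.+-cong (component-neg γ a) (R.-‿cong (component-neg γ b)))
                    (F.diff-neg (component γ a) (component γ b))))
    (𝒫⁺-‿ (h .at γ))

  gradedRing : CommutativeRing c 0ℓ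
  gradedRing = record
    { Carrier = Gr
    ; _≈_ = _≈_
    ; _+_ = _++_
    ; _*_ = _*_
    ; -_ = map -ᵗ_
    ; 0# = []
    ; 1# = 1ᵗ ∷ []
    ; isCommutativeRing = record
      { isRing = record
        { +-isAbelianGroup = record
          { isGroup = record
            { isMonoid = record
              { isSemigroup = record
                { isMagma = record
                  { isEquivalence = record { refl = ≋⇒≈ ≋-refl ; sym = ≈-sym ; trans = ≈-trans }
                  ; ∙-cong = ++-cong
                  }
                ; assoc = λ a b d → ≋⇒≈ (++-assoc a b d)
                }
              ; identity = (λ a → ≋⇒≈ ≋-refl) , (λ a → ≋⇒≈ (++-comm a []))
              }
            ; inverse = (λ a → ≋⇒≈ (neg-inverse a))
                      , (λ a → ≋⇒≈ (≋-trans (++-comm a (map -ᵗ_ a)) (neg-inverse a)))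
            ; ⁻¹-cong = neg-cong
            }
          ; comm = λ a b → ≋⇒≈ (++-comm a b)
          }
        ; *-cong = *-cong
        ; *-assoc = λ a b d → ≋⇒≈ (*-assoc a b d)
        ; *-identity = (λ a → ≋⇒≈ (1* a))
                     , (λ a → ≋⇒≈ (≋-trans (*-comm a (1ᵗ ∷ [])) (1* a)))
        ; distrib = (λ a b d → ≋⇒≈ (*-distribˡ a b d)) , (λ a b d → ≋⇒≈ (*-distribʳ a b d))
        }
      ; *-comm = λ a b → ≋⇒≈ (*-comm a b)
      }
    }

  Homogeneous : ℚ → Gr → Set
  Homogeneous α a = ∀ β → β ≢ α → component β a ∈𝒫⁺ β

  degree₀ : CommutativeRing.Carrier (residueRing V) → Gr
  degree₀ (g , h) = record { degree = 0ℚ ; ∈Γ = Γ-0 ; repr = g ; bound = h } ∷ []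

  -- H(g) is the class of g in degree val g, and H(0) = 0.
  H : R.Carrier → Gr
  H g = initial (val g) ≡.refl
    where
    initial : ∀ w → val g ≡ w → Gr
    initial ⊤⁺    _ = []
    initial [ α ] h = record
      { degree = α
      ; ∈Γ     = Γ-val h
      ; repr   = g
      ; bound  = ≡.subst ([ α ] ≤⁺_) (≡.sym h) [ ℚ.≤-refl ]
      } ∷ []

-- The image of the map residueRing V → residueRing W induced by a ring
-- homomorphism f, when it exists (that is, when V ≤ W ∘ f).

module ResidueImage {c d ℓ ℓ′ : Level} {R : CommutativeRing c ℓ} {S : CommutativeRing d ℓ′}
  (V : Valuation R) (W : Valuation S) (f : CommutativeRing.Carrier R → CommutativeRing.Carrier S)
  (f-homo : RingMorphisms.IsRingHomomorphism (CommutativeRing.rawRing R) (CommutativeRing.rawRing S) f) where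
  private
    module S = CommutativeRing S
    module κV = CommutativeRing (residueRing V)
    module κW = CommutativeRing (residueRing W)
    module f = RingMorphisms.IsRingHomomorphism f-homo
  open RingFacts S
  open Valuation W
  open ValuationFacts W

  InImage : Pred κW.Carrier c
  InImage b = ∃[ a ] f (proj₁ {B = λ x → Valuation._∈𝒫_ V x 0ℚ} a) S.- proj₁ b ∈𝒫⁺ 0ℚ

  private
    rewriteˡ : ∀ {x x′ y} → x S.≈ x′ → x′ S.- y ∈𝒫⁺ 0ℚ → x S.- y ∈𝒫⁺ 0ℚ
    rewriteˡ h = 𝒫⁺-resp (S.+-congʳ (S.sym h))

    integral : ∀ {x y} → x S.- y ∈𝒫⁺ 0ℚ → y ∈𝒫 0ℚ → x ∈𝒫 0ℚ
    integral {x} {y} h k = 𝒫-resp (//-rightDividesˡ y x) (𝒫-+ (𝒫⁺⇒𝒫 h) k)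

  image : CommutativeRing (c ⊔ d) 0ℓ
  image = subquotient {R = residueRing W} record
    { P = InImage
    ; Q = κW._≈ κW.0#
    ; P-0# = κV.0# , rewriteˡ f.0#-homo (𝒫⁺-resp (S.sym (diff-refl S.refl)) 𝒫⁺-0#)
    ; P-1# = κV.1# , rewriteˡ f.1#-homo (𝒫⁺-resp (S.sym (diff-refl S.refl)) 𝒫⁺-0#)
    ; P-+ = λ { {b , _} {b′ , _} (a , h) (a′ , h′) → a κV.+ a′ ,
        rewriteˡ (f.+-homo (proj₁ a) (proj₁ a′))
          (𝒫⁺-resp (S.sym (diff-+ (f (proj₁ a)) (f (proj₁ a′)) b b′)) (𝒫⁺-+ h h′)) }
    ; P-* = λ { {b , k} {b′ , k′} (a , h) (a′ , h′) → a κV.* a′ ,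
        rewriteˡ (f.*-homo (proj₁ a) (proj₁ a′))
          (𝒫⁺-resp (S.sym (diff-* (f (proj₁ a)) (f (proj₁ a′)) b b′))
            (𝒫⁺-+ (𝒫⁺-* (integral h k) h′) (𝒫⁺-* k′ h))) }
    ; P-‿ = λ { {b , _} (a , h) → κV.- a ,
        rewriteˡ (f.-‿homo (proj₁ a)) (𝒫⁺-resp (S.sym (diff-neg (f (proj₁ a)) b)) (𝒫⁺-‿ h)) }
    ; Q-0# = κW.refl
    ; Q-+ = λ h k → κW.trans (κW.+-cong h k) (κW.+-identityˡ κW.0#)
    ; Q-‿ = λ h → κW.trans (κW.-‿cong h) (RingFacts.-0#≈0# (residueRing W))
    ; Q-* = λ {x} _ k → κW.trans (κW.*-congˡ k) (κW.zeroʳ x)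
    ; Q-resp = λ h k → κW.trans (κW.sym h) k
    }

module Units {c ℓ : Level} (R : CommutativeRing c ℓ) where
  open CommutativeRing R
  open RawSemiringDefinitions (Semiring.rawSemiring semiring) using (_^_)
  open CommutativeSemigroupProperties *-commutativeSemigroup using (interchange)

  IsUnit : Pred Carrier (c ⊔ ℓ)
  IsUnit = Invertible _≈_ 1# _*_

  Unit : Set (c ⊔ ℓ)
  Unit = Σ Carrier IsUnit

  infixl 7 _∙_
  infix 8 _⁻¹ _^ᵘ_ _^ᶻ_

  _∙_ : Unit → Unit → Unit
  (a , a⁻¹ , h , k) ∙ (b , b⁻¹ , h′ , k′) = a * b , a⁻¹ * b⁻¹
    , trans (interchange a⁻¹ b⁻¹ a b) (trans (*-cong h h′) (*-identityˡ 1#))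
    , trans (interchange a b a⁻¹ b⁻¹) (trans (*-cong k k′) (*-identityˡ 1#))

  _⁻¹ : Unit → Unit
  (a , a⁻¹ , h , k) ⁻¹ = a⁻¹ , a , k , h

  _^ᵘ_ : Unit → ℕ → Unit
  a ^ᵘ zero  = 1# , 1# , *-identityˡ 1# , *-identityˡ 1#
  a ^ᵘ suc n = a ∙ (a ^ᵘ n)

  _^ᶻ_ : Unit → ℤ → Unit
  a ^ᶻ (+ n)    = a ^ᵘ n
  a ^ᶻ -[1+ n ] = (a ⁻¹) ^ᵘ suc n

record DiscreteValuation {c ℓ : Level} (K : Field c ℓ) : Set (c ⊔ ℓ) where
  open Field K
  field
    valuation : Valuation commutativeRing
  open Valuation valuation public
  field
    val-image : ∀ q → (∃[ a ] val a ≡ [ q ]) ⇔ (∃[ n ] q ≡ fromℤ n)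

  -- 𝔪 = π𝒪.
  IsUniformizer : Pred Carrier (c ⊔ ℓ)
  IsUniformizer π = ∀ a → a ∈𝒫⁺ 0ℚ ⇔ (∃[ b ] b ∈𝒫 0ℚ × a ≈ π * b)

record RawGradedAlgebra {f g : Level} (F : CommutativeRing f g) (c ℓ h : Level) : Set (lsuc (c ⊔ ℓ ⊔ h) ⊔ f) where
  field
    commutativeRing : CommutativeRing c ℓ
  open CommutativeRing commutativeRing public using (Carrier; _≈_; rawRing)
  field
    algebraMap  : CommutativeRing.Carrier F → Carrier
    Homogeneous : ℚ → Carrier → Set h

record GradedIsomorphism {f g c ℓ h c′ ℓ′ h′ : Level} {F : CommutativeRing f g}
  (A : RawGradedAlgebra F c ℓ h) (B : RawGradedAlgebra F c′ ℓ′ h′) : Set (f ⊔ c ⊔ ℓ ⊔ h ⊔ c′ ⊔ ℓ′ ⊔ h′) where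
  private
    module A = RawGradedAlgebra A
    module B = RawGradedAlgebra B
  field
    ⟦_⟧               : A.Carrier → B.Carrier
    isRingIsomorphism : RingMorphisms.IsRingIsomorphism A.rawRing B.rawRing ⟦_⟧
    algebraMap-homo   : ∀ k → ⟦ A.algebraMap k ⟧ B.≈ B.algebraMap k
    homogeneous       : ∀ α a → A.Homogeneous α a ⇔ B.Homogeneous α ⟦ a ⟧

-- A[p, p⁻¹] = A[p][q] / (p q - 1).

module Laurent {c ℓ : Level} (A : CommutativeRing c ℓ) where
  A[p] A[p][q] : CommutativeRing c ℓ
  A[p]    = Polynomial.polyRing A
  A[p][q] = Polynomial.polyRing A[p]

  open CommutativeRing A[p][q]

  relation : Carrier
  relation = Polynomial.constant A[p] (Polynomial.X A) * Polynomial.X A[p] - 1#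

  A[p,p⁻¹] : CommutativeRing c (c ⊔ ℓ)
  A[p,p⁻¹] = Quotient.ring/f A[p][q] relation

  constant : CommutativeRing.Carrier A → CommutativeRing.Carrier A[p,p⁻¹]
  constant a = Quotient.[_]/ A[p][q] relation (Polynomial.constant A[p] (Polynomial.constant A a))

  p p⁻¹ : CommutativeRing.Carrier A[p,p⁻¹]
  p   = Quotient.[_]/ A[p][q] relation (Polynomial.constant A[p] (Polynomial.X A))
  p⁻¹ = Quotient.[_]/ A[p][q] relation (Polynomial.X A[p])

-- A[x] with xᵉ = a, that is, A[x] / (xᵉ - a).

module AdjoinRoot {c ℓ : Level} (A : CommutativeRing c ℓ) (e : ℕ) (a : CommutativeRing.Carrier A) where
  A[X] : CommutativeRing c ℓ
  A[X] = Polynomial.polyRing A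

  open CommutativeRing A[X]
  open RawSemiringDefinitions (Semiring.rawSemiring semiring) using (_^_)

  relation : Carrier
  relation = Polynomial.X A ^ e - Polynomial.constant A a

  A[x] : CommutativeRing c (c ⊔ ℓ)
  A[x] = Quotient.ring/f A[X] relation

  constant : CommutativeRing.Carrier A → CommutativeRing.Carrier A[x]
  constant b = Quotient.[_]/ A[X] relation (Polynomial.constant A b)

  x : CommutativeRing.Carrier A[x]
  x = Quotient.[_]/ A[X] relation (Polynomial.X A)

-- The grading of an algebra generated by elements y, p, p⁻¹, x for which
-- scalars and y have degree 0, p has degree δ and x has degree lam.

module Grading {f c ℓ : Level} {Scalar : Set f} (A : CommutativeRing c ℓ) (δ lam : ℚ)
  (scalar : Scalar → CommutativeRing.Carrier A) (y p p⁻¹ x : CommutativeRing.Carrier A) where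
  open CommutativeRing A

  data Homogeneous : ℚ → Carrier → Set (f ⊔ c ⊔ ℓ) where
    scalar-homogeneous : ∀ k → Homogeneous 0ℚ (scalar k)
    y-homogeneous      : Homogeneous 0ℚ y
    p-homogeneous      : Homogeneous δ p
    p⁻¹-homogeneous    : Homogeneous (ℚ.- δ) p⁻¹
    x-homogeneous      : Homogeneous lam x
    0-homogeneous      : ∀ {α} → Homogeneous α 0#
    +-homogeneous      : ∀ {α a b} → Homogeneous α a → Homogeneous α b → Homogeneous α (a + b)
    *-homogeneous      : ∀ {α β a b} → Homogeneous α a → Homogeneous β b → Homogeneous (α ℚ.+ β) (a * b)
    ≈-homogeneous      : ∀ {α a b} → a ≈ b → Homogeneous α a → Homogeneous α b

-- F[y, p, p⁻¹][x] with xᵉ = pʰ y.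

module Presentation {c ℓ : Level} (F : CommutativeRing c ℓ) (e h : ℕ) where

  F[y] : CommutativeRing c ℓ
  F[y] = Polynomial.polyRing F

  F[y,p,p⁻¹] : CommutativeRing c (c ⊔ ℓ)
  F[y,p,p⁻¹] = Laurent.A[p,p⁻¹] F[y]

  pʰy : CommutativeRing.Carrier F[y,p,p⁻¹]
  pʰy = (Laurent.p F[y] ^ h) * Laurent.constant F[y] (Polynomial.X F)
    where
    open CommutativeRing F[y,p,p⁻¹]
    open RawSemiringDefinitions (Semiring.rawSemiring semiring) using (_^_)

  F[y,p,p⁻¹][x] : CommutativeRing c (c ⊔ ℓ)
  F[y,p,p⁻¹][x] = AdjoinRoot.A[x] F[y,p,p⁻¹] e pʰy

  private
    coefficient : CommutativeRing.Carrier F[y,p,p⁻¹] → CommutativeRing.Carrier F[y,p,p⁻¹][x]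
    coefficient = AdjoinRoot.constant F[y,p,p⁻¹] e pʰy

  scalar : CommutativeRing.Carrier F → CommutativeRing.Carrier F[y,p,p⁻¹][x]
  scalar k = coefficient (Laurent.constant F[y] (Polynomial.constant F k))

  y p p⁻¹ x : CommutativeRing.Carrier F[y,p,p⁻¹][x]
  y   = coefficient (Laurent.constant F[y] (Polynomial.X F))
  p   = coefficient (Laurent.p F[y])
  p⁻¹ = coefficient (Laurent.p⁻¹ F[y])
  x   = AdjoinRoot.x F[y,p,p⁻¹] e pʰy

  gradedAlgebra : ℚ → ℚ → RawGradedAlgebra F c (c ⊔ ℓ) (c ⊔ ℓ)
  gradedAlgebra δ lam = record
    { commutativeRing = F[y,p,p⁻¹][x]
    ; algebraMap      = scalar
    ; Homogeneous     = Grading.Homogeneous F[y,p,p⁻¹][x] δ lam scalar y p p⁻¹ x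
    }

module _ {c ℓ : Level} {K : Field c ℓ} (v : DiscreteValuation K) where
  private
    module K = Field K
    module v = DiscreteValuation v

  open Polynomial K.commutativeRing

  K[x] : CommutativeRing c ℓ
  K[x] = polyRing

  open RawSemiringDefinitions (Semiring.rawSemiring (CommutativeRing.semiring K[x])) using (_^_)

  -- A valuation on K(x) is given by its restriction to K[x].
  record 𝕍 : Set (c ⊔ ℓ) where
    field
      valuation : Valuation K[x]
    open Valuation valuation public
    field
      extends  : ∀ a → val (constant a) ≡ v.val a
      x≥0      : [ 0ℚ ] ≤⁺ val X
      e        : ℕ
      e≢0      : ℕ.NonZero e
      eΓ≡ℤ     : ∀ α → Γ α ⇔ (∃[ n ] fromℕ e ℚ.* α ≡ fromℤ n)

  IsGauss : 𝕍 → Set c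
  IsGauss μ = ∀ f → 𝕍.val μ f ≡ foldr (λ a w → v.val a ⊓⁺ w) ⊤⁺ f

  record IsKeyPolynomial (μ : 𝕍) (φ : Poly) : Set (c ⊔ ℓ) where
    open GradedRing (𝕍.valuation μ) using (H; gradedRing)
    open RawSemiringDefinitions (Semiring.rawSemiring (CommutativeRing.semiring gradedRing)) using (_∣_; Prime)
    field
      monic   : MonicOfPositiveDegree φ
      prime   : Prime (H φ)
      minimal : ∀ g → ¬ g ≈ [] → g deg< φ → ¬ H φ ∣ H g

  -- min over s of μ(g_s φˢ) + s lam, the list being g_k, g_{k+1}, ….
  augmentedValue : 𝕍 → Poly → ℚ → ℕ → List Poly → ℚ ⁺
  augmentedValue μ φ lam k []       = ⊤⁺
  augmentedValue μ φ lam k (g ∷ gs) =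
    (𝕍.val μ (g * (φ ^ k)) +⁺ [ fromℕ k ℚ.* lam ]) ⊓⁺ augmentedValue μ φ lam (suc k) gs

  -- μ′ = [μ; (φ, lam)].
  IsAugmentation : 𝕍 → Poly → ℚ → 𝕍 → Set (c ⊔ ℓ)
  IsAugmentation μ φ lam μ′ =
    ∀ f gs → IsExpansion φ f gs → 𝕍.val μ′ f ≡ augmentedValue μ φ lam 0 gs

  -- Only the values at indices ≤ r are meaningful.
  record MacLaneChain (r : ℕ) : Set (c ⊔ ℓ) where
    field
      μ   : ℕ → 𝕍
      φ   : ℕ → Poly
      lam : ℕ → ℚ
      μ-0   : IsGauss (μ 0)
      φ-0   : φ 0 ≈ X
      lam-0 : lam 0 ≡ 0ℚ
      key          : ∀ i → i ℕ.< r → IsKeyPolynomial (μ i) (φ (suc i))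
      lam>0        : ∀ i → i ℕ.< r → 0ℚ ℚ.< lam (suc i)
      augmentation : ∀ i → i ℕ.< r → IsAugmentation (μ i) (φ (suc i)) (lam (suc i)) (μ (suc i))
      ≁            : ∀ i → 1 ℕ.≤ i → i ℕ.< r →
        ¬ GradedRing._≈_ (𝕍.valuation (μ i))
            (GradedRing.H (𝕍.valuation (μ i)) (φ (suc i)))
            (GradedRing.H (𝕍.valuation (μ i)) (φ i))

    eμ : ℕ → ℕ
    eμ i = 𝕍.e (μ i)

    -- e(μᵢ₋₁), where μ₋₁ = μ₀.
    eμ₋₁ : ℕ → ℕ
    eμ₋₁ zero    = eμ 0
    eμ₋₁ (suc i) = eμ i

    eμ₋₁≢0 : ∀ i → ℕ.NonZero (eμ₋₁ i)
    eμ₋₁≢0 zero    = 𝕍.e≢0 (μ 0)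
    eμ₋₁≢0 (suc i) = 𝕍.e≢0 (μ i)

    𝔽 : ℕ → CommutativeRing c 0ℓ
    𝔽 zero    = ResidueImage.image v.valuation (𝕍.valuation (μ 0)) constant constant-isRingHomomorphism
    𝔽 (suc i) = ResidueImage.image (𝕍.valuation (μ i)) (𝕍.valuation (μ (suc i))) id
      (Identity.isRingHomomorphism (CommutativeRing.rawRing K[x]) (CommutativeRing.refl K[x]))

  -- The equations determine this data uniquely (at the indices they mention);
  -- so do the inverses of units.
  record ChainData (π : K.Carrier) {r : ℕ} (chain : MacLaneChain r) : Set (c ⊔ ℓ) where
    open MacLaneChain chain
    open GradedRing (𝕍.valuation (μ r)) using (Gr; H; gradedRing; degree₀; Homogeneous)
    private
      module Gr = CommutativeRing gradedRing
      open RawSemiringDefinitions (Semiring.rawSemiring Gr.semiring) using () renaming (_^_ to _^ᴳ_)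
    open Units gradedRing
    field
      e h l : ℕ → ℕ
      l′ V  : ℕ → ℤ
      e-def : ∀ i → i ℕ.≤ r → eμ i ≡ e i ℕ.* eμ₋₁ i
      h-def : ∀ i → i ℕ.≤ r → fromℕ (eμ i) ℚ.* lam i ≡ fromℕ (h i)
      V-def : ∀ i → i ℕ.< r → fromℕ (eμ i) ·⁺ 𝕍.val (μ i) (φ (suc i)) ≡ [ fromℤ (V (suc i)) ]
      l-def : ∀ i → i ℕ.≤ r → + l i ℤ.* + h i ℤ.+ l′ i ℤ.* + e i ≡ ℤ.1ℤ
      l<e   : ∀ i → i ℕ.≤ r → l i ℕ.< e i
      s     : ℚ → ℕ
      u     : ℚ → ℤ
      s-u-def : ∀ α → 𝕍.Γ (μ r) α →
        fromℤ (u α) ℚ.* fromℕ (e r) ℚ.+ fromℕ (s α) ℚ.* fromℕ (h r) ≡ fromℕ (eμ r) ℚ.* α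
      s<e     : ∀ α → 𝕍.Γ (μ r) α → s α ℕ.< e r
      π-unit : IsUnit (H (constant π))
      φ-unit : ∀ k → 1 ℕ.≤ k → k ℕ.< r → IsUnit (H (φ k))

    -- Hπ and HΦ apply H = H_μᵣ to the factors of the rational functions πᵢ and
    -- Φᵢ, where πᵢ₊₁ = Φᵢ^lᵢ πᵢ^l′ᵢ and Φᵢ = φᵢ πᵢ^(-Vᵢ).
    nextπ : ℕ → Unit → Unit → Unit
    nextπ i φᵢ πᵢ = ((φᵢ ∙ (πᵢ ^ᶻ (ℤ.- V i))) ^ᶻ (+ l i)) ∙ (πᵢ ^ᶻ l′ i)

    Hπ : ∀ i → i ℕ.≤ r → Unit
    Hπ zero          _  = H (constant π) , π-unit
    Hπ (suc zero)    _  = H (constant π) , π-unit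
    Hπ (suc (suc i)) i≤ =
      nextπ (suc i) (H (φ (suc i)) , φ-unit (suc i) (s≤s z≤n) i≤) (Hπ (suc i) (ℕ.<⇒≤ i≤))

    HΦ : ∀ i → i ℕ.≤ r → Gr
    HΦ zero    _  = H (φ 0)
    HΦ (suc i) i≤ = H (φ (suc i)) Gr.* proj₁ (Hπ (suc i) i≤ ^ᶻ (ℤ.- V (suc i)))

    xᵣ : Gr
    xᵣ = HΦ r ℕ.≤-refl

    pᵣ : Unit
    pᵣ = Hπ r ℕ.≤-refl

    φᵣ : ℚ → Gr
    φᵣ α = (xᵣ ^ᴳ s α) Gr.* proj₁ (pᵣ ^ᶻ u α)

    -- Gr(μᵣ) = ⨁ φᵣ(α)Δ: by construction Gr(μᵣ) is the direct sum of its
    -- homogeneous components, so this says that they are the φᵣ(α)Δ.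
    Gr≡⨁φᵣΔ : Set c
    Gr≡⨁φᵣΔ = ∀ α → 𝕍.Γ (μ r) α → ∀ a →
      Homogeneous α a ⇔ (∃[ δ ] a Gr.≈ φᵣ α Gr.* degree₀ δ)

    GrAlgebra : RawGradedAlgebra (𝔽 r) c 0ℓ 0ℓ
    GrAlgebra = record
      { commutativeRing = gradedRing
      ; algebraMap      = λ b → degree₀ (algebraMap′ r b)
      ; Homogeneous     = Homogeneous
      }
      where
      algebraMap′ : ∀ i → CommutativeRing.Carrier (𝔽 i) → CommutativeRing.Carrier (residueRing (𝕍.valuation (μ i)))
      algebraMap′ zero    = proj₁
      algebraMap′ (suc i) = proj₁

    presentedAlgebra : RawGradedAlgebra (𝔽 r) c c c
    presentedAlgebra = Presentation.gradedAlgebra (𝔽 r) (e r) (h r)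
      ((+ 1) / eμ₋₁ r) (lam r)
      where instance
        nonZero : ℕ.NonZero (eμ₋₁ r)
        nonZero = eμ₋₁≢0 r

{-# OPTIONS --safe #-}

-- Call a polynomial small if its degree is less than deg φᵣ. Bézout modulo φᵣ and the
-- primality of H(φᵣ) for μᵣ₋₁ show that the class of a small polynomial is a unit of Gr(μᵣ),
-- with a small inverse, and that products of small classes are small. So small classes form
-- a graded field D, and by φᵣ-expansion Gr(μᵣ) is the polynomial ring D[H(φᵣ)]. Its degree-zero
-- part is 𝔽ᵣ, and pᵣ is small of degree 1/e(μᵣ₋₁), which generates the degrees of D; hence
-- D = 𝔽ᵣ[pᵣ, pᵣ⁻¹]. Since xᵣ is H(φᵣ) times a unit of D, Gr(μᵣ) = 𝔽ᵣ[pᵣ, pᵣ⁻¹][xᵣ].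
-- This is the presented algebra: the relation xᵉ = pʰy eliminates y.
--
-- The induction along the chain needs that φᵢ is a unit for μᵢ₊₁ with unchanged value. Hence
-- every value of μᵢ is the value of a unit for μᵢ₊₁, so e(μᵢ) divides e(μᵢ₊₁), and Γ(μᵢ) is
-- generated by 1/e(μᵢ₋₁) and λᵢ, so hᵢ and eᵢ are coprime.

module Submission where

open import Defs
open import Algebra.Bundles using (CommutativeRing; module Semiring)
import Algebra.Definitions.RawSemiring as RawSemiringDefinitions
import Algebra.Morphism.Construct.Identity as Identity
open import Algebra.Morphism.Structures using (module RingMorphisms)
import Algebra.Properties.CommutativeSemigroup as CommutativeSemigroupProperties
open import Data.Empty using (⊥-elim)
open import Data.Integer.Base as ℤ using (ℤ; +_; -[1+_])
import Data.Integer.DivMod as ℤ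
import Data.Integer.Properties as ℤ
import Data.Integer.Solver
open import Data.List.Base using (List; []; _∷_; _++_; map)
open import Data.List.Relation.Unary.All as All using (All; []; _∷_)
open import Data.Nat.Base as ℕ using (ℕ; zero; suc; z≤n; s≤s)
import Data.Nat.Properties as ℕ
open import Data.Product.Base using (Σ; ∃-syntax; Σ-syntax; _×_; _,_; proj₁; proj₂)
open import Data.Rational.Base as ℚ using (ℚ; 0ℚ; _/_)
import Data.Rational.Properties as ℚ
open import Data.Rational.Solver using (module +-*-Solver)
import Data.Rational.Unnormalised as ℚᵘ
import Data.Rational.Unnormalised.Properties as ℚᵘ
open import Data.Sum.Base using (_⊎_; inj₁; inj₂)
open import Function.Base using (id)
open import Function.Bundles using (mk⇔; module Equivalence)
open import Level using (Level; 0ℓ; _⊔_; Lift; lift) renaming (suc to lsuc)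
open import Relation.Binary.Definitions using (tri<; tri≈; tri>)
open import Relation.Binary.PropositionalEquality.Core as ≡ using (_≡_; _≢_)
open import Relation.Binary.PropositionalEquality.Properties using (module ≡-Reasoning)
import Relation.Binary.Reasoning.Setoid as SetoidReasoning
open import Relation.Nullary.Construct.Add.Supremum using (_⁺; ⊤⁺; [_]; []-injective)
open import Relation.Nullary.Decidable.Core using (Dec; yes; no)
open import Relation.Nullary.Negation.Core using (¬_)
open RingMorphisms using (IsRingHomomorphism)

-- Small polynomials are not closed under multiplication. Reduction modulo the key polynomial φ is
-- nevertheless compatible with classes, because augmentation raises the value of φ by λ > 0 and
-- leaves small values alone. If `f` has old value at least γ, minimality of φ forbids cancellation
-- between its remainder and the multiple of φ; that multiple then gains strictly and vanishes in
-- degree γ, so `f` and its remainder have the same class for the new valuation. The isomorphism is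
-- obtained as the inverse of a map from the presented algebra to Gr, since that is the direction in
-- which generators and relations define homomorphisms. Surjectivity is φ-expansion. For
-- injectivity, elements of the nested quotients have no canonical form to compare; multiplying by a
-- power of the unit p moves any of them into the image of F[p][x], where the kernel is trivial
-- because a multiple of φ never cancels a small element. The bottom valuation μ₀ is not an
-- augmentation, and 𝔽₀ comes from v. With x as φ and the constants as small polynomials it
-- satisfies the same interface, so the structure theorem is proved once, from that interface.

-- Integers inside the rationals.

module RationalFacts where
  open +-*-Solver

  [x+y]-x≡y : ∀ x y → (x ℚ.+ y) ℚ.- x ≡ y
  [x+y]-x≡y = solve 2 (λ x y → (x :+ y) :- x := y) ≡.refl

  x+[y-x]≡y : ∀ x y → x ℚ.+ (y ℚ.- x) ≡ y
  x+[y-x]≡y = solve 2 (λ x y → x :+ (y :- x) := y) ≡.refl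

  +-cancel-< : ∀ x {y z} → x ℚ.+ y ℚ.< x ℚ.+ z → y ℚ.< z
  +-cancel-< x {y} {z} h = ≡.subst₂ ℚ._<_ (cancelled y) (cancelled z) (ℚ.+-monoʳ-< (ℚ.- x) h)
    where
    cancelled : ∀ y → ℚ.- x ℚ.+ (x ℚ.+ y) ≡ y
    cancelled = solve 2 (λ x y → :- x :+ (x :+ y) := y) ≡.refl x

  private
    module ℤS = Data.Integer.Solver.+-*-Solver

    toℚᵘ-fromℤ : ∀ n → ℚ.toℚᵘ (fromℤ n) ℚᵘ.≃ ℚᵘ.mkℚᵘ n 0
    toℚᵘ-fromℤ n = ℚ.toℚᵘ-fromℚᵘ (ℚᵘ.mkℚᵘ n 0)

  fromℤ-+ : ∀ m n → fromℤ (m ℤ.+ n) ≡ fromℤ m ℚ.+ fromℤ n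
  fromℤ-+ m n = ℚ.toℚᵘ-injective (begin
    ℚ.toℚᵘ (fromℤ (m ℤ.+ n))                    ≈⟨ toℚᵘ-fromℤ (m ℤ.+ n) ⟩
    ℚᵘ.mkℚᵘ (m ℤ.+ n) 0                         ≈⟨ ℚᵘ.*≡* (solve₂ m n) ⟩
    ℚᵘ.mkℚᵘ m 0 ℚᵘ.+ ℚᵘ.mkℚᵘ n 0                ≈⟨ ℚᵘ.+-cong (toℚᵘ-fromℤ m) (toℚᵘ-fromℤ n) ⟨
    ℚ.toℚᵘ (fromℤ m) ℚᵘ.+ ℚ.toℚᵘ (fromℤ n)      ≈⟨ ℚ.toℚᵘ-homo-+ (fromℤ m) (fromℤ n) ⟨
    ℚ.toℚᵘ (fromℤ m ℚ.+ fromℤ n)                ∎)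
    where
    open SetoidReasoning ℚᵘ.≃-setoid
    solve₂ : ∀ m n → (m ℤ.+ n) ℤ.* (+ 1) ≡ (m ℤ.* (+ 1) ℤ.+ n ℤ.* (+ 1)) ℤ.* (+ 1)
    solve₂ = ℤS.solve 2 (λ m n → (m ℤS.:+ n) ℤS.:* ℤS.con (+ 1) ℤS.:=
      (m ℤS.:* ℤS.con (+ 1) ℤS.:+ n ℤS.:* ℤS.con (+ 1)) ℤS.:* ℤS.con (+ 1)) ≡.refl

  fromℤ-* : ∀ m n → fromℤ (m ℤ.* n) ≡ fromℤ m ℚ.* fromℤ n
  fromℤ-* m n = ℚ.toℚᵘ-injective (begin
    ℚ.toℚᵘ (fromℤ (m ℤ.* n))                    ≈⟨ toℚᵘ-fromℤ (m ℤ.* n) ⟩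
    ℚᵘ.mkℚᵘ m 0 ℚᵘ.* ℚᵘ.mkℚᵘ n 0                ≈⟨ ℚᵘ.*-cong (toℚᵘ-fromℤ m) (toℚᵘ-fromℤ n) ⟨
    ℚ.toℚᵘ (fromℤ m) ℚᵘ.* ℚ.toℚᵘ (fromℤ n)      ≈⟨ ℚ.toℚᵘ-homo-* (fromℤ m) (fromℤ n) ⟨
    ℚ.toℚᵘ (fromℤ m ℚ.* fromℤ n)                ∎)
    where open SetoidReasoning ℚᵘ.≃-setoid

  fromℤ-injective : ∀ m n → fromℤ m ≡ fromℤ n → m ≡ n
  fromℤ-injective m n h with ℚᵘ.≃-trans (ℚᵘ.≃-sym (toℚᵘ-fromℤ m)) (ℚᵘ.≃-trans (ℚ.toℚᵘ-cong h) (toℚᵘ-fromℤ n))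
  ... | ℚᵘ.*≡* e = ≡.trans (≡.sym (ℤ.*-identityʳ m)) (≡.trans e (ℤ.*-identityʳ n))

  fromℤ-neg : ∀ n → fromℤ (ℤ.- n) ≡ ℚ.- fromℤ n
  fromℤ-neg n = ℚF.+-inverseˡ-unique _ _ (≡.trans (≡.sym (fromℤ-+ (ℤ.- n) n)) (≡.cong fromℤ (ℤ.+-inverseˡ n)))
    where module ℚF = RingFacts ℚ.+-*-commutativeRing

  fromℕ-suc : ∀ n → fromℕ (suc n) ≡ ℚ.1ℚ ℚ.+ fromℕ n
  fromℕ-suc n = fromℤ-+ (+ 1) (+ n)

  recip : ∀ n .{{_ : ℕ.NonZero n}} → fromℕ n ℚ.* ((+ 1) / n) ≡ ℚ.1ℚ
  recip (suc n) = ℚ.toℚᵘ-injective (begin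
    ℚ.toℚᵘ (fromℕ (suc n) ℚ.* ((+ 1) / suc n))               ≈⟨ ℚ.toℚᵘ-homo-* (fromℕ (suc n)) ((+ 1) / suc n) ⟩
    ℚ.toℚᵘ (fromℕ (suc n)) ℚᵘ.* ℚ.toℚᵘ ((+ 1) / suc n)        ≈⟨ ℚᵘ.*-cong (toℚᵘ-fromℤ (+ suc n)) (ℚ.toℚᵘ-fromℚᵘ (ℚᵘ.mkℚᵘ (+ 1) n)) ⟩
    ℚᵘ.mkℚᵘ (+ suc n) 0 ℚᵘ.* ℚᵘ.mkℚᵘ (+ 1) n                  ≈⟨ ℚᵘ.*-inverseʳ (ℚᵘ.mkℚᵘ (+ suc n) 0) ⟩
    ℚᵘ.1ℚᵘ                                                    ∎)
    where open SetoidReasoning ℚᵘ.≃-setoid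

  scale-cancel : ∀ {n q} α .{{_ : ℕ.NonZero n}} → fromℕ n ℚ.* α ≡ q → α ≡ q ℚ.* ((+ 1) / n)
  scale-cancel {n} {q} α h = ≡.sym (≡.trans (≡.cong (ℚ._* ((+ 1) / n)) (≡.sym h))
    (≡.trans (solve 3 (λ n α δ → (n :* α) :* δ := (n :* δ) :* α) ≡.refl (fromℕ n) α ((+ 1) / n))
      (≡.trans (≡.cong (ℚ._* α) (recip n)) (ℚ.*-identityˡ α))))

  scale-injective : ∀ n α β .{{_ : ℕ.NonZero n}} → fromℕ n ℚ.* α ≡ fromℕ n ℚ.* β → α ≡ β
  scale-injective n α β h = ≡.trans (scale-cancel {n} α h) (≡.sym (scale-cancel {n} β ≡.refl))

  scale : ∀ n q .{{_ : ℕ.NonZero n}} → fromℕ n ℚ.* (q ℚ.* ((+ 1) / n)) ≡ q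
  scale n q = ≡.trans (solve 3 (λ n q δ → n :* (q :* δ) := q :* (n :* δ)) ≡.refl (fromℕ n) q ((+ 1) / n))
    (≡.trans (≡.cong (q ℚ.*_) (recip n)) (ℚ.*-identityʳ q))

  0<recip : ∀ n .{{_ : ℕ.NonZero n}} → 0ℚ ℚ.< (+ 1) / n
  0<recip (suc n) = ℚ.positive⁻¹ ((+ 1) / suc n) {{ℚ.normalize-pos 1 (suc n)}}

  -- The gcd removed by normalisation is gcd(n, 1) = 1. This lets an integer be read back from a
  -- rational known to be integral.
  numerator-fromℤ : ∀ n → ℚ.↥ (fromℤ n) ≡ n
  numerator-fromℤ n = ≡.trans (≡.sym (ℤ.*-identityʳ _)) (≡.trans
    (≡.cong (λ d → ℚ.↥ (fromℤ n) ℤ.* (+ d)) (≡.sym (gcd-zeroʳ ℤ.∣ n ∣))) (ℚ.↥-/ n 1))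
    where open import Data.Nat.GCD using (gcd-zeroʳ)

  fromℤ-nonNegative : ∀ n → 0ℚ ℚ.≤ fromℤ n → fromℕ ℤ.∣ n ∣ ≡ fromℤ n
  fromℤ-nonNegative n h = ≡.cong fromℤ (ℤ.0≤i⇒+∣i∣≡i (≡.subst (+ 0 ℤ.≤_)
    (≡.trans (ℤ.*-identityʳ _) (numerator-fromℤ n)) (ℚ.drop-*≤* h)))

  multiple-scale : ∀ {m} e n .{{_ : ℕ.NonZero n}} → m ≡ e ℕ.* n → fromℕ m ℚ.* ((+ 1) / n) ≡ fromℕ e
  multiple-scale e n ≡.refl = ≡.trans (≡.cong (ℚ._* ((+ 1) / n)) (≡.trans (≡.cong fromℤ (ℤ.pos-* e n)) (fromℤ-* (+ e) (+ n))))
    (≡.trans (ℚ.*-assoc (fromℕ e) (fromℕ n) ((+ 1) / n)) (≡.trans (≡.cong (fromℕ e ℚ.*_) (recip n)) (ℚ.*-identityʳ (fromℕ e))))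

open RationalFacts public

-- Congruence modulo the 𝒫⁺.

module ValuationProperties {c ℓ : Level} {R : CommutativeRing c ℓ} (V : Valuation R) where
  open CommutativeRing R
  open Valuation V public
  open ValuationFacts V public
  open RingFacts R using (diff-refl; diff-sym; diff-trans; diff-+; diff-*; -0#≈0#; //-rightDividesˡ; xyx⁻¹≈y)

  infix 4 _∼[_]_

  -- On `𝒫 γ` this is equality of classes in degree `γ`; computations in the graded ring are mostly
  -- carried out on representatives with it.
  _∼[_]_ : Carrier → ℚ → Carrier → Set
  f ∼[ γ ] g = f - g ∈𝒫⁺ γ

  val-split : ∀ f → f ≈ 0# ⊎ (∃[ α ] val f ≡ [ α ])
  val-split f with val f in eq
  ... | [ α ] = inj₂ (α , ≡.refl)
  ... | ⊤⁺    = inj₁ (Equivalence.to (val-∞ f) eq)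

  val≢⊤ : ∀ {f α} → val f ≡ [ α ] → ¬ f ≈ 0#
  val≢⊤ h k with ≡.trans (≡.sym h) (≡.trans (val-cong k) val-0#)
  ... | ()

  -- Inspecting the value decides this, since exactly zero has value ∞. It is the source of all
  -- decisions about coefficients below.
  ≈0? : ∀ f → Dec (f ≈ 0#)
  ≈0? f with val-split f
  ... | inj₁ h       = yes h
  ... | inj₂ (_ , h) = no (val≢⊤ h)

  val-nonzero : ∀ {f} → ¬ f ≈ 0# → ∃[ α ] val f ≡ [ α ]
  val-nonzero {f} h with val-split f
  ... | inj₁ k = ⊥-elim (h k)
  ... | inj₂ k = k

  val⇒𝒫 : ∀ {f α} → val f ≡ [ α ] → f ∈𝒫 α
  val⇒𝒫 h = ≡.subst (_ ≤⁺_) (≡.sym h) [ ℚ.≤-refl ]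

  𝒫⇒≤ : ∀ {f α γ} → val f ≡ [ α ] → f ∈𝒫 γ → γ ℚ.≤ α
  𝒫⇒≤ h k with ≡.subst (_ ≤⁺_) h k
  ... | [ p ] = p

  𝒫⁺⇒< : ∀ {f α γ} → val f ≡ [ α ] → f ∈𝒫⁺ γ → γ ℚ.< α
  𝒫⁺⇒< h k with ≡.subst (_ <⁺_) h k
  ... | [ p ] = p

  <⇒𝒫⁺ : ∀ {f α γ} → val f ≡ [ α ] → γ ℚ.< α → f ∈𝒫⁺ γ
  <⇒𝒫⁺ h p = ≡.subst (_ <⁺_) (≡.sym h) [ p ]

  ≤⇒𝒫 : ∀ {f α γ} → val f ≡ [ α ] → γ ℚ.≤ α → f ∈𝒫 γ
  ≤⇒𝒫 h p = ≡.subst (_ ≤⁺_) (≡.sym h) [ p ]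

  ∉𝒫⁺ : ∀ {f α} → val f ≡ [ α ] → ¬ f ∈𝒫⁺ α
  ∉𝒫⁺ h k = ℚ.<-irrefl ≡.refl (𝒫⁺⇒< h k)

  0∈𝒫⁺ : ∀ {f γ} → f ≈ 0# → f ∈𝒫⁺ γ
  0∈𝒫⁺ h = 𝒫⁺-resp (sym h) 𝒫⁺-0#

  0∈𝒫 : ∀ {f γ} → f ≈ 0# → f ∈𝒫 γ
  0∈𝒫 h = 𝒫-resp (sym h) 𝒫-0#

  𝒫-<-𝒫⁺ : ∀ {f γ δ} → δ ℚ.< γ → f ∈𝒫 γ → f ∈𝒫⁺ δ
  𝒫-<-𝒫⁺ p h = <⁺-transˡ ℚ.<-≤-trans [ p ] h

  𝒫-split : ∀ {f γ} → f ∈𝒫 γ → f ∈𝒫⁺ γ ⊎ val f ≡ [ γ ]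
  𝒫-split {f} {γ} h with val-split f
  ... | inj₁ f≈0 = inj₁ (0∈𝒫⁺ f≈0)
  ... | inj₂ (α , k) with ℚ.<-cmp γ α
  ...   | tri< p _ _      = inj₁ (<⇒𝒫⁺ k p)
  ...   | tri≈ _ ≡.refl _ = inj₂ k
  ...   | tri> ¬p ¬q p    = ⊥-elim (ℚ.<-irrefl ≡.refl (ℚ.<-≤-trans p (𝒫⇒≤ k h)))

  𝒫⁺-dec : ∀ f γ → f ∈𝒫⁺ γ ⊎ (∃[ α ] val f ≡ [ α ] × α ℚ.≤ γ)
  𝒫⁺-dec f γ with val-split f
  ... | inj₁ f≈0 = inj₁ (0∈𝒫⁺ f≈0)
  ... | inj₂ (α , k) with γ ℚ.<? α
  ...   | yes p = inj₁ (<⇒𝒫⁺ k p)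
  ...   | no ¬p = inj₂ (α , k , ℚ.≮⇒≥ ¬p)

  ∼-refl : ∀ {γ f g} → f ≈ g → f ∼[ γ ] g
  ∼-refl h = 0∈𝒫⁺ (diff-refl h)

  ∼-sym : ∀ {γ f g} → f ∼[ γ ] g → g ∼[ γ ] f
  ∼-sym h = 𝒫⁺-resp (sym (diff-sym _ _)) (𝒫⁺-‿ h)

  ∼-trans : ∀ {γ f g h} → f ∼[ γ ] g → g ∼[ γ ] h → f ∼[ γ ] h
  ∼-trans {g = g} p q = 𝒫⁺-resp (sym (diff-trans _ g _)) (𝒫⁺-+ p q)

  ∼-+ : ∀ {γ f g h k} → f ∼[ γ ] g → h ∼[ γ ] k → f + h ∼[ γ ] g + k
  ∼-+ p q = 𝒫⁺-resp (sym (diff-+ _ _ _ _)) (𝒫⁺-+ p q)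

  ∼-* : ∀ {α β f g h k} → f ∈𝒫 α → k ∈𝒫 β → f ∼[ α ] g → h ∼[ β ] k → f * h ∼[ α ℚ.+ β ] g * k
  ∼-* {α} {β} {f} {g} {h} {k} f∈ k∈ p q = 𝒫⁺-resp (sym (diff-* f h g k))
    (𝒫⁺-+ (𝒫⁺-* f∈ q) (≡.subst (λ γ → k * (f - g) ∈𝒫⁺ γ) (ℚ.+-comm β α) (𝒫⁺-* k∈ p)))

  ∼-*ˡ : ∀ {α β f h k} → f ∈𝒫 α → h ∼[ β ] k → f * h ∼[ α ℚ.+ β ] f * k
  ∼-*ˡ {f = f} {h} {k} f∈ q = 𝒫⁺-resp (RingFacts.x[y-z]≈xy-xz R f h k) (𝒫⁺-* f∈ q)

  ∼-0 : ∀ {γ f} → f ∈𝒫⁺ γ → f ∼[ γ ] 0#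
  ∼-0 {f = f} h = 𝒫⁺-resp (sym (trans (+-congˡ -0#≈0#) (+-identityʳ f))) h

  ∼-𝒫⁺ : ∀ {γ f g} → f ∼[ γ ] g → g ∈𝒫⁺ γ → f ∈𝒫⁺ γ
  ∼-𝒫⁺ {f = f} {g} h k = 𝒫⁺-resp (//-rightDividesˡ g f) (𝒫⁺-+ h k)

  ∼-𝒫 : ∀ {γ f g} → f ∼[ γ ] g → g ∈𝒫 γ → f ∈𝒫 γ
  ∼-𝒫 {f = f} {g} h k = 𝒫-resp (//-rightDividesˡ g f) (𝒫-+ (𝒫⁺⇒𝒫 h) k)

  ∼-val : ∀ {γ f g} → f ∼[ γ ] g → val g ≡ [ γ ] → val f ≡ [ γ ]
  ∼-val h k with 𝒫-split (∼-𝒫 h (val⇒𝒫 k))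
  ... | inj₂ e = e
  ... | inj₁ e = ⊥-elim (∉𝒫⁺ k (∼-𝒫⁺ (∼-sym h) e))

  +-∼ : ∀ {γ} f {g} → g ∈𝒫⁺ γ → f + g ∼[ γ ] f
  +-∼ f {g} h = 𝒫⁺-resp (sym (xyx⁻¹≈y f g)) h

  val-*ᵛ : ∀ {f g α β} → val f ≡ [ α ] → val g ≡ [ β ] → val (f * g) ≡ [ α ℚ.+ β ]
  val-*ᵛ h k = ≡.trans (val-* _ _) (≡.cong₂ _+⁺_ h k)

  𝒫⁺-cancel : ∀ {f g β α} → val f ≡ [ β ] → f * g ∈𝒫⁺ β ℚ.+ α → g ∈𝒫⁺ α
  𝒫⁺-cancel {f} {g} {β} {α} h k with val-split g
  ... | inj₁ e       = 0∈𝒫⁺ e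
  ... | inj₂ (γ , e) = <⇒𝒫⁺ e (+-cancel-< β (𝒫⁺⇒< (val-*ᵛ h e) k))

  𝒫-cancel : ∀ {f g β α} → val f ≡ [ β ] → f * g ∈𝒫 β ℚ.+ α → g ∈𝒫 α
  𝒫-cancel {f} {g} {β} {α} h k with val-split g
  ... | inj₁ e       = 0∈𝒫 e
  ... | inj₂ (γ , e) with α ℚ.≤? γ
  ...   | yes p = ≤⇒𝒫 e p
  ...   | no ¬p = ⊥-elim (ℚ.<-irrefl ≡.refl
    (ℚ.<-≤-trans (ℚ.+-monoʳ-< β (ℚ.≰⇒> ¬p)) (𝒫⇒≤ (val-*ᵛ h e) k)))

  -- Invertibility of the class of `f`, witnessed by a polynomial: K(x) is represented only by its
  -- polynomials. The value of `g` is forced to be the opposite of that of `f`, see `unit-val`.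
  IsUnitMod⁺ : Carrier → Set c
  IsUnitMod⁺ f = ∃[ g ] f * g ∼[ 0ℚ ] 1#

  unit-val : ∀ {f g α} → val f ≡ [ α ] → f * g ∼[ 0ℚ ] 1# → val g ≡ [ ℚ.- α ]
  unit-val {f} {g} {α} h k with val-split g
  ... | inj₁ e = ⊥-elim (val≢⊤ (∼-val k val-1#) (trans (*-congˡ e) (zeroʳ f)))
  ... | inj₂ (β , e) = ≡.trans e (≡.cong [_] (negated _ _
    ([]-injective (≡.trans (≡.sym (val-*ᵛ h e)) (∼-val k val-1#)))))
    where
    open +-*-Solver
    negated : ∀ α β → α ℚ.+ β ≡ 0ℚ → β ≡ ℚ.- α
    negated α β h = ≡.trans (solve 2 (λ α β → β := (α :+ β) :- α) ≡.refl α β)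
      (≡.trans (≡.cong (ℚ._- α) h) (ℚ.+-identityˡ (ℚ.- α)))

  unit-nonzero : ∀ {f} → IsUnitMod⁺ f → ¬ f ≈ 0#
  unit-nonzero {f} (g , h) e = val≢⊤ (∼-val h val-1#) (trans (*-congʳ e) (zeroˡ g))

-- Homogeneous classes in the graded ring.

module GradedProperties {c ℓ : Level} {R : CommutativeRing c ℓ} (V : Valuation R) where
  private module R = CommutativeRing R
  open R using (Carrier; 0#; 1#) renaming (_≈_ to _≈ᴿ_; _*_ to _*ᴿ_; _+_ to _+ᴿ_)
  open ValuationProperties V
  open GradedRing V using (Term; degree; repr; bound; ∈Γ; Gr; H; component; component-·; component-++;
    at; componentwise; gradedRing; Homogeneous; degree₀; _·_)
  module Gr = CommutativeRing gradedRing
  open Gr using (_≈_; _*_; _+_)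
  open RawSemiringDefinitions (Semiring.rawSemiring Gr.semiring) using (_∣_)

  HShape : Carrier → ℚ ⁺ → Gr → Set c
  HShape g ⊤⁺    a = a ≡ []
  HShape g [ α ] a = Σ[ t ∈ Term ] a ≡ t ∷ [] × degree t ≡ α × repr t ≡ g

  private
    -- H g unfolds to a function of w = val g and of a proof of val g ≡ w.
    -- Abstracting over w is well typed only if this proof is opaque, whence F.
    H-shape′ : ∀ g (F : Σ[ W ∈ (ℚ ⁺ → Set) ] ∀ w → W w → val g ≡ w) (x : proj₁ F (val g)) →
      ≡.refl ≡ proj₂ F (val g) x → HShape g (val g) (H g)
    H-shape′ g F x h with ≡.refl {x = val g}
    H-shape′ g F x ≡.refl | _ with val g | x
    ... | ⊤⁺    | _ = ≡.refl
    ... | [ α ] | _ = _ , ≡.refl , ≡.refl , ≡.refl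

  H-shape : ∀ g → HShape g (val g) (H g)
  H-shape g = H-shape′ g ((val g ≡_) , λ _ e → e) ≡.refl ≡.refl

  -- The degree `α` is only a lower bound for the value of `f`, so the class may be zero; this is
  -- what makes classes of one degree closed under addition.
  record IsClass (α : ℚ) (f : Carrier) (a : Gr) : Set c where
    constructor isClass
    field
      t        : Term
      degree-t : degree t ≡ α
      repr-t   : repr t ≡ f
      ≈[t]     : a ≈ t ∷ []

  class-∈𝒫 : ∀ {α f a} → IsClass α f a → f ∈𝒫 α
  class-∈𝒫 (isClass t ≡.refl ≡.refl _) = bound t

  class-Γ : ∀ {α f a} → IsClass α f a → Γ α
  class-Γ (isClass t ≡.refl _ _) = ∈Γ t

  class : ∀ {α f} → Γ α → f ∈𝒫 α → Gr
  class {α} {f} Γα f∈ = record { degree = α ; ∈Γ = Γα ; repr = f ; bound = f∈ } ∷ []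

  class-isClass : ∀ {α f} (Γα : Γ α) (f∈ : f ∈𝒫 α) → IsClass α f (class Γα f∈)
  class-isClass Γα f∈ = isClass _ ≡.refl ≡.refl Gr.refl

  class-resp : ∀ {α f a b} → a ≈ b → IsClass α f a → IsClass α f b
  class-resp h (isClass t d r e) = isClass t d r (Gr.trans (Gr.sym h) e)

  class-degree : ∀ {α β f a} → α ≡ β → IsClass α f a → IsClass β f a
  class-degree ≡.refl h = h

  component-term : ∀ t → component (degree t) (t ∷ []) ≈ᴿ repr t
  component-term t with degree t ℚ.≟ degree t
  ... | yes _ = R.+-identityʳ _
  ... | no ¬h = ⊥-elim (¬h ≡.refl)

  component-term-≢ : ∀ {γ} t → degree t ≢ γ → component γ (t ∷ []) ≈ᴿ 0#
  component-term-≢ {γ} t h with degree t ℚ.≟ γ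
  ... | yes k = ⊥-elim (h k)
  ... | no _  = R.+-identityʳ _

  term-cong : ∀ s t → degree s ≡ degree t → repr s ∼[ degree t ] repr t → s ∷ [] ≈ t ∷ []
  term-cong s t h k .at γ with degree s ℚ.≟ γ | degree t ℚ.≟ γ
  ... | yes _ | yes ≡.refl = ∼-+ k (∼-refl R.refl)
  ... | no  _ | no  _      = ∼-refl R.refl
  ... | yes p | no ¬q      = ⊥-elim (¬q (≡.trans (≡.sym h) p))
  ... | no ¬p | yes q      = ⊥-elim (¬p (≡.trans h q))

  class-unique : ∀ {α f g a b} → IsClass α f a → IsClass α g b → f ∼[ α ] g → a ≈ b
  class-unique (isClass s ≡.refl ≡.refl h) (isClass t d ≡.refl k) p =
    Gr.trans h (Gr.trans (term-cong s t (≡.sym d) (≡.subst (repr s ∼[_] repr t) (≡.sym d) p)) (Gr.sym k))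

  class-∼ : ∀ {α f g a} → IsClass α f a → f ∼[ α ] g → IsClass α g a
  class-∼ {α} {f} {g} h p = class-resp (class-unique k h (∼-sym p)) k
    where
    k : IsClass α g (class (class-Γ h) (∼-𝒫 (∼-sym p) (class-∈𝒫 h)))
    k = class-isClass _ _

  component-cong : ∀ {a b} γ → a ≈ b → component γ a ∼[ γ ] component γ b
  component-cong γ h = h .at γ

  ≈[]⇒ : ∀ {a} γ → a ≈ [] → component γ a ∈𝒫⁺ γ
  ≈[]⇒ γ h = ∼-𝒫⁺ (h .at γ) 𝒫⁺-0#

  ⇒≈[] : ∀ {a} → (∀ γ → component γ a ∈𝒫⁺ γ) → a ≈ []
  ⇒≈[] h .at γ = ∼-0 (h γ)

  class-component : ∀ {α f a} → IsClass α f a → component α a ∼[ α ] f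
  class-component (isClass t ≡.refl ≡.refl h) = ∼-trans (component-cong _ h) (∼-refl (component-term t))

  class-component-≢ : ∀ {α f a γ} → IsClass α f a → α ≢ γ → component γ a ∈𝒫⁺ γ
  class-component-≢ {γ = γ} (isClass t ≡.refl ≡.refl h) p =
    ∼-𝒫⁺ (component-cong γ h) (0∈𝒫⁺ (component-term-≢ t p))

  class-vanishes : ∀ {α f a} → IsClass α f a → f ∈𝒫⁺ α → a ≈ []
  class-vanishes (isClass t ≡.refl ≡.refl h) p = Gr.trans h (⇒≈[] vanishes)
    where
    vanishes : ∀ γ → component γ (t ∷ []) ∈𝒫⁺ γ
    vanishes γ with degree t ℚ.≟ γ
    ... | yes ≡.refl = 𝒫⁺-resp (R.sym (R.+-identityʳ _)) p
    ... | no  _      = 0∈𝒫⁺ (R.+-identityʳ _)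

  class-* : ∀ {α β f g a b} → IsClass α f a → IsClass β g b → IsClass (α ℚ.+ β) (f *ᴿ g) (a * b)
  class-* (isClass s ≡.refl ≡.refl h) (isClass t ≡.refl ≡.refl k) = isClass (s · t) ≡.refl ≡.refl (Gr.*-cong h k)

  class-+ : ∀ {α f g a b} → IsClass α f a → IsClass α g b → IsClass α (f +ᴿ g) (a + b)
  class-+ {α} {f} {g} {a} {b} h@(isClass s ≡.refl ≡.refl p) k@(isClass t e ≡.refl q) =
    class-resp sum (class-isClass (∈Γ s) (𝒫-+ (bound s) (class-∈𝒫 k)))
    where
    u : Term
    u = record { degree = degree s ; ∈Γ = ∈Γ s ; repr = repr s +ᴿ repr t ; bound = 𝒫-+ (bound s) (class-∈𝒫 k) }
    components : ∀ γ → component γ (u ∷ []) ≈ᴿ component γ (s ∷ t ∷ [])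
    components γ with degree s ℚ.≟ γ | degree t ℚ.≟ γ
    ... | yes _ | yes _ = R.+-assoc _ _ _
    ... | no  _ | no  _ = R.sym (R.+-identityˡ _)
    ... | yes x | no ¬y = ⊥-elim (¬y (≡.trans e x))
    ... | no ¬x | yes y = ⊥-elim (¬x (≡.trans (≡.sym e) y))
    sum : u ∷ [] ≈ a + b
    sum = Gr.trans (componentwise λ γ → ∼-refl (components γ)) (Gr.sym (Gr.+-cong p q))

  H-class : ∀ {α g} → val g ≡ [ α ] → IsClass α g (H g)
  H-class {α} {g} h = go h (H-shape g)
    where
    go : ∀ {w a} → w ≡ [ α ] → HShape g w a → IsClass α g a
    go ≡.refl (t , e , d , r) = isClass t d r (Gr.reflexive e)

  H-0 : ∀ {g} → g ≈ᴿ 0# → H g ≈ []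
  H-0 {g} h = go (≡.trans (val-cong h) val-0#) (H-shape g)
    where
    go : ∀ {w a} → w ≡ ⊤⁺ → HShape g w a → a ≈ []
    go ≡.refl e = Gr.reflexive e

  H-* : ∀ f g → H (f *ᴿ g) ≈ H f * H g
  H-* f g with val-split f | val-split g
  ... | inj₁ h | _ = Gr.trans (H-0 (R.trans (R.*-congʳ h) (R.zeroˡ g))) (Gr.sym (Gr.*-congʳ (H-0 h)))
  ... | inj₂ _ | inj₁ k = Gr.trans (H-0 (R.trans (R.*-congˡ k) (R.zeroʳ f)))
    (Gr.sym (Gr.trans (Gr.*-congˡ {H f} (H-0 k)) (Gr.zeroʳ (H f))))
  ... | inj₂ (_ , h) | inj₂ (_ , k) =
    class-unique (H-class (val-*ᵛ h k)) (class-* (H-class h) (H-class k)) (∼-refl R.refl)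

  H-∼ : ∀ {f g γ} → val g ≡ [ γ ] → f ∼[ γ ] g → H f ≈ H g
  H-∼ h p = class-unique (H-class (∼-val p h)) (H-class h) p

  -- The form in which divisibility by a key polynomial arises, always in order to contradict its
  -- minimality or use its primality.
  H-∣ : ∀ {f φ g γ} → val g ≡ [ γ ] → f *ᴿ φ ∼[ γ ] g → H φ ∣ H g
  H-∣ {f} {φ} h p = RawMagma._,_ (H f) (Gr.trans (Gr.sym (H-* f φ)) (H-∼ h p))
    where import Algebra.Definitions.RawMagma (Gr.*-rawMagma) as RawMagma

  component-class-* : ∀ {α f a} γ b → IsClass α f a → component γ (a * b) ∼[ γ ] f *ᴿ component (γ ℚ.- α) b
  component-class-* {a = a} γ b (isClass t ≡.refl ≡.refl h) =
    ∼-trans (component-cong γ (Gr.*-congʳ {b} h)) (∼-refl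
      (R.trans (component-++ γ (map (t ·_) b) []) (R.trans (R.+-identityʳ _) (component-· γ t b))))

  component-resp-∼ : ∀ {γ δ} a → γ ≡ δ → component γ a ∼[ δ ] component δ a
  component-resp-∼ a ≡.refl = ∼-refl R.refl

  -- Component `α + γ` of `a * b` is `f` times component `γ` of `b`, and a factor of exact value `α`
  -- can be cancelled from membership in 𝒫⁺.
  class-*-cancel : ∀ {α f a b} → val f ≡ [ α ] → IsClass α f a → a * b ≈ [] → b ≈ []
  class-*-cancel {α} {f} {a} {b} h k p = ⇒≈[] λ γ → ∼-𝒫⁺ (∼-sym (component-resp-∼ b ([x+y]-x≡y α γ)))
    (≡.subst (component ((α ℚ.+ γ) ℚ.- α) b ∈𝒫⁺_) ≡.refl
      (𝒫⁺-cancel h (∼-𝒫⁺ (∼-sym (component-class-* (α ℚ.+ γ) b k)) (≈[]⇒ (α ℚ.+ γ) p))))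

  -- A syntactic counterpart of `Homogeneous`: closure under products is immediate for lists of
  -- terms of one degree, but awkward for a condition on components.
  record IsPure (α : ℚ) (a : Gr) : Set c where
    constructor isPure
    field
      terms   : Gr
      degrees : All (λ t → degree t ≡ α) terms
      ≈terms  : a ≈ terms

  pure-resp : ∀ {α a b} → a ≈ b → IsPure α a → IsPure α b
  pure-resp h (isPure l d e) = isPure l d (Gr.trans (Gr.sym h) e)

  pure-degree : ∀ {α β a} → α ≡ β → IsPure α a → IsPure β a
  pure-degree ≡.refl h = h

  pure-0 : ∀ {α} → IsPure α []
  pure-0 = isPure [] [] Gr.refl

  pure-+ : ∀ {α a b} → IsPure α a → IsPure α b → IsPure α (a + b)
  pure-+ (isPure l d e) (isPure l′ d′ e′) = isPure (l ++ l′) (++⁺ d d′) (Gr.+-cong e e′)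
    where open import Data.List.Relation.Unary.All.Properties using (++⁺)

  pure-* : ∀ {α β a b} → IsPure α a → IsPure β b → IsPure (α ℚ.+ β) (a * b)
  pure-* {α} {β} (isPure l d e) (isPure l′ d′ e′) = isPure (l * l′) (products d) (Gr.*-cong e e′)
    where
    open import Data.List.Relation.Unary.All.Properties using (++⁺; map⁺)
    products : ∀ {l} → All (λ t → degree t ≡ α) l → All (λ t → degree t ≡ α ℚ.+ β) (l * l′)
    products []            = []
    products (≡.refl ∷ ds) = ++⁺ (map⁺ (All.map (λ { ≡.refl → ≡.refl }) d′)) (products ds)

  class-pure : ∀ {α f a} → IsClass α f a → IsPure α a
  class-pure (isClass t d _ e) = isPure (t ∷ []) (d ∷ []) e

  pure⇒homogeneous : ∀ {α a} → IsPure α a → Homogeneous α a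
  pure⇒homogeneous {α} (isPure l d e) γ γ≢α = ∼-𝒫⁺ (component-cong γ e) (0∈𝒫⁺ (components d))
    where
    components : ∀ {l} → All (λ t → degree t ≡ α) l → component γ l ≈ᴿ 0#
    components [] = R.refl
    components (_∷_ {t} ≡.refl ds) with degree t ℚ.≟ γ
    ... | yes ≡.refl = ⊥-elim (γ≢α ≡.refl)
    ... | no  _      = R.trans (R.+-identityˡ _) (components ds)

  -- Dropping the terms of other degrees leaves component `α` unchanged; in every other degree both
  -- sides are zero modulo 𝒫⁺.
  homogeneous⇒pure : ∀ {α a} → Homogeneous α a → IsPure α a
  homogeneous⇒pure {α} {a} h = isPure (filter P? a) (all-filter P? a) (componentwise components)
    where
    open import Data.List.Base using (filter)
    open import Data.List.Relation.Unary.All.Properties using (all-filter)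
    P? : ∀ t → Dec (degree t ≡ α)
    P? t = degree t ℚ.≟ α
    same : ∀ a → component α a ≈ᴿ component α (filter P? a)
    same [] = R.refl
    same (t ∷ a) with degree t ℚ.≟ α
    ... | no  _ = R.trans (R.+-identityˡ _) (same a)
    ... | yes p with degree t ℚ.≟ α
    ...   | yes _ = R.+-congˡ (same a)
    ...   | no ¬p = ⊥-elim (¬p p)
    components : ∀ γ → component γ a ∼[ γ ] component γ (filter P? a)
    components γ with γ ℚ.≟ α
    ... | yes ≡.refl = ∼-refl (same a)
    ... | no  γ≢α    = ∼-trans (∼-0 (h γ γ≢α))
      (∼-sym (∼-0 (pure⇒homogeneous (isPure _ (all-filter P? a) Gr.refl) γ γ≢α)))

  pure⇒class : ∀ {α a} → Γ α → IsPure α a → ∃[ f ] IsClass α f a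
  pure⇒class {α} Γα (isPure l d e) = let f , h = go d in f , class-resp (Gr.sym e) h
    where
    go : ∀ {l} → All (λ t → degree t ≡ α) l → ∃[ f ] IsClass α f l
    -- The empty list has no term that certifies its degree, so the zero class takes its membership
    -- in Γ from the hypothesis.
    go [] = 0# , class-resp (class-vanishes h 𝒫⁺-0#) h
      where
      h : IsClass α 0# (class Γα 𝒫-0#)
      h = class-isClass Γα 𝒫-0#
    go (_∷_ {t} p ds) = let f , h = go ds in _ , class-+ (isClass t p ≡.refl Gr.refl) h

  class-degree₀ : ∀ {f a} → IsClass 0ℚ f a → ∃[ δ ] a ≈ degree₀ δ × proj₁ δ ≡ f
  class-degree₀ {f} h = (f , class-∈𝒫 h) , class-unique h (isClass _ ≡.refl ≡.refl Gr.refl) (∼-refl R.refl) , ≡.refl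

  degree₀-class : ∀ δ → IsClass 0ℚ (proj₁ δ) (degree₀ δ)
  degree₀-class δ = isClass _ ≡.refl ≡.refl Gr.refl

  1-class : IsClass 0ℚ 1# Gr.1#
  1-class = isClass _ ≡.refl ≡.refl Gr.refl

-- Homomorphisms out of polynomial rings and their quotients.

record RingHom {a ℓa b ℓb : Level} (A : CommutativeRing a ℓa) (B : CommutativeRing b ℓb) : Set (a ⊔ ℓa ⊔ b ⊔ ℓb) where
  private
    module A = CommutativeRing A
    module B = CommutativeRing B
    open RawSemiringDefinitions (Semiring.rawSemiring A.semiring) using () renaming (_^_ to _^ᴬ_)
    open RawSemiringDefinitions (Semiring.rawSemiring B.semiring) using () renaming (_^_ to _^ᴮ_)
  field
    ⟦_⟧    : A.Carrier → B.Carrier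
    cong   : ∀ {x y} → x A.≈ y → ⟦ x ⟧ B.≈ ⟦ y ⟧
    +-homo : ∀ x y → ⟦ x A.+ y ⟧ B.≈ ⟦ x ⟧ B.+ ⟦ y ⟧
    *-homo : ∀ x y → ⟦ x A.* y ⟧ B.≈ ⟦ x ⟧ B.* ⟦ y ⟧
    1-homo : ⟦ A.1# ⟧ B.≈ B.1#

  0-homo : ⟦ A.0# ⟧ B.≈ B.0#
  0-homo = +-identityʳ-unique ⟦ A.0# ⟧ ⟦ A.0# ⟧ (B.trans (B.sym (+-homo A.0# A.0#)) (cong (A.+-identityˡ A.0#)))
    where open RingFacts B using (+-identityʳ-unique)

  neg-homo : ∀ x → ⟦ A.- x ⟧ B.≈ B.- ⟦ x ⟧
  neg-homo x = +-inverseˡ-unique _ _ (B.trans (B.sym (+-homo (A.- x) x)) (B.trans (cong (A.-‿inverseˡ x)) 0-homo))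
    where open RingFacts B using (+-inverseˡ-unique)

  -homo : ∀ x y → ⟦ x A.- y ⟧ B.≈ ⟦ x ⟧ B.- ⟦ y ⟧
  -homo x y = B.trans (+-homo x (A.- y)) (B.+-congˡ (neg-homo y))

  -homo-0 : ∀ x y → ⟦ x ⟧ B.≈ ⟦ y ⟧ → ⟦ x A.- y ⟧ B.≈ B.0#
  -homo-0 x y h = B.trans (-homo x y) (RingFacts.diff-refl B h)

  ^-homo : ∀ x n → ⟦ x ^ᴬ n ⟧ B.≈ ⟦ x ⟧ ^ᴮ n
  ^-homo x zero    = 1-homo
  ^-homo x (suc n) = B.trans (*-homo x (x ^ᴬ n)) (B.*-congˡ (^-homo x n))

infixr 9 _∘ᴴ_

_∘ᴴ_ : ∀ {a ℓa b ℓb c ℓc} {A : CommutativeRing a ℓa} {B : CommutativeRing b ℓb} {C : CommutativeRing c ℓc} →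
  RingHom B C → RingHom A B → RingHom A C
_∘ᴴ_ {C = C} g f = record
  { ⟦_⟧    = λ x → g.⟦ f.⟦ x ⟧ ⟧
  ; cong   = λ h → g.cong (f.cong h)
  ; +-homo = λ x y → trans (g.cong (f.+-homo x y)) (g.+-homo _ _)
  ; *-homo = λ x y → trans (g.cong (f.*-homo x y)) (g.*-homo _ _)
  ; 1-homo = trans (g.cong f.1-homo) g.1-homo
  }
  where
  open CommutativeRing C using (trans)
  module g = RingHom g
  module f = RingHom f

module PolynomialProperties {a ℓ : Level} (A : CommutativeRing a ℓ) where
  private module A = CommutativeRing A
  open Polynomial A

  constantHom : RingHom A polyRing
  constantHom = record
    { ⟦_⟧    = constant
    ; cong   = λ h → shift-cong h ≈-refl
    ; +-homo = λ _ _ → ≈-refl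
    ; *-homo = λ _ _ → shift-cong (A.sym (A.+-identityʳ _)) ≈-refl
    ; 1-homo = ≈-refl
    }

  X* : ∀ f → X * f ≈ A.0# ∷ f
  X* f = ≈-trans (shift-* (constant A.1#) f) (shift-cong A.refl (1* f))

  ∷≈ : ∀ b f → b ∷ f ≈ constant b + X * f
  ∷≈ b f = ≈-sym (≈-trans (+-cong (≈-refl {constant b}) (X* f)) (shift-cong (A.+-identityʳ b) ≈-refl))

  ∷≈[] : ∀ {b f} → b ∷ f ≈ [] → (b A.≈ A.0#) × f ≈ []
  ∷≈[] h = h .at 0 , pointwise λ n → h .at (suc n)

module Evaluation {a ℓa b ℓb : Level} {A : CommutativeRing a ℓa} {B : CommutativeRing b ℓb}
  (φ : RingHom A B) (s : CommutativeRing.Carrier B) where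
  private
    module A = CommutativeRing A
    module P = Polynomial A
  open PolynomialProperties A
  open P using (Poly; constant; X; _⊛_)
  open CommutativeRing B
  open CommutativeSemigroupProperties +-commutativeSemigroup using (interchange)
  open CommutativeSemigroupProperties *-commutativeSemigroup using (x∙yz≈y∙xz)
  open RingHom φ using (⟦_⟧; cong; +-homo; *-homo; 1-homo; 0-homo)

  eval : Poly → Carrier
  eval []      = 0#
  eval (c ∷ f) = ⟦ c ⟧ + s * eval f

  eval-≈[] : ∀ f → f P.≈ [] → eval f ≈ 0#
  eval-≈[] []      h = refl
  eval-≈[] (c ∷ f) h = trans (+-cong (trans (cong (proj₁ (∷≈[] h))) 0-homo)
    (trans (*-congˡ (eval-≈[] f (proj₂ (∷≈[] h)))) (zeroʳ s))) (+-identityˡ 0#)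

  eval-cong : ∀ f g → f P.≈ g → eval f ≈ eval g
  eval-cong []      g       h = sym (eval-≈[] g (P.≈-sym h))
  eval-cong (c ∷ f) []      h = eval-≈[] (c ∷ f) h
  eval-cong (c ∷ f) (d ∷ g) h =
    +-cong (cong (h .P.at 0)) (*-congˡ (eval-cong f g (P.pointwise λ n → h .P.at (suc n))))

  eval-+ : ∀ f g → eval (f P.+ g) ≈ eval f + eval g
  eval-+ []      g       = sym (+-identityˡ _)
  eval-+ (c ∷ f) []      = sym (+-identityʳ _)
  eval-+ (c ∷ f) (d ∷ g) = trans
    (+-cong (+-homo c d) (trans (*-congˡ (eval-+ f g)) (distribˡ s _ _)))
    (interchange _ _ _ _)

  eval-⊛ : ∀ c f → eval (c ⊛ f) ≈ ⟦ c ⟧ * eval f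
  eval-⊛ c []      = sym (zeroʳ _)
  eval-⊛ c (d ∷ f) = trans
    (+-cong (*-homo c d) (trans (*-congˡ (eval-⊛ c f)) (x∙yz≈y∙xz s _ _)))
    (sym (distribˡ _ _ _))

  eval-* : ∀ f g → eval (f P.* g) ≈ eval f * eval g
  eval-* []      g = sym (zeroˡ _)
  eval-* (c ∷ f) g = trans (eval-+ (c ⊛ g) (A.0# ∷ (f P.* g))) (trans
    (+-cong (eval-⊛ c g) (trans (+-cong 0-homo (trans (*-congˡ (eval-* f g)) (sym (*-assoc _ _ _)))) (+-identityˡ _)))
    (sym (distribʳ _ _ _)))

  eval-constant : ∀ c → eval (constant c) ≈ ⟦ c ⟧
  eval-constant c = trans (+-congˡ (zeroʳ s)) (+-identityʳ _)

  eval-X : eval X ≈ s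
  eval-X = trans (+-cong 0-homo (trans (*-congˡ (trans (eval-constant A.1#) 1-homo)) (*-identityʳ s))) (+-identityˡ s)

  evalHom : RingHom P.polyRing B
  evalHom = record
    { ⟦_⟧    = eval
    ; cong   = λ {f} {g} → eval-cong f g
    ; +-homo = eval-+
    ; *-homo = eval-*
    ; 1-homo = trans (eval-constant A.1#) 1-homo
    }

module QuotientProperties {a ℓa : Level} (A : CommutativeRing a ℓa) (f : CommutativeRing.Carrier A) where
  private module A = CommutativeRing A
  open Quotient A f

  quotientHom : RingHom A ring/f
  quotientHom = record
    { ⟦_⟧    = [_]/
    ; cong   = []/-cong
    ; +-homo = λ _ _ → refl
    ; *-homo = λ _ _ → refl
    ; 1-homo = refl
    }
    where
    open CommutativeRing ring/f using (refl; _≈_)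
    []/-cong : ∀ {x y} → x A.≈ y → [ x ]/ ≈ [ y ]/
    []/-cong h = modulo record { quotient = A.0# ; equality = A.trans (A.zeroˡ f) (A.sym (RingFacts.diff-refl A h)) }

  relation≈0 : CommutativeRing._≈_ ring/f [ f ]/ (CommutativeRing.0# ring/f)
  relation≈0 = modulo record { quotient = A.1# ; equality = A.trans (A.*-identityˡ f)
    (A.sym (A.trans (A.+-congˡ (RingFacts.-0#≈0# A)) (A.+-identityʳ f))) }

  liftHom : ∀ {b ℓb} {B : CommutativeRing b ℓb} (φ : RingHom A B) →
    CommutativeRing._≈_ B (RingHom.⟦_⟧ φ f) (CommutativeRing.0# B) → RingHom ring/f B
  liftHom {B = B} φ h = record
    { ⟦_⟧    = λ x → ⟦ proj₁ x ⟧
    ; cong   = λ { {x , _} {y , _} (modulo record { quotient = z ; equality = e }) →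
        x∙y⁻¹≈ε⇒x≈y _ _ (trans (sym (-homo x y)) (trans (cong (A.sym e))
          (trans (*-homo z f) (trans (*-congˡ h) (zeroʳ _))))) }
    ; +-homo = λ x y → +-homo (proj₁ x) (proj₁ y)
    ; *-homo = λ x y → *-homo (proj₁ x) (proj₁ y)
    ; 1-homo = 1-homo
    }
    where
    open RingHom φ
    open CommutativeRing B using (trans; sym; *-congˡ; zeroʳ)
    open RingFacts B using (x∙y⁻¹≈ε⇒x≈y)

module _ {a ℓa b ℓb t : Level} {A : CommutativeRing a ℓa} {B : CommutativeRing b ℓb} where
  open CommutativeRing B

  -- Speaking of the images under `k` rather than of polynomials lets the principle be iterated
  -- through a tower: the constants of one level are handled by the same principle one level below.
  polynomial-ind : (k : RingHom (Polynomial.polyRing A) B) (T : Carrier → Set t) →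
    (∀ {x y} → x ≈ y → T x → T y) → (∀ {x y} → T x → T y → T (x + y)) → (∀ {x y} → T x → T y → T (x * y)) →
    (∀ c → T (RingHom.⟦_⟧ k (Polynomial.constant A c))) → T (RingHom.⟦_⟧ k (Polynomial.X A)) →
    ∀ f → T (RingHom.⟦_⟧ k f)
  polynomial-ind k T T-resp T-+ T-* T-c T-X = go
    where
    open RingHom k
    open PolynomialProperties A
    go : ∀ f → T ⟦ f ⟧
    go []      = T-resp (cong (Polynomial.shift-[] A)) (T-c (CommutativeRing.0# A))
    go (c ∷ f) = T-resp
      (sym (trans (cong (∷≈ c f)) (trans (+-homo _ _) (+-congˡ (*-homo _ f)))))
      (T-+ (T-c c) (T-* T-X (go f)))

module Powers {a ℓ : Level} (A : CommutativeRing a ℓ) where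
  open CommutativeRing A
  open import Algebra.Properties.Semiring.Exp semiring public using (_^_; ^-congˡ; ^-homo-*)
  open import Algebra.Properties.CommutativeSemiring.Exp commutativeSemiring public using (^-distrib-*)
  open CommutativeSemigroupProperties *-commutativeSemigroup using (x∙yz≈y∙xz)

  1^ : ∀ n → 1# ^ n ≈ 1#
  1^ zero    = refl
  1^ (suc n) = trans (*-identityˡ _) (1^ n)

  inverse-^ : ∀ n {x y} → x * y ≈ 1# → x ^ n * y ^ n ≈ 1#
  inverse-^ n {x} {y} h = trans (sym (^-distrib-* x y n)) (trans (^-congˡ n h) (1^ n))

  unit-cancel : ∀ {x y z} → x * y ≈ 1# → x * z ≈ 0# → z ≈ 0#
  unit-cancel {x} {y} {z} h k = trans (sym (*-identityˡ z)) (trans (*-congʳ (sym h))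
    (trans (*-assoc x y z) (trans (x∙yz≈y∙xz x y z) (trans (*-congˡ k) (zeroʳ y)))))

  inverse-unique : ∀ {x y z} → x * y ≈ 1# → x * z ≈ 1# → y ≈ z
  inverse-unique {x} {y} {z} h k = trans (sym (*-identityʳ y)) (trans (*-congˡ (sym k))
    (trans (x∙yz≈y∙xz y x z) (trans (sym (*-assoc x y z)) (trans (*-congʳ h) (*-identityˡ z)))))

module LaurentProperties {a ℓa : Level} (A : CommutativeRing a ℓa) where
  open Laurent A
  private module L = CommutativeRing A[p,p⁻¹]

  private
    k₃ : RingHom A[p][q] A[p,p⁻¹]
    k₃ = QuotientProperties.quotientHom A[p][q] relation

    k₂ : RingHom A[p] A[p,p⁻¹]
    k₂ = k₃ ∘ᴴ PolynomialProperties.constantHom A[p]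

  laurentConstantHom : RingHom A A[p,p⁻¹]
  laurentConstantHom = k₂ ∘ᴴ PolynomialProperties.constantHom A

  laurent-p*p⁻¹≈1 : p L.* p⁻¹ L.≈ L.1#
  laurent-p*p⁻¹≈1 = x∙y⁻¹≈ε⇒x≈y _ _ (QuotientProperties.relation≈0 A[p][q] relation)
    where open RingFacts A[p,p⁻¹] using (x∙y⁻¹≈ε⇒x≈y)

  laurent-ind : ∀ {b ℓb t} {B : CommutativeRing b ℓb} (let open CommutativeRing B) (k : RingHom A[p,p⁻¹] B)
    (T : Carrier → Set t) →
    (∀ {x y} → x ≈ y → T x → T y) → (∀ {x y} → T x → T y → T (x + y)) → (∀ {x y} → T x → T y → T (x * y)) →
    (∀ f → T (RingHom.⟦_⟧ k (constant f))) → T (RingHom.⟦_⟧ k p) → T (RingHom.⟦_⟧ k p⁻¹) →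
    ∀ f → T (RingHom.⟦_⟧ k f)
  laurent-ind k T T-resp T-+ T-* T-c T-p T-p⁻¹ (f , _) = polynomial-ind (k ∘ᴴ k₃) T T-resp T-+ T-*
    (polynomial-ind (k ∘ᴴ k₂) T T-resp T-+ T-* T-c T-p) T-p⁻¹ f

  module LaurentUniversal {b ℓb : Level} {B : CommutativeRing b ℓb} (φ : RingHom A B) (pᴮ p⁻¹ᴮ : CommutativeRing.Carrier B)
    (pp⁻¹≈1 : CommutativeRing._≈_ B (CommutativeRing._*_ B pᴮ p⁻¹ᴮ) (CommutativeRing.1# B)) where
    private
      module B = CommutativeRing B
      module E₂ = Evaluation φ pᴮ
      module E₃ = Evaluation E₂.evalHom p⁻¹ᴮ
      open CommutativeRing A[p][q] using (_*_; 1#)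

      P : CommutativeRing.Carrier A[p][q]
      P = Polynomial.constant A[p] (Polynomial.X A)

      p↦ : E₃.eval P B.≈ pᴮ
      p↦ = B.trans (E₃.eval-constant (Polynomial.X A)) E₂.eval-X

    laurentHom : RingHom A[p,p⁻¹] B
    laurentHom = QuotientProperties.liftHom A[p][q] relation E₃.evalHom
      (RingHom.-homo-0 E₃.evalHom (P * Polynomial.X A[p]) 1#
        (B.trans (RingHom.*-homo E₃.evalHom P (Polynomial.X A[p])) (B.trans (B.*-cong p↦ E₃.eval-X)
          (B.trans pp⁻¹≈1 (B.sym (RingHom.1-homo E₃.evalHom))))))

    laurentHom-constant : ∀ f → RingHom.⟦_⟧ laurentHom (constant f) B.≈ RingHom.⟦_⟧ φ f
    laurentHom-constant f = B.trans (E₃.eval-constant (Polynomial.constant A f)) (E₂.eval-constant f)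

    laurentHom-p : RingHom.⟦_⟧ laurentHom p B.≈ pᴮ
    laurentHom-p = p↦

    laurentHom-p⁻¹ : RingHom.⟦_⟧ laurentHom p⁻¹ B.≈ p⁻¹ᴮ
    laurentHom-p⁻¹ = E₃.eval-X

module AdjoinRootProperties {a ℓa : Level} (A : CommutativeRing a ℓa) (e : ℕ) (r : CommutativeRing.Carrier A) where
  open AdjoinRoot A e r
  private module Adj = CommutativeRing A[x]
  open RawSemiringDefinitions (Semiring.rawSemiring Adj.semiring) using (_^_)

  private
    k₅ : RingHom A[X] A[x]
    k₅ = QuotientProperties.quotientHom A[X] relation

  adjoinConstantHom : RingHom A A[x]
  adjoinConstantHom = k₅ ∘ᴴ PolynomialProperties.constantHom A

  xᵉ≈r : x ^ e Adj.≈ constant r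
  xᵉ≈r = Adj.trans (Adj.sym (RingHom.^-homo k₅ (Polynomial.X A) e))
    (x∙y⁻¹≈ε⇒x≈y _ _ (QuotientProperties.relation≈0 A[X] relation))
    where open RingFacts A[x] using (x∙y⁻¹≈ε⇒x≈y)

  adjoin-ind : ∀ {t} (T : Adj.Carrier → Set t) →
    (∀ {x y} → x Adj.≈ y → T x → T y) → (∀ {x y} → T x → T y → T (x Adj.+ y)) → (∀ {x y} → T x → T y → T (x Adj.* y)) →
    (∀ f → T (constant f)) → T x → ∀ f → T f
  adjoin-ind T T-resp T-+ T-* T-c T-x (f , _) = polynomial-ind k₅ T T-resp T-+ T-* T-c T-x f

  module AdjoinUniversal {b ℓb : Level} {B : CommutativeRing b ℓb} (φ : RingHom A B) (xᴮ : CommutativeRing.Carrier B)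
    (xᵉ≈ : CommutativeRing._≈_ B (RawSemiringDefinitions._^_ (Semiring.rawSemiring (CommutativeRing.semiring B)) xᴮ e)
      (RingHom.⟦_⟧ φ r)) where
    private
      module B = CommutativeRing B
      module E₅ = Evaluation φ xᴮ
      open RawSemiringDefinitions (Semiring.rawSemiring (CommutativeRing.semiring A[X])) using () renaming (_^_ to _^ˣ_)

    adjoinHom : RingHom A[x] B
    adjoinHom = QuotientProperties.liftHom A[X] relation E₅.evalHom
      (RingHom.-homo-0 E₅.evalHom (Polynomial.X A ^ˣ e) (Polynomial.constant A r)
        (B.trans (RingHom.^-homo E₅.evalHom (Polynomial.X A) e) (B.trans (Powers.^-congˡ B e E₅.eval-X)
          (B.trans xᵉ≈ (B.sym (E₅.eval-constant r))))))

    adjoinHom-constant : ∀ f → RingHom.⟦_⟧ adjoinHom (constant f) B.≈ RingHom.⟦_⟧ φ f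
    adjoinHom-constant = E₅.eval-constant

    adjoinHom-x : RingHom.⟦_⟧ adjoinHom x B.≈ xᴮ
    adjoinHom-x = E₅.eval-X

module PresentationProperties {c ℓ : Level} (F : CommutativeRing c ℓ) (e h : ℕ) where
  open Presentation F e h
  private
    module Pres = CommutativeRing F[y,p,p⁻¹][x]
    module L = CommutativeRing F[y,p,p⁻¹]
    open RawSemiringDefinitions (Semiring.rawSemiring Pres.semiring) using (_^_)

    coefficientHom : RingHom F[y,p,p⁻¹] F[y,p,p⁻¹][x]
    coefficientHom = AdjoinRootProperties.adjoinConstantHom F[y,p,p⁻¹] e pʰy

  scalarHom : RingHom F F[y,p,p⁻¹][x]
  scalarHom = coefficientHom ∘ᴴ LaurentProperties.laurentConstantHom F[y] ∘ᴴ PolynomialProperties.constantHom F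

  presentation-ind : ∀ {t} (T : Pres.Carrier → Set t) →
    (∀ {x y} → x Pres.≈ y → T x → T y) → (∀ {x y} → T x → T y → T (x Pres.+ y)) →
    (∀ {x y} → T x → T y → T (x Pres.* y)) →
    (∀ k → T (scalar k)) → T y → T p → T p⁻¹ → T x → ∀ b → T b
  presentation-ind T T-resp T-+ T-* T-k T-y T-p T-p⁻¹ T-x =
    AdjoinRootProperties.adjoin-ind F[y,p,p⁻¹] e pʰy T T-resp T-+ T-*
      (LaurentProperties.laurent-ind F[y] coefficientHom T T-resp T-+ T-*
        (polynomial-ind (coefficientHom ∘ᴴ LaurentProperties.laurentConstantHom F[y]) T T-resp T-+ T-* T-k T-y)
        T-p T-p⁻¹)
      T-x

  p*p⁻¹≈1 : p Pres.* p⁻¹ Pres.≈ Pres.1#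
  p*p⁻¹≈1 = Pres.trans
    (Pres.sym (RingHom.*-homo coefficientHom (Laurent.p F[y]) (Laurent.p⁻¹ F[y])))
    (RingHom.cong coefficientHom {Laurent.p F[y] L.* Laurent.p⁻¹ F[y]} {L.1#} (LaurentProperties.laurent-p*p⁻¹≈1 F[y]))

  xᵉ≈pʰy : x ^ e Pres.≈ p ^ h Pres.* y
  xᵉ≈pʰy = Pres.trans (AdjoinRootProperties.xᵉ≈r F[y,p,p⁻¹] e pʰy)
    (Pres.trans (RingHom.*-homo coefficientHom (Laurent.p F[y] ^ᴸ h) (Laurent.constant F[y] (Polynomial.X F)))
      (Pres.*-congʳ (RingHom.^-homo coefficientHom (Laurent.p F[y]) h)))
    where open RawSemiringDefinitions (Semiring.rawSemiring L.semiring) using () renaming (_^_ to _^ᴸ_)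

  module Universal {s ℓs : Level} {S : CommutativeRing s ℓs} (ι : RingHom F S) (yˢ pˢ p⁻¹ˢ xˢ : CommutativeRing.Carrier S)
    (pp⁻¹≈1 : CommutativeRing._≈_ S (CommutativeRing._*_ S pˢ p⁻¹ˢ) (CommutativeRing.1# S))
    (xᵉ≈pʰyˢ : CommutativeRing._≈_ S (RawSemiringDefinitions._^_ (Semiring.rawSemiring (CommutativeRing.semiring S)) xˢ e)
      (CommutativeRing._*_ S (RawSemiringDefinitions._^_ (Semiring.rawSemiring (CommutativeRing.semiring S)) pˢ h) yˢ)) where
    private
      module S = CommutativeRing S
      module E₁ = Evaluation ι yˢ
      module U₁ = LaurentProperties.LaurentUniversal F[y] E₁.evalHom pˢ p⁻¹ˢ pp⁻¹≈1
      open RawSemiringDefinitions (Semiring.rawSemiring L.semiring) using () renaming (_^_ to _^ᴸ_)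

      pʰy↦ : RingHom.⟦_⟧ U₁.laurentHom pʰy S.≈ RawSemiringDefinitions._^_ (Semiring.rawSemiring S.semiring) pˢ h S.* yˢ
      pʰy↦ = S.trans (RingHom.*-homo U₁.laurentHom (Laurent.p F[y] ^ᴸ h) (Laurent.constant F[y] (Polynomial.X F))) (S.*-cong
        (S.trans (RingHom.^-homo U₁.laurentHom (Laurent.p F[y]) h) (Powers.^-congˡ S h U₁.laurentHom-p))
        (S.trans (U₁.laurentHom-constant (Polynomial.X F)) E₁.eval-X))

      module U₂ = AdjoinRootProperties.AdjoinUniversal F[y,p,p⁻¹] e pʰy U₁.laurentHom xˢ (S.trans xᵉ≈pʰyˢ (S.sym pʰy↦))

    universal : RingHom F[y,p,p⁻¹][x] S
    universal = U₂.adjoinHom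

    open RingHom universal using (⟦_⟧)

    universal-scalar : ∀ k → ⟦ scalar k ⟧ S.≈ RingHom.⟦_⟧ ι k
    universal-scalar k = S.trans (U₂.adjoinHom-constant (Laurent.constant F[y] (Polynomial.constant F k)))
      (S.trans (U₁.laurentHom-constant (Polynomial.constant F k)) (E₁.eval-constant k))

    universal-y : ⟦ y ⟧ S.≈ yˢ
    universal-y = S.trans (U₂.adjoinHom-constant (Laurent.constant F[y] (Polynomial.X F)))
      (S.trans (U₁.laurentHom-constant (Polynomial.X F)) E₁.eval-X)

    universal-p : ⟦ p ⟧ S.≈ pˢ
    universal-p = S.trans (U₂.adjoinHom-constant (Laurent.p F[y])) U₁.laurentHom-p

    universal-p⁻¹ : ⟦ p⁻¹ ⟧ S.≈ p⁻¹ˢ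
    universal-p⁻¹ = S.trans (U₂.adjoinHom-constant (Laurent.p⁻¹ F[y])) U₁.laurentHom-p⁻¹

    universal-x : ⟦ x ⟧ S.≈ xˢ
    universal-x = U₂.adjoinHom-x

module _ {a ℓa b ℓb c ℓc : Level} {A : CommutativeRing a ℓa} {B : CommutativeRing b ℓb} {C : CommutativeRing c ℓc} where
  open CommutativeRing C

  eval-natural : (ψ : RingHom B C) (φ : RingHom A B) (φ′ : RingHom A C) (s : CommutativeRing.Carrier B) (s′ : Carrier) →
    (∀ d → RingHom.⟦_⟧ ψ (RingHom.⟦_⟧ φ d) ≈ RingHom.⟦_⟧ φ′ d) → RingHom.⟦_⟧ ψ s ≈ s′ →
    ∀ f → RingHom.⟦_⟧ ψ (Evaluation.eval φ s f) ≈ Evaluation.eval φ′ s′ f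
  eval-natural ψ φ φ′ s s′ hc hs []      = RingHom.0-homo ψ
  eval-natural ψ φ φ′ s s′ hc hs (d ∷ f) = trans (RingHom.+-homo ψ _ _)
    (+-cong (hc d) (trans (RingHom.*-homo ψ s _) (*-cong hs (eval-natural ψ φ φ′ s s′ hc hs f))))

-- If p is a unit and xᵉ = pʰy, then up to a power of p every polynomial in y, p, p⁻¹, x
-- is the value of an element of F[p][x].
module Normalisation {f ℓf b ℓb : Level} {F : CommutativeRing f ℓf} {B : CommutativeRing b ℓb} (σ : RingHom F B)
  (y p p⁻¹ x : CommutativeRing.Carrier B) where
  open CommutativeRing B
  open Powers B
  open CommutativeSemigroupProperties *-commutativeSemigroup using (interchange)

  F[p] F[p][x] : CommutativeRing f ℓf
  F[p]    = Polynomial.polyRing F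
  F[p][x] = Polynomial.polyRing F[p]

  private
    module E₁ = Evaluation σ p
    module E₂ = Evaluation E₁.evalHom x
    module P = CommutativeRing F[p][x]
    open RawSemiringDefinitions (Semiring.rawSemiring P.semiring) using () renaming (_^_ to _^ᴾ_)

    P-p : P.Carrier
    P-p = Polynomial.constant F[p] (Polynomial.X F)

  normal : RingHom F[p][x] B
  normal = E₂.evalHom

  open RingHom normal using (⟦_⟧; +-homo; *-homo; ^-homo; 1-homo)

  ⟦p⟧ : ⟦ P-p ⟧ ≈ p
  ⟦p⟧ = trans (E₂.eval-constant (Polynomial.X F)) E₁.eval-X

  ⟦p^⟧ : ∀ n → ⟦ P-p ^ᴾ n ⟧ ≈ p ^ n
  ⟦p^⟧ n = trans (^-homo P-p n) (^-congˡ n ⟦p⟧)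

  Normalisable : Carrier → Set (f ⊔ ℓb)
  Normalisable z = Σ[ n ∈ ℕ ] Σ[ g ∈ P.Carrier ] p ^ n * z ≈ ⟦ g ⟧

  normalisable-resp : ∀ {w z} → w ≈ z → Normalisable w → Normalisable z
  normalisable-resp h (n , g , k) = n , g , trans (*-congˡ (sym h)) k

  normalisable-+ : ∀ {w z} → Normalisable w → Normalisable z → Normalisable (w + z)
  normalisable-+ {w} {z} (m , f , h) (n , g , k) = m ℕ.+ n , (P-p ^ᴾ n) P.* f P.+ (P-p ^ᴾ m) P.* g , (begin
    p ^ (m ℕ.+ n) * (w + z)                      ≈⟨ *-congʳ (^-homo-* p m n) ⟩
    (p ^ m * p ^ n) * (w + z)                    ≈⟨ distribˡ _ w z ⟩
    (p ^ m * p ^ n) * w + (p ^ m * p ^ n) * z    ≈⟨ +-cong (*-congʳ (*-comm _ _)) refl ⟩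
    (p ^ n * p ^ m) * w + (p ^ m * p ^ n) * z    ≈⟨ +-cong (*-assoc _ _ _) (*-assoc _ _ _) ⟩
    p ^ n * (p ^ m * w) + p ^ m * (p ^ n * z)    ≈⟨ +-cong (*-cong (sym (⟦p^⟧ n)) h) (*-cong (sym (⟦p^⟧ m)) k) ⟩
    ⟦ P-p ^ᴾ n ⟧ * ⟦ f ⟧ + ⟦ P-p ^ᴾ m ⟧ * ⟦ g ⟧  ≈⟨ +-cong (*-homo (P-p ^ᴾ n) f) (*-homo (P-p ^ᴾ m) g) ⟨
    ⟦ (P-p ^ᴾ n) P.* f ⟧ + ⟦ (P-p ^ᴾ m) P.* g ⟧  ≈⟨ +-homo ((P-p ^ᴾ n) P.* f) ((P-p ^ᴾ m) P.* g) ⟨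
    ⟦ (P-p ^ᴾ n) P.* f P.+ (P-p ^ᴾ m) P.* g ⟧    ∎)
    where open SetoidReasoning setoid

  normalisable-* : ∀ {w z} → Normalisable w → Normalisable z → Normalisable (w * z)
  normalisable-* {w} {z} (m , f , h) (n , g , k) = m ℕ.+ n , f P.* g , trans (*-congʳ (^-homo-* p m n))
    (trans (interchange _ _ w z) (trans (*-cong h k) (sym (*-homo f g))))

  private
    normal⇒normalisable : ∀ {z} g → z ≈ ⟦ g ⟧ → Normalisable z
    normal⇒normalisable g h = 0 , g , trans (*-identityˡ _) h

  normalisable-scalar : ∀ k → Normalisable (RingHom.⟦_⟧ σ k)
  normalisable-scalar k = normal⇒normalisable (Polynomial.constant F[p] (Polynomial.constant F k))
    (sym (trans (E₂.eval-constant (Polynomial.constant F k)) (E₁.eval-constant k)))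

  normalisable-p : Normalisable p
  normalisable-p = normal⇒normalisable P-p (sym ⟦p⟧)

  normalisable-x : Normalisable x
  normalisable-x = normal⇒normalisable (Polynomial.X F[p]) (sym E₂.eval-X)

  normalisable-p⁻¹ : p * p⁻¹ ≈ 1# → Normalisable p⁻¹
  normalisable-p⁻¹ h = 1 , P.1# , trans (*-congʳ (*-identityʳ p)) (trans h (sym 1-homo))

  normalisable-y : ∀ e h → x ^ e ≈ p ^ h * y → Normalisable y
  normalisable-y e h k = h , Polynomial.X F[p] ^ᴾ e ,
    trans (sym k) (sym (trans (^-homo (Polynomial.X F[p]) e) (^-congˡ e E₂.eval-X)))

  -- If `z` is in the kernel, so is its multiple by the clearing power of `p`, which is the value of
  -- some `g`. Then `g` is zero, and the clearing power, being a unit, cancels.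
  injective-if-normal-injective : ∀ {s ℓs} {S : CommutativeRing s ℓs} (ψ : RingHom B S) → p * p⁻¹ ≈ 1# →
    (∀ z → Normalisable z) →
    (∀ g → CommutativeRing._≈_ S (RingHom.⟦_⟧ ψ ⟦ g ⟧) (CommutativeRing.0# S) → g P.≈ P.0#) →
    ∀ z → CommutativeRing._≈_ S (RingHom.⟦_⟧ ψ z) (CommutativeRing.0# S) → z ≈ 0#
  injective-if-normal-injective {S = S} ψ pp⁻¹≈1 all inj z h = let n , g , k = all z in
    unit-cancel (inverse-^ n pp⁻¹≈1) (trans k (trans (RingHom.cong normal
      (inj g (S.trans (RingHom.cong ψ (sym k)) (S.trans (RingHom.*-homo ψ (p ^ n) z)
        (S.trans (S.*-congˡ h) (S.zeroʳ _)))))) (RingHom.0-homo normal)))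
    where module S = CommutativeRing S

-- The graded ring over the small classes.

module _ {c ℓ : Level} {R : CommutativeRing c ℓ} where
  open CommutativeRing R

  -- The φ-expansion in Horner form, as an inductive family: proofs about arbitrary polynomials
  -- recurse on it instead of on a degree.
  data Expansion (φ : Carrier) (Small : Carrier → Set ℓ) : Carrier → Set (c ⊔ ℓ) where
    nil  : ∀ {f} → f ≈ 0# → Expansion φ Small f
    cons : ∀ {f a g} → Small a → Expansion φ Small g → f ≈ a + φ * g → Expansion φ Small f

  -- What a valuation μᵢ shares with its key polynomial φᵢ; the small elements
  -- are the polynomials of degree < deg φᵢ. Their classes in the graded ring
  -- form a graded field, over which the graded ring is generated by the class of φᵢ.

  record IsAdapted (V : Valuation R) (φ : Carrier) (Small : Carrier → Set ℓ) : Set (c ⊔ ℓ) where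
    open ValuationProperties V
    field
      small-resp    : ∀ {a b} → a ≈ b → Small a → Small b
      small-0       : Small 0#
      small-1       : Small 1#
      small-+       : ∀ {a b} → Small a → Small b → Small (a + b)
      small-neg     : ∀ {a} → Small a → Small (- a)
      small-*       : ∀ {a b γ} → Small a → Small b → val (a * b) ≡ [ γ ] → ∃[ d ] Small d × a * b ∼[ γ ] d
      small-inverse : ∀ {a} → Small a → ¬ a ≈ 0# → ∃[ b ] Small b × a * b ∼[ 0ℚ ] 1#
      φ-nonzero     : ¬ φ ≈ 0#
      split         : ∀ {a} g → Small a → val (a + φ * g) ≡ val a ⊓⁺ val (φ * g)
      expand        : ∀ f → Expansion φ Small f

    private
      ≤⁺-split : ∀ {γ} a b → [ γ ] ≤⁺ a ⊓⁺ b → [ γ ] ≤⁺ a × [ γ ] ≤⁺ b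
      ≤⁺-split [ a ] [ b ] [ h ] = [ ℚ.p≤q⊓r⇒p≤q a b h ] , [ ℚ.p≤q⊓r⇒p≤r a b h ]
      ≤⁺-split [ a ] ⊤⁺    h     = h , (_ ≤⊤⁺)
      ≤⁺-split ⊤⁺    b     h     = (_ ≤⊤⁺) , h

      <⁺-split : ∀ {γ} a b → [ γ ] <⁺ a ⊓⁺ b → [ γ ] <⁺ a × [ γ ] <⁺ b
      <⁺-split [ a ] [ b ] [ h ] = [ ℚ.<-≤-trans h (ℚ.p⊓q≤p a b) ] , [ ℚ.<-≤-trans h (ℚ.p⊓q≤q a b) ]
      <⁺-split [ a ] ⊤⁺    h     = h , [ _ ]<⊤⁺
      <⁺-split ⊤⁺    b     h     = [ _ ]<⊤⁺ , h

    split-𝒫 : ∀ {a γ} g → Small a → a + φ * g ∈𝒫 γ → a ∈𝒫 γ × φ * g ∈𝒫 γ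
    split-𝒫 g a∈ h = ≤⁺-split _ _ (≡.subst (_ ≤⁺_) (split g a∈) h)

    -- A small element and a multiple of `φ` cannot cancel each other modulo 𝒫⁺: the algebraic
    -- independence of H(φ) over the small classes.
    split-𝒫⁺ : ∀ {a γ} g → Small a → a + φ * g ∈𝒫⁺ γ → a ∈𝒫⁺ γ × φ * g ∈𝒫⁺ γ
    split-𝒫⁺ g a∈ h = <⁺-split _ _ (≡.subst (_ <⁺_) (split g a∈) h)

module Homogeneity {c ℓ : Level} {R : CommutativeRing c ℓ} {V : Valuation R} {φ : CommutativeRing.Carrier R}
  {Small : CommutativeRing.Carrier R → Set ℓ} (adapted : IsAdapted V φ Small) where
  private module R = CommutativeRing R
  open R using (Carrier; 1#) renaming (_≈_ to _≈ᴿ_; _*_ to _*ᴿ_; _+_ to _+ᴿ_)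
  open ValuationProperties V
  open GradedProperties V
  open GradedRing V using (Gr; H; gradedRing)
  open Gr using (_≈_; _*_; _+_)
  open IsAdapted adapted
  open Powers gradedRing

  -- A nonzero homogeneous element of the graded field D. In contrast to `IsClass`, the degree is
  -- the exact value of the representative.
  record IsSmallClass (α : ℚ) (a : Gr) : Set (c ⊔ ℓ) where
    constructor smallClass
    field
      {f}   : Carrier
      small   : Small f
      val-f   : val f ≡ [ α ]
      f-class : IsClass α f a

  small-class-degree : ∀ {α β a} → α ≡ β → IsSmallClass α a → IsSmallClass β a
  small-class-degree ≡.refl h = h

  small-class-* : ∀ {α β a b} → IsSmallClass α a → IsSmallClass β b → IsSmallClass (α ℚ.+ β) (a * b)
  small-class-* (smallClass s v k) (smallClass s′ v′ k′) =
    let d , sd , p = small-* s s′ (val-*ᵛ v v′)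
    in smallClass sd (∼-val (∼-sym p) (val-*ᵛ v v′)) (class-∼ (class-* k k′) p)

  small-class-1 : IsSmallClass 0ℚ Gr.1#
  small-class-1 = smallClass small-1 val-1# 1-class

  -- Inverses are unique in a ring, so `b`, however it was obtained, coincides with the class of the
  -- small inverse.
  small-class-inverse : ∀ {α a b} → IsSmallClass α a → a * b ≈ Gr.1# → IsSmallClass (ℚ.- α) b
  small-class-inverse {α} {a} {b} (smallClass {f} s v k) h =
    let g , sg , p = small-inverse s (val≢⊤ v)
        vg : val g ≡ [ ℚ.- α ]
        vg = unit-val v p
        a*Hg≈1 : a * H g ≈ Gr.1#
        a*Hg≈1 = class-unique (class-degree (ℚ.+-inverseʳ α) (class-* k (H-class vg))) 1-class p
    in smallClass sg vg (class-resp (inverse-unique {a} a*Hg≈1 h) (H-class vg))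

  small-H : ∀ {f α} → Small f → val f ≡ [ α ] → IsSmallClass α (H f)
  small-H s v = smallClass s v (H-class v)

  module _ {lam : ℚ} {x : Gr} where
    -- The degree-`α` part of D[x]: a coefficient of `x ^ n` must have degree `α - n lam`.
    data SumOfMonomials (α : ℚ) : Gr → Set (c ⊔ ℓ) where
      zero     : SumOfMonomials α []
      plus     : ∀ {a b} → SumOfMonomials α a → SumOfMonomials α b → SumOfMonomials α (a + b)
      resp     : ∀ {a b} → a ≈ b → SumOfMonomials α a → SumOfMonomials α b
      monomial : ∀ n {z} → IsSmallClass (α ℚ.- fromℕ n ℚ.* lam) z → SumOfMonomials α (x ^ n * z)

  -- `x` and `H φ` differ by the unit `d` of D, hence generate the same algebra over D. Along a
  -- chain `d` is the power of pᵣ that turns φᵣ into Φᵣ, or 1 when r = 0.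
  record IsGenerator (β γ lam : ℚ) (x d d⁻¹ : Gr) : Set (c ⊔ ℓ) where
    field
      val-φ     : val φ ≡ [ β ]
      d-small   : IsSmallClass γ d
      d*d⁻¹≈1   : d * d⁻¹ ≈ Gr.1#
      x≈φ*d     : x ≈ H φ * d
      lam≡      : lam ≡ β ℚ.+ γ

    x-class : ∃[ g ] val g ≡ [ γ ] × IsClass lam (φ *ᴿ g) x
    x-class with d-small
    ... | smallClass {g} _ v k = g , v ,
      class-degree (≡.sym lam≡) (class-resp (Gr.sym x≈φ*d) (class-* (H-class val-φ) k))

    φ≈x*d⁻¹ : H φ ≈ x * d⁻¹
    φ≈x*d⁻¹ = Gr.sym (Gr.trans (Gr.*-congʳ {d⁻¹} x≈φ*d) (Gr.trans (Gr.*-assoc (H φ) d d⁻¹)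
      (Gr.trans (Gr.*-congˡ {H φ} d*d⁻¹≈1) (Gr.*-identityʳ (H φ)))))

    Monomials : ℚ → Gr → Set (c ⊔ ℓ)
    Monomials = SumOfMonomials {lam} {x}

    φ*-monomials : ∀ {α a} → Monomials (α ℚ.- β) a → Monomials α (H φ * a)
    φ*-monomials zero       = resp (Gr.sym (Gr.zeroʳ (H φ))) zero
    φ*-monomials (plus {a} {b} h k) = resp (Gr.sym (Gr.distribˡ (H φ) a b)) (plus (φ*-monomials h) (φ*-monomials k))
    φ*-monomials (resp p h) = resp (Gr.*-congˡ {H φ} p) (φ*-monomials h)
    φ*-monomials {α} (monomial n {z} h) = resp (Gr.sym product)
      (monomial (suc n) (small-class-degree degrees (small-class-* (small-class-inverse d-small d*d⁻¹≈1) h)))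
      where
      open CommutativeSemigroupProperties Gr.*-commutativeSemigroup using (interchange)
      product : H φ * (x ^ n * z) ≈ (x * x ^ n) * (d⁻¹ * z)
      product = Gr.trans (Gr.*-congʳ {x ^ n * z} φ≈x*d⁻¹) (interchange x d⁻¹ (x ^ n) z)
      degrees : ℚ.- γ ℚ.+ ((α ℚ.- β) ℚ.- fromℕ n ℚ.* lam) ≡ α ℚ.- fromℕ (suc n) ℚ.* lam
      degrees = ≡.trans (solve 5 (λ α β γ n lam → :- γ :+ ((α :- β) :- n :* lam) := α :- ((β :+ γ) :+ n :* lam)) ≡.refl
          α β γ (fromℕ n) lam)
        (≡.cong (λ q → α ℚ.- q) (≡.trans (≡.cong (ℚ._+ fromℕ n ℚ.* lam) (≡.sym lam≡))
          (≡.trans (solve 2 (λ n lam → lam :+ n :* lam := (con ℚ.1ℚ :+ n) :* lam) ≡.refl (fromℕ n) lam)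
            (≡.cong (ℚ._* lam) (≡.sym (fromℕ-suc n))))))
        where open +-*-Solver

    Γ-β : ∀ {α} → Γ α → Γ (α ℚ.- β)
    Γ-β (f , g , a , b , hf , hg , ≡.refl) = f , g *ᴿ φ , a , b ℚ.+ β , hf , val-*ᵛ hg val-φ ,
      solve 3 (λ a b β → (a :- b) :- β := a :- (b :+ β)) ≡.refl a b β
      where open +-*-Solver

    -- Both parts of `a + φ * g` lie in `𝒫 α` by `split`. The small one is a monomial with exponent
    -- 0; `g` is treated in degree `α - β`, and multiplication by `H φ = x * d⁻¹` raises the
    -- exponents by one.
    monomials : ∀ {f} → Expansion φ Small f → ∀ {α a} → IsClass α f a → Monomials α a
    monomials (nil h) k = resp (Gr.sym (class-vanishes k (0∈𝒫⁺ h))) zero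
    monomials (cons {f} {a} {g} s e h) {α} {b} k =
      resp (class-unique (class-+ (class-isClass Γα a∈) (class-isClass Γα φg∈)) k (∼-refl (R.sym h)))
        (plus (small-part (𝒫-split a∈)) (resp φ-part (φ*-monomials (monomials e (class-isClass (Γ-β Γα) g∈)))))
      where
      Γα : Γ α
      Γα = class-Γ k
      a∈ : a ∈𝒫 α
      a∈ = proj₁ (split-𝒫 g s (𝒫-resp h (class-∈𝒫 k)))
      φg∈ : φ *ᴿ g ∈𝒫 α
      φg∈ = proj₂ (split-𝒫 g s (𝒫-resp h (class-∈𝒫 k)))
      g∈ : g ∈𝒫 α ℚ.- β
      g∈ = 𝒫-cancel val-φ (≡.subst (φ *ᴿ g ∈𝒫_) (≡.sym (x+[y-x]≡y β α)) φg∈)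
      φ-part : H φ * class (Γ-β Γα) g∈ ≈ class Γα φg∈
      φ-part = class-unique (class-degree (x+[y-x]≡y β α) (class-* (H-class val-φ) (class-isClass (Γ-β Γα) g∈)))
        (class-isClass Γα φg∈) (∼-refl R.refl)
      -- The value of `a` may exceed `α`, in which case it contributes nothing in this degree.
      small-part : a ∈𝒫⁺ α ⊎ val a ≡ [ α ] → Monomials α (class Γα a∈)
      small-part (inj₁ p) = resp (Gr.sym (class-vanishes (class-isClass Γα a∈) p)) zero
      small-part (inj₂ p) = resp (Gr.*-identityˡ (class Γα a∈)) (monomial 0 (small-class-degree degrees
        (smallClass s p (class-isClass Γα a∈))))
        where
        open +-*-Solver
        degrees : α ≡ α ℚ.- fromℕ 0 ℚ.* lam
        degrees = solve 2 (λ α lam → α := α :- con 0ℚ :* lam) ≡.refl α lam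

    class-monomials : ∀ {α f a} → IsClass α f a → Monomials α a
    class-monomials {f = f} = monomials (expand f)

module IntegerPowers {a ℓ : Level} (A : CommutativeRing a ℓ) (p p⁻¹ : CommutativeRing.Carrier A)
  (p*p⁻¹≈1 : CommutativeRing._≈_ A (CommutativeRing._*_ A p p⁻¹) (CommutativeRing.1# A)) where
  open CommutativeRing A
  open Powers A

  pow : ℤ → Carrier
  pow (+ n)    = p ^ n
  pow -[1+ n ] = p⁻¹ ^ suc n

  pow-inverse : ∀ n → pow n * pow (ℤ.- n) ≈ 1#
  pow-inverse (+ zero)  = *-identityˡ 1#
  pow-inverse (+ suc n) = inverse-^ (suc n) p*p⁻¹≈1
  pow-inverse -[1+ n ]  = inverse-^ (suc n) (trans (*-comm p⁻¹ p) p*p⁻¹≈1)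

module _ {c ℓ : Level} {R : CommutativeRing c ℓ} {V : Valuation R} {φ : CommutativeRing.Carrier R}
  {Small : CommutativeRing.Carrier R → Set ℓ} (adapted : IsAdapted V φ Small) where
  private module R = CommutativeRing R
  open ValuationProperties V
  open GradedProperties V
  open GradedRing V using (Gr; gradedRing)
  open Homogeneity adapted

  -- The classes of small elements form F[p, p⁻¹], and x is the class of φ up to a unit.

  record Coordinates {f ℓf : Level} {F : CommutativeRing f ℓf} (ι : RingHom F gradedRing) (δ lam : ℚ) : Set (c ⊔ ℓ ⊔ f ⊔ ℓf) where
    private module F = CommutativeRing F
    field
      ι-injective : ∀ k → RingHom.⟦_⟧ ι k Gr.≈ [] → k F.≈ F.0#
      ι-class     : ∀ k → ∃[ a ] Small a × IsClass 0ℚ a (RingHom.⟦_⟧ ι k)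
      class-ι     : ∀ {a b} → Small a → IsClass 0ℚ a b → ∃[ k ] RingHom.⟦_⟧ ι k Gr.≈ b
      0<δ         : 0ℚ ℚ.< δ
      p p⁻¹       : Gr
      p-small     : IsSmallClass δ p
      p*p⁻¹≈1     : p Gr.* p⁻¹ Gr.≈ Gr.1#
      small-val   : ∀ {a α} → Small a → val a ≡ [ α ] → ∃[ n ] α ≡ fromℤ n ℚ.* δ
      {β γ}       : ℚ
      x {d d⁻¹}   : Gr
      generator   : IsGenerator β γ lam x d d⁻¹

-- The structure theorem in coordinates.

module Structure {c ℓ f ℓf : Level} {R : CommutativeRing c ℓ} {V : Valuation R} {φ : CommutativeRing.Carrier R}
  {Small : CommutativeRing.Carrier R → Set ℓ} (adapted : IsAdapted V φ Small) {F : CommutativeRing f ℓf}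
  {ι : RingHom F (GradedRing.gradedRing V)} {δ lam : ℚ} (coordinates : Coordinates adapted ι δ lam) where

  private
    module R = CommutativeRing R
    module F = CommutativeRing F
  open ValuationProperties V
  open GradedProperties V
  open GradedRing V using (Gr; gradedRing)
  open Homogeneity adapted
  open Coordinates coordinates
  open R using (Carrier; 0#) renaming (_≈_ to _≈ᴿ_; _*_ to _*ᴿ_; _+_ to _+ᴿ_)
  open GradedRing V using (component; component-++; degree₀; Homogeneous; degree)
  open Gr using (_≈_; _*_; _+_)
  open IsAdapted adapted
  open IsGenerator generator
  open Powers gradedRing using (_^_; ^-congˡ)
  open IntegerPowers gradedRing p p⁻¹ p*p⁻¹≈1
  open +-*-Solver using (solve; _:=_; _:+_; _:*_; _:-_; :-_; con)

  p⁻¹-small : IsSmallClass (ℚ.- δ) p⁻¹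
  p⁻¹-small = small-class-inverse p-small p*p⁻¹≈1

  fromℕ-suc-* : ∀ n q → q ℚ.+ fromℕ n ℚ.* q ≡ fromℕ (suc n) ℚ.* q
  fromℕ-suc-* n q = ≡.trans (solve 2 (λ n q → q :+ n :* q := (con ℚ.1ℚ :+ n) :* q) ≡.refl (fromℕ n) q)
    (≡.cong (ℚ._* q) (≡.sym (fromℕ-suc n)))

  small-class-^ : ∀ n {α a} → IsSmallClass α a → IsSmallClass (fromℕ n ℚ.* α) (a ^ n)
  small-class-^ zero    {α} h = small-class-degree (≡.sym (ℚ.*-zeroˡ α)) small-class-1
  small-class-^ (suc n) {α} h = small-class-degree (fromℕ-suc-* n α) (small-class-* h (small-class-^ n h))

  pure-^ : ∀ n {α a} → IsPure α a → IsPure (fromℕ n ℚ.* α) (a ^ n)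
  pure-^ zero    {α} h = pure-degree (≡.sym (ℚ.*-zeroˡ α)) (class-pure 1-class)
  pure-^ (suc n) {α} h = pure-degree (fromℕ-suc-* n α) (pure-* h (pure-^ n h))

  pow-small : ∀ n → IsSmallClass (fromℤ n ℚ.* δ) (pow n)
  pow-small (+ n)    = small-class-^ n p-small
  pow-small -[1+ n ] = small-class-degree
    (≡.trans (solve 2 (λ n δ → n :* (:- δ) := (:- n) :* δ) ≡.refl (fromℕ (suc n)) δ) (≡.cong (ℚ._* δ) (≡.sym (fromℤ-neg (+ suc n)))))
    (small-class-^ (suc n) p⁻¹-small)

  -- The degree is an integral multiple of `δ`, so dividing by a power of `p` leads to degree 0,
  -- where the small classes are the image of `F`.
  small-class≈ : ∀ {α a} → IsSmallClass α a → ∃[ n ] ∃[ k ] α ≡ fromℤ n ℚ.* δ × a ≈ RingHom.⟦_⟧ ι k * pow n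
  small-class≈ {α} {a} h =
    let n , α≡ = small-val (IsSmallClass.small h) (IsSmallClass.val-f h)
        z = small-class-degree (degrees n α≡) (small-class-* h (pow-small (ℤ.- n)))
        k , e = class-ι (IsSmallClass.small z) (IsSmallClass.f-class z)
    in n , k , α≡ , Gr.sym (Gr.trans (Gr.*-congʳ {pow n} e) (Gr.trans (Gr.*-assoc a (pow (ℤ.- n)) (pow n))
      (Gr.trans (Gr.*-congˡ {a} (Gr.trans (Gr.*-comm (pow (ℤ.- n)) (pow n)) (pow-inverse n))) (Gr.*-identityʳ a))))
    where
    degrees : ∀ n → α ≡ fromℤ n ℚ.* δ → α ℚ.+ fromℤ (ℤ.- n) ℚ.* δ ≡ 0ℚ
    degrees n ≡.refl = ≡.trans (≡.cong (λ q → α ℚ.+ q ℚ.* δ) (fromℤ-neg n))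
      (solve 2 (λ n δ → n :* δ :+ (:- n) :* δ := con 0ℚ) ≡.refl (fromℤ n) δ)

  x-pure : IsPure lam x
  x-pure = class-pure (proj₂ (proj₂ x-class))

  module E₁ = Evaluation ι p
  module E₂ = Evaluation E₁.evalHom x

  SmallAt : ℚ → Gr → Set (c ⊔ ℓ)
  SmallAt γ a = ∃[ b ] Small b × component γ a ∼[ γ ] b

  private
    component-ι : ∀ {γ} k → γ ≢ 0ℚ → component γ (RingHom.⟦_⟧ ι k) ∈𝒫⁺ γ
    component-ι k h = class-component-≢ (proj₂ (proj₂ (ι-class k))) λ e → h (≡.sym e)

    p-val : Σ[ w ∈ Carrier ] Small w × val w ≡ [ δ ] × IsClass δ w p
    p-val = IsSmallClass.f p-small , IsSmallClass.small p-small , IsSmallClass.val-f p-small , IsSmallClass.f-class p-small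

    component-p* : ∀ γ a → component γ (p * a) ∼[ γ ] proj₁ p-val *ᴿ component (γ ℚ.- δ) a
    component-p* γ a = component-class-* γ a (proj₂ (proj₂ (proj₂ p-val)))

    component-∷ : ∀ γ k l → component γ (E₁.eval (k ∷ l)) ≈ᴿ
      component γ (RingHom.⟦_⟧ ι k) +ᴿ component γ (p * E₁.eval l)
    component-∷ γ k l = component-++ γ (RingHom.⟦_⟧ ι k) (p * E₁.eval l)

  -- Elements of F[p] mix degrees, but `split` speaks of a single small polynomial. A small
  -- representative in each degree allows it to be applied degree by degree.
  F[p]-small : ∀ l γ → SmallAt γ (E₁.eval l)
  F[p]-small []      γ = 0# , small-0 , ∼-refl R.refl
  F[p]-small (k ∷ l) γ =
    let a , a-small , a∼ = head (γ ℚ.≟ 0ℚ)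
        b , b-small , b∼ = tail (F[p]-small l (γ ℚ.- δ))
    in a +ᴿ b , small-+ a-small b-small , ∼-trans (∼-refl (component-∷ γ k l)) (∼-+ a∼ b∼)
    where
    head : Dec (γ ≡ 0ℚ) → SmallAt γ (RingHom.⟦_⟧ ι k)
    head (yes ≡.refl) = let a , s , h = ι-class k in a , s , class-component h
    head (no γ≢0)     = 0# , small-0 , ∼-0 (component-ι k γ≢0)
    tail : SmallAt (γ ℚ.- δ) (E₁.eval l) → SmallAt γ (p * E₁.eval l)
    tail (b , s , h) = let d , sd , e = product (𝒫-split wb∈)
      in d , sd , ∼-trans (component-p* γ (E₁.eval l)) (∼-trans wb∼ e)
      where
      w : Carrier
      w = proj₁ p-val
      w∈ : w ∈𝒫 δ
      w∈ = val⇒𝒫 (proj₁ (proj₂ (proj₂ p-val)))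
      wb∼ : w *ᴿ component (γ ℚ.- δ) (E₁.eval l) ∼[ γ ] w *ᴿ b
      wb∼ = ≡.subst (λ q → w *ᴿ component (γ ℚ.- δ) (E₁.eval l) ∼[ q ] w *ᴿ b) (x+[y-x]≡y δ γ) (∼-*ˡ w∈ h)
      wb∈ : w *ᴿ b ∈𝒫 γ
      wb∈ = ≡.subst (w *ᴿ b ∈𝒫_) (x+[y-x]≡y δ γ) (𝒫-* w∈ (∼-𝒫 (∼-sym h) (component-∈𝒫 _ (E₁.eval l))))
        where open GradedRing V using (component-∈𝒫)
      -- `b` is only known modulo 𝒫⁺, so `w * b` may vanish in degree `γ`; its small representative
      -- is then 0.
      product : w *ᴿ b ∈𝒫⁺ γ ⊎ val (w *ᴿ b) ≡ [ γ ] → ∃[ d ] Small d × w *ᴿ b ∼[ γ ] d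
      product (inj₁ h) = 0# , small-0 , ∼-0 h
      product (inj₂ h) = small-* (proj₁ (proj₂ p-val)) s h

  private
    component-p*-negative : ∀ {γ} l → γ ℚ.≤ 0ℚ → component (γ ℚ.- δ) (E₁.eval l) ∈𝒫⁺ γ ℚ.- δ →
      component γ (p * E₁.eval l) ∈𝒫⁺ γ
    component-p*-negative {γ} l γ≤0 h = ∼-𝒫⁺ (component-p* γ (E₁.eval l))
      (≡.subst (λ q → proj₁ p-val *ᴿ component (γ ℚ.- δ) (E₁.eval l) ∈𝒫⁺ q) (x+[y-x]≡y δ γ) (𝒫⁺-* (val⇒𝒫 (proj₁ (proj₂ (proj₂ p-val)))) h))

    -δ<0 : ∀ {γ} → γ ℚ.≤ 0ℚ → γ ℚ.- δ ℚ.< 0ℚ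
    -δ<0 {γ} h = ℚ.≤-<-trans (ℚ.+-monoˡ-≤ (ℚ.- δ) h)
      (≡.subst (ℚ._< 0ℚ) (≡.sym (ℚ.+-identityˡ (ℚ.- δ))) (ℚ.neg-antimono-< 0<δ))

  -- Multiplication by `p` shifts degrees up by `δ > 0` and the scalars have degree 0. Consequently
  -- `p * E₁.eval l` has no component in degree 0, which isolates the constant coefficient in
  -- `F[p]-injective`.
  F[p]-nonnegative : ∀ l {γ} → γ ℚ.< 0ℚ → component γ (E₁.eval l) ∈𝒫⁺ γ
  F[p]-nonnegative []      γ<0 = 𝒫⁺-0#
  F[p]-nonnegative (k ∷ l) {γ} γ<0 = 𝒫⁺-resp (R.sym (component-∷ γ k l))
    (𝒫⁺-+ (component-ι k (ℚ.<⇒≢ γ<0))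
      (component-p*-negative l (ℚ.<⇒≤ γ<0) (F[p]-nonnegative l (-δ<0 (ℚ.<⇒≤ γ<0)))))

  F[p]-injective : ∀ l → E₁.eval l ≈ [] → CommutativeRing._≈_ (Polynomial.polyRing F) l []
  F[p]-injective []      h = Polynomial.≈-refl F
  F[p]-injective (k ∷ l) h = Polynomial.≈-trans F (Polynomial.shift-cong F k≈0 (F[p]-injective l l≈0)) (Polynomial.shift-[] F)
    where
    p-part : component 0ℚ (p * E₁.eval l) ∈𝒫⁺ 0ℚ
    p-part = component-p*-negative l ℚ.≤-refl (F[p]-nonnegative l (-δ<0 ℚ.≤-refl))
    ιk-part : ∀ γ → component γ (RingHom.⟦_⟧ ι k) ∈𝒫⁺ γ
    ιk-part γ with γ ℚ.≟ 0ℚ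
    ... | no γ≢0     = component-ι k γ≢0
    ... | yes ≡.refl = ∼-𝒫⁺ (∼-sym (+-∼ _ p-part)) (𝒫⁺-resp (component-∷ 0ℚ k l) (≈[]⇒ 0ℚ h))
    k≈0 : k F.≈ F.0#
    k≈0 = ι-injective k (⇒≈[] ιk-part)
    l≈0 : E₁.eval l ≈ []
    l≈0 = class-*-cancel (proj₁ (proj₂ (proj₂ p-val))) (proj₂ (proj₂ (proj₂ p-val)))
      (Gr.trans (Gr.sym (Gr.+-congʳ {p * E₁.eval l} (⇒≈[] ιk-part))) h)

  -- In each degree the element is a small polynomial plus a multiple of `φ`, since `x` is the class
  -- of such a multiple. If the sum vanishes, so does the small part in every degree; then `x` is
  -- cancelled and the argument repeats.
  F[p][x]-injective : ∀ g → E₂.eval g ≈ [] → CommutativeRing._≈_ (Polynomial.polyRing (Polynomial.polyRing F)) g []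
  F[p][x]-injective []      h = Polynomial.≈-refl (Polynomial.polyRing F)
  F[p][x]-injective (l ∷ g) h = Polynomial.≈-trans F[p]
      (Polynomial.shift-cong F[p] (F[p]-injective l (⇒≈[] l-part)) (F[p][x]-injective g g≈0)) (Polynomial.shift-[] F[p])
    where
    F[p] : CommutativeRing f ℓf
    F[p] = Polynomial.polyRing F
    fx : Carrier
    fx = proj₁ x-class
    xg : ∀ γ → component γ (x * E₂.eval g) ∼[ γ ] φ *ᴿ (fx *ᴿ component (γ ℚ.- lam) (E₂.eval g))
    xg γ = ∼-trans (component-class-* γ (E₂.eval g) (proj₂ (proj₂ x-class))) (∼-refl (R.*-assoc _ _ _))
    l-part : ∀ γ → component γ (E₁.eval l) ∈𝒫⁺ γ
    l-part γ = let a , a-small , a∼ = F[p]-small l γ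
      in ∼-𝒫⁺ a∼ (proj₁ (split-𝒫⁺ _ a-small (∼-𝒫⁺ (∼-sym (∼-trans
        (∼-refl (component-++ γ (E₁.eval l) (x * E₂.eval g))) (∼-+ a∼ (xg γ)))) (≈[]⇒ γ h))))
    g≈0 : E₂.eval g ≈ []
    g≈0 = class-*-cancel (≡.trans (val-*ᵛ val-φ (proj₁ (proj₂ x-class))) (≡.cong [_] (≡.sym lam≡))) (proj₂ (proj₂ x-class))
      (Gr.trans (Gr.sym (Gr.+-congʳ {x * E₂.eval g} (⇒≈[] l-part))) h)

  -- If φᵅ = xˢ u and s is the least exponent of x in a monomial of degree α,
  -- then φᵅ divides every element of degree α.
  module _ {α υ : ℚ} (s : ℕ) {u u⁻¹ : Gr} (u-small : IsSmallClass υ u) (u*u⁻¹≈1 : u * u⁻¹ ≈ Gr.1#)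
    (α≡ : fromℕ s ℚ.* lam ℚ.+ υ ≡ α) (Γα : Γ α)
    (least : ∀ n {z} → IsSmallClass (α ℚ.- fromℕ n ℚ.* lam) z → s ℕ.≤ n) where

    private
      xˢu : Gr
      xˢu = x ^ s * u

    homogeneous-multiple : ∀ δ → Homogeneous α (xˢu * degree₀ δ)
    homogeneous-multiple δ = pure⇒homogeneous (pure-degree (≡.trans (ℚ.+-identityʳ _) α≡)
      (pure-* (pure-* (pure-^ s x-pure) (class-pure (IsSmallClass.f-class u-small))) (class-pure (degree₀-class δ))))

    private
      Multiple : Gr → Set c
      Multiple a = ∃[ g ] ∃[ b ] IsClass 0ℚ g b × a ≈ xˢu * b

      multiple-+ : ∀ {a b} → Multiple a → Multiple b → Multiple (a + b)
      multiple-+ (g , b , h , e) (g′ , b′ , h′ , e′) =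
        _ , b + b′ , class-+ h h′ , Gr.trans (Gr.+-cong e e′) (Gr.sym (Gr.distribˡ xˢu b b′))

      multiple-0 : Multiple []
      multiple-0 = 0# , class Γ-0 𝒫-0# , class-isClass Γ-0 𝒫-0# ,
        Gr.sym (Gr.trans (Gr.*-congˡ {xˢu} (class-vanishes (class-isClass Γ-0 𝒫-0#) 𝒫⁺-0#)) (Gr.zeroʳ xˢu))

      multiple : ∀ {a} → SumOfMonomials {lam} {x} α a → Multiple a
      multiple zero       = multiple-0
      multiple (plus h k) = multiple-+ (multiple h) (multiple k)
      multiple (resp p h) = let g , b , k , e = multiple h in g , b , k , Gr.trans (Gr.sym p) e
      -- With `n = s + m` the cofactor of `x ^ s * u` in `x ^ n * z` is `x ^ m * (u⁻¹ * z)`, which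
      -- has degree 0.
      multiple (monomial n {z} h) = let m , n≡ = ℕ.m≤n⇒∃[o]m+o≡n (least n h) in
        proj₁ (pure⇒class Γ-0 (quotient-pure m n≡)) , x ^ m * (u⁻¹ * z) , proj₂ (pure⇒class Γ-0 (quotient-pure m n≡)) ,
        product m n≡
        where
        open CommutativeSemigroupProperties Gr.*-commutativeSemigroup using (interchange)
        quotient-pure : ∀ m → s ℕ.+ m ≡ n → IsPure 0ℚ (x ^ m * (u⁻¹ * z))
        quotient-pure m ≡.refl = pure-degree degrees (pure-* (pure-^ m x-pure)
          (pure-* (class-pure (IsSmallClass.f-class (small-class-inverse u-small u*u⁻¹≈1))) (class-pure (IsSmallClass.f-class h))))
          where
          degrees : fromℕ m ℚ.* lam ℚ.+ (ℚ.- υ ℚ.+ (α ℚ.- fromℕ (s ℕ.+ m) ℚ.* lam)) ≡ 0ℚ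
          degrees = ≡.trans (≡.cong₂ (λ a b → fromℕ m ℚ.* lam ℚ.+ (ℚ.- υ ℚ.+ (a ℚ.- b ℚ.* lam))) (≡.sym α≡) (fromℤ-+ (+ s) (+ m)))
            (solve 4 (λ m s υ lam → m :* lam :+ (:- υ :+ ((s :* lam :+ υ) :- (s :+ m) :* lam)) := con 0ℚ) ≡.refl
              (fromℕ m) (fromℕ s) υ lam)
        product : ∀ m → s ℕ.+ m ≡ n → x ^ n * z ≈ xˢu * (x ^ m * (u⁻¹ * z))
        product m ≡.refl = Gr.sym (begin
          (x ^ s * u) * (x ^ m * (u⁻¹ * z))   ≈⟨ interchange (x ^ s) u (x ^ m) (u⁻¹ * z) ⟩
          (x ^ s * x ^ m) * (u * (u⁻¹ * z))   ≈⟨ Gr.*-cong (Gr.sym (^-homo-* x s m)) (Gr.sym (Gr.*-assoc u u⁻¹ z)) ⟩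
          x ^ (s ℕ.+ m) * ((u * u⁻¹) * z)     ≈⟨ Gr.*-congˡ {x ^ (s ℕ.+ m)} (Gr.trans (Gr.*-congʳ {z} u*u⁻¹≈1) (Gr.*-identityˡ z)) ⟩
          x ^ (s ℕ.+ m) * z                   ∎)
          where
          open SetoidReasoning Gr.setoid
          open Powers gradedRing using (^-homo-*)

    multiple-of-homogeneous : ∀ a → Homogeneous α a → ∃[ δ ] a ≈ xˢu * degree₀ δ
    multiple-of-homogeneous a h =
      let g , k = pure⇒class Γα (homogeneous⇒pure {a = a} h)
          g′ , b , k′ , e = multiple (class-monomials k)
          δ , e′ , _ = class-degree₀ k′
      in δ , Gr.trans e (Gr.*-congˡ {xˢu} e′)

  module Isomorphism {b ℓb : Level} {B : CommutativeRing b ℓb} (σ : RingHom F B)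
    (yᴮ pᴮ p⁻¹ᴮ xᴮ : CommutativeRing.Carrier B)
    (pp⁻¹≈1 : CommutativeRing._≈_ B (CommutativeRing._*_ B pᴮ p⁻¹ᴮ) (CommutativeRing.1# B))
    (normalisable : ∀ z → Normalisation.Normalisable σ yᴮ pᴮ p⁻¹ᴮ xᴮ z)
    (ψ : RingHom B gradedRing) (e h : ℕ) (eλ≡hδ : fromℕ e ℚ.* lam ≡ fromℕ h ℚ.* δ)
    (ψ-σ : ∀ k → RingHom.⟦_⟧ ψ (RingHom.⟦_⟧ σ k) ≈ RingHom.⟦_⟧ ι k) (ψ-y : RingHom.⟦_⟧ ψ yᴮ ≈ x ^ e * p⁻¹ ^ h)
    (ψ-p : RingHom.⟦_⟧ ψ pᴮ ≈ p) (ψ-p⁻¹ : RingHom.⟦_⟧ ψ p⁻¹ᴮ ≈ p⁻¹) (ψ-x : RingHom.⟦_⟧ ψ xᴮ ≈ x) where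

    open RingHom ψ using (⟦_⟧)
    private
      module B = CommutativeRing B
      module ψ = RingHom ψ
      module PB = Powers B
      module IB = IntegerPowers B pᴮ p⁻¹ᴮ pp⁻¹≈1
      module Grad = Grading B δ lam (RingHom.⟦_⟧ σ) yᴮ pᴮ p⁻¹ᴮ xᴮ
      module NB = Normalisation σ yᴮ pᴮ p⁻¹ᴮ xᴮ
    open Grad using (scalar-homogeneous; y-homogeneous; p-homogeneous; p⁻¹-homogeneous; x-homogeneous;
      0-homogeneous; +-homogeneous; *-homogeneous; ≈-homogeneous)

    -- On F[p][x] the map is evaluation at `p` and `x`, already known to be injective; normalisation
    -- reduces every element to that case.
    ψ-kernel : ∀ z → ⟦ z ⟧ ≈ [] → z B.≈ B.0#
    ψ-kernel = NB.injective-if-normal-injective ψ pp⁻¹≈1 normalisable λ g k →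
      F[p][x]-injective g (Gr.trans (Gr.sym (eval-natural ψ (Evaluation.evalHom σ pᴮ) E₁.evalHom xᴮ x
        (eval-natural ψ σ ι pᴮ p ψ-σ ψ-p) ψ-x g)) k)

    ψ-injective : ∀ {w z} → ⟦ w ⟧ ≈ ⟦ z ⟧ → w B.≈ z
    ψ-injective {w} {z} k = x∙y⁻¹≈ε⇒x≈y w z (ψ-kernel (w B.- z) (ψ.-homo-0 w z k))
      where open RingFacts B using (x∙y⁻¹≈ε⇒x≈y)

    ψ-pow : ∀ n → ⟦ IB.pow n ⟧ ≈ pow n
    ψ-pow (+ n)    = Gr.trans (ψ.^-homo pᴮ n) (^-congˡ n ψ-p)
    ψ-pow -[1+ n ] = Gr.trans (ψ.^-homo p⁻¹ᴮ (suc n)) (^-congˡ (suc n) ψ-p⁻¹)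

    homogeneous-degree : ∀ {α β z} → α ≡ β → Grad.Homogeneous α z → Grad.Homogeneous β z
    homogeneous-degree ≡.refl k = k

    homogeneous-^ : ∀ n {α z} → Grad.Homogeneous α z → Grad.Homogeneous (fromℕ n ℚ.* α) (z PB.^ n)
    homogeneous-^ zero    {α} k = homogeneous-degree (≡.sym (ℚ.*-zeroˡ α))
      (≈-homogeneous (RingHom.1-homo σ) (scalar-homogeneous F.1#))
    homogeneous-^ (suc n) {α} k = homogeneous-degree (fromℕ-suc-* n α) (*-homogeneous k (homogeneous-^ n k))

    homogeneous-pow : ∀ n → Grad.Homogeneous (fromℤ n ℚ.* δ) (IB.pow n)
    homogeneous-pow (+ n)    = homogeneous-^ n p-homogeneous
    homogeneous-pow -[1+ n ] = homogeneous-degree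
      (≡.trans (solve 2 (λ n δ → n :* (:- δ) := (:- n) :* δ) ≡.refl (fromℕ (suc n)) δ) (≡.cong (ℚ._* δ) (≡.sym (fromℤ-neg (+ suc n)))))
      (homogeneous-^ (suc n) p⁻¹-homogeneous)

    homogeneous-ψ : ∀ {α z} → Grad.Homogeneous α z → IsPure α ⟦ z ⟧
    homogeneous-ψ (scalar-homogeneous k)  = pure-resp (Gr.sym (ψ-σ k)) (class-pure (proj₂ (proj₂ (ι-class k))))
    homogeneous-ψ y-homogeneous           = pure-degree degrees (pure-resp (Gr.sym ψ-y)
      (pure-* (pure-^ e x-pure) (pure-^ h (class-pure (IsSmallClass.f-class p⁻¹-small)))))
      where
      degrees : fromℕ e ℚ.* lam ℚ.+ fromℕ h ℚ.* (ℚ.- δ) ≡ 0ℚ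
      degrees = ≡.trans (≡.cong (ℚ._+ fromℕ h ℚ.* (ℚ.- δ)) eλ≡hδ)
        (solve 2 (λ h δ → h :* δ :+ h :* (:- δ) := con 0ℚ) ≡.refl (fromℕ h) δ)
    homogeneous-ψ p-homogeneous           = pure-resp (Gr.sym ψ-p) (class-pure (IsSmallClass.f-class p-small))
    homogeneous-ψ p⁻¹-homogeneous         = pure-resp (Gr.sym ψ-p⁻¹) (class-pure (IsSmallClass.f-class p⁻¹-small))
    homogeneous-ψ x-homogeneous           = pure-resp (Gr.sym ψ-x) x-pure
    homogeneous-ψ 0-homogeneous           = pure-resp (Gr.sym ψ.0-homo) pure-0
    homogeneous-ψ (+-homogeneous {a = a} {b} k l) = pure-resp (Gr.sym (ψ.+-homo a b)) (pure-+ (homogeneous-ψ k) (homogeneous-ψ l))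
    homogeneous-ψ (*-homogeneous {a = a} {b} k l) = pure-resp (Gr.sym (ψ.*-homo a b)) (pure-* (homogeneous-ψ k) (homogeneous-ψ l))
    homogeneous-ψ (≈-homogeneous k l)     = pure-resp (ψ.cong k) (homogeneous-ψ l)

    Preimage : ℚ → Gr → Set (f ⊔ b ⊔ ℓb)
    Preimage α a = ∃[ z ] Grad.Homogeneous α z × ⟦ z ⟧ ≈ a

    -- Lifts are kept homogeneous of the same degree, so surjectivity and compatibility with the
    -- gradings come from one construction.
    preimage : ∀ {α a} → Monomials α a → Preimage α a
    preimage zero       = B.0# , 0-homogeneous , ψ.0-homo
    preimage (plus k l) =
      let w , w-hom , w≈ = preimage k
          z , z-hom , z≈ = preimage l
      in w B.+ z , +-homogeneous w-hom z-hom , Gr.trans (ψ.+-homo w z) (Gr.+-cong w≈ z≈)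
    preimage (resp p k) = let z , z-hom , z≈ = preimage k in z , z-hom , Gr.trans z≈ p
    preimage {α} (monomial n {z} k) =
      let m , c , degree≡ , z≈ = small-class≈ k
      in xᴮ PB.^ n B.* (RingHom.⟦_⟧ σ c B.* IB.pow m) ,
         homogeneous-degree (degrees m degree≡) (*-homogeneous (homogeneous-^ n x-homogeneous)
           (*-homogeneous (scalar-homogeneous c) (homogeneous-pow m))) ,
         Gr.trans (ψ.*-homo _ _) (Gr.*-cong (Gr.trans (ψ.^-homo xᴮ n) (^-congˡ n ψ-x))
           (Gr.trans (ψ.*-homo _ _) (Gr.trans (Gr.*-cong (ψ-σ c) (ψ-pow m)) (Gr.sym z≈))))
      where
      degrees : ∀ m → α ℚ.- fromℕ n ℚ.* lam ≡ fromℤ m ℚ.* δ →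
        fromℕ n ℚ.* lam ℚ.+ (0ℚ ℚ.+ fromℤ m ℚ.* δ) ≡ α
      degrees m q = ≡.trans (≡.cong (λ t → fromℕ n ℚ.* lam ℚ.+ (0ℚ ℚ.+ t)) (≡.sym q))
        (solve 2 (λ α t → t :+ (con 0ℚ :+ (α :- t)) := α) ≡.refl α (fromℕ n ℚ.* lam))

    private
      term-preimage : ∀ t → Preimage (degree t) (t ∷ [])
      term-preimage t = preimage (class-monomials (isClass t ≡.refl ≡.refl Gr.refl))

    -- The choice depends on the representatives of the terms. As a right inverse of an injective
    -- homomorphism it still respects equality and the ring operations, by `ψ⁻¹-unique`.
    ψ⁻¹ : Gr → B.Carrier
    ψ⁻¹ []      = B.0#
    ψ⁻¹ (t ∷ a) = proj₁ (term-preimage t) B.+ ψ⁻¹ a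

    ψψ⁻¹ : ∀ a → ⟦ ψ⁻¹ a ⟧ ≈ a
    ψψ⁻¹ []      = ψ.0-homo
    ψψ⁻¹ (t ∷ a) = Gr.trans (ψ.+-homo _ _) (Gr.+-cong (proj₂ (proj₂ (term-preimage t))) (ψψ⁻¹ a))

    ψ⁻¹-unique : ∀ {a z} → a ≈ ⟦ z ⟧ → ψ⁻¹ a B.≈ z
    ψ⁻¹-unique {a} k = ψ-injective (Gr.trans (ψψ⁻¹ a) k)

    ψ⁻¹-cong : ∀ {a a′} → a ≈ a′ → ψ⁻¹ a B.≈ ψ⁻¹ a′
    ψ⁻¹-cong {a} {a′} k = ψ⁻¹-unique (Gr.trans k (Gr.sym (ψψ⁻¹ a′)))

    ψ⁻¹-homogeneous : ∀ {α a} → IsPure α a → Grad.Homogeneous α (ψ⁻¹ a)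
    ψ⁻¹-homogeneous (isPure l ds k) = ≈-homogeneous (ψ⁻¹-cong (Gr.sym k)) (go ds)
      where
      go : ∀ {α l} → All (λ t → degree t ≡ α) l → Grad.Homogeneous α (ψ⁻¹ l)
      go []                  = 0-homogeneous
      go (_∷_ {t} ≡.refl ds) = +-homogeneous (proj₁ (proj₂ (term-preimage t))) (go ds)

    gradedIsomorphism : GradedIsomorphism {F = F}
      (record { commutativeRing = gradedRing ; algebraMap = RingHom.⟦_⟧ ι ; Homogeneous = Homogeneous })
      (record { commutativeRing = B ; algebraMap = RingHom.⟦_⟧ σ ; Homogeneous = Grad.Homogeneous })
    gradedIsomorphism = record
      { ⟦_⟧               = ψ⁻¹
      ; isRingIsomorphism = record
        { isRingMonomorphism = record
          { isRingHomomorphism = record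
            { isSemiringHomomorphism = record
              { isNearSemiringHomomorphism = record
                { +-isMonoidHomomorphism = record
                  { isMagmaHomomorphism = record
                    { isRelHomomorphism = record { cong = ψ⁻¹-cong }
                    ; homo = λ a b → ψ⁻¹-unique (Gr.trans (Gr.sym (Gr.+-cong (ψψ⁻¹ a) (ψψ⁻¹ b))) (Gr.sym (ψ.+-homo _ _)))
                    }
                  ; ε-homo = B.refl
                  }
                ; *-homo = λ a b → ψ⁻¹-unique (Gr.trans (Gr.sym (Gr.*-cong (ψψ⁻¹ a) (ψψ⁻¹ b))) (Gr.sym (ψ.*-homo _ _)))
                }
              ; 1#-homo = ψ⁻¹-unique (Gr.sym ψ.1-homo)
              }
            ; -‿homo = λ a → ψ⁻¹-unique (Gr.trans (Gr.sym (Gr.-‿cong (ψψ⁻¹ a))) (Gr.sym (ψ.neg-homo _)))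
            }
          ; injective = λ {a} {b} k → Gr.trans (Gr.sym (ψψ⁻¹ a)) (Gr.trans (ψ.cong k) (ψψ⁻¹ b))
          }
        ; surjective = λ z → ⟦ z ⟧ , λ k → ψ⁻¹-unique k
        }
      ; algebraMap-homo   = λ k → ψ⁻¹-unique (Gr.sym (ψ-σ k))
      ; homogeneous       = λ α a → mk⇔ (λ k → ψ⁻¹-homogeneous (homogeneous⇒pure {a = a} k))
          (λ k → pure⇒homogeneous (pure-resp (ψψ⁻¹ a) (homogeneous-ψ k)))
      }

-- A record rather than the bare equation, which would make conversion checking unfold three
-- nested polynomial rings.
record IsPresentation {f ℓf : Level} {F : CommutativeRing f ℓf} (B : RawGradedAlgebra F f (f ⊔ ℓf) (f ⊔ ℓf))
  (e h : ℕ) (δ lam : ℚ) : Set (lsuc (f ⊔ ℓf)) where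
  constructor presentation
  field equality : B ≡ Presentation.gradedAlgebra F e h δ lam

module StructurePresentation {c ℓ f ℓf : Level} {R : CommutativeRing c ℓ} {V : Valuation R} {φ : CommutativeRing.Carrier R}
  {Small : CommutativeRing.Carrier R → Set ℓ} (adapted : IsAdapted V φ Small) {F : CommutativeRing f ℓf}
  {ι : RingHom F (GradedRing.gradedRing V)} {δ lam : ℚ} (coordinates : Coordinates adapted ι δ lam)
  (e h : ℕ) (eλ≡hδ : fromℕ e ℚ.* lam ≡ fromℕ h ℚ.* δ) where

  open GradedRing V using (gradedRing; Homogeneous)
  open GradedProperties V using (module Gr)
  open Coordinates coordinates
  open Powers gradedRing using (_^_; inverse-^)
  private
    module Pres = Presentation F e h
    module PP = PresentationProperties F e h
    module N = Normalisation PP.scalarHom Pres.y Pres.p Pres.p⁻¹ Pres.x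

    -- The only possible image of y: the relation determines it because `p` is a unit.
    yᴳ : Gr.Carrier
    yᴳ = x ^ e Gr.* p⁻¹ ^ h

    xᵉ≈pʰy : x ^ e Gr.≈ p ^ h Gr.* yᴳ
    xᵉ≈pʰy = Gr.sym (Gr.trans (x∙yz≈y∙xz (p ^ h) (x ^ e) (p⁻¹ ^ h))
      (Gr.trans (Gr.*-congˡ {x ^ e} (inverse-^ h p*p⁻¹≈1)) (Gr.*-identityʳ (x ^ e))))
      where open CommutativeSemigroupProperties Gr.*-commutativeSemigroup using (x∙yz≈y∙xz)

    module U = PP.Universal ι yᴳ p p⁻¹ x p*p⁻¹≈1 xᵉ≈pʰy

    normalisable : ∀ z → N.Normalisable z
    normalisable = PP.presentation-ind N.Normalisable N.normalisable-resp N.normalisable-+ N.normalisable-*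
      N.normalisable-scalar (N.normalisable-y e h PP.xᵉ≈pʰy) N.normalisable-p (N.normalisable-p⁻¹ PP.p*p⁻¹≈1) N.normalisable-x

  isomorphism : GradedIsomorphism {F = F}
    (record { commutativeRing = gradedRing ; algebraMap = RingHom.⟦_⟧ ι ; Homogeneous = Homogeneous })
    (Presentation.gradedAlgebra F e h δ lam)
  isomorphism = Structure.Isomorphism.gradedIsomorphism adapted coordinates
    PP.scalarHom Pres.y Pres.p Pres.p⁻¹ Pres.x PP.p*p⁻¹≈1 normalisable U.universal e h eλ≡hδ
    U.universal-scalar U.universal-y U.universal-p U.universal-p⁻¹ U.universal-x

  isomorphic-to : ∀ (A : RawGradedAlgebra F _ _ _) (B : RawGradedAlgebra F _ _ _) →
    A ≡ record { commutativeRing = gradedRing ; algebraMap = RingHom.⟦_⟧ ι ; Homogeneous = Homogeneous } →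
    IsPresentation B e h δ lam → GradedIsomorphism A B
  isomorphic-to _ _ ≡.refl (presentation ≡.refl) = isomorphism

-- Division with remainder and inverses modulo φ.

module DegreeBound {a ℓ : Level} (A : CommutativeRing a ℓ) where
  private
    module A = CommutativeRing A
    module P = CommutativeRing (Polynomial.polyRing A)
  open Polynomial A
  open PolynomialProperties A

  infix 4 _≺_

  record _≺_ (f : Poly) (n : ℕ) : Set ℓ where
    constructor vanishing
    field vanishes : ∀ m → n ℕ.≤ m → coeff f m A.≈ A.0#
  open _≺_ public

  ≺-resp : ∀ {f g n} → f ≈ g → f ≺ n → g ≺ n
  ≺-resp h k .vanishes m n≤m = A.trans (A.sym (h .at m)) (k .vanishes m n≤m)

  ≺-mono : ∀ {f m n} → m ℕ.≤ n → f ≺ m → f ≺ n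
  ≺-mono h k .vanishes m n≤m = k .vanishes m (ℕ.≤-trans h n≤m)

  ≺-0 : ∀ {n} → [] ≺ n
  ≺-0 .vanishes m _ = A.refl

  ≺-+ : ∀ {f g n} → f ≺ n → g ≺ n → f + g ≺ n
  ≺-+ {f} {g} h k .vanishes m n≤m = A.trans (coeff-+ f g m)
    (A.trans (A.+-cong (h .vanishes m n≤m) (k .vanishes m n≤m)) (A.+-identityˡ _))

  ≺-neg : ∀ {f n} → f ≺ n → - f ≺ n
  ≺-neg {f} h .vanishes m n≤m = A.trans (coeff-neg f m) (A.trans (A.-‿cong (h .vanishes m n≤m)) (RingFacts.-0#≈0# A))

  ≺-∷ : ∀ {b f n} → f ≺ n → b ∷ f ≺ suc n
  ≺-∷ h .vanishes (suc m) (s≤s n≤m) = h .vanishes m n≤m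

  ≺-tail : ∀ {b f n} → b ∷ f ≺ suc n → f ≺ n
  ≺-tail h .vanishes m n≤m = h .vanishes (suc m) (s≤s n≤m)

  ≺0⇒≈[] : ∀ {f} → f ≺ 0 → f ≈ []
  ≺0⇒≈[] h = pointwise λ n → h .vanishes n z≤n

  ≈[]⇒≺ : ∀ {f n} → f ≈ [] → f ≺ n
  ≈[]⇒≺ h .vanishes m _ = h .at m

  ≺-constant : ∀ b → constant b ≺ 1
  ≺-constant b = ≺-∷ ≺-0

  ≺-length : ∀ f → ∃[ n ] f ≺ n
  ≺-length []      = 0 , ≺-0
  ≺-length (c ∷ f) = let n , h = ≺-length f in suc n , ≺-∷ h

  ≺1⇒≈constant : ∀ {f} → f ≺ 1 → f ≈ constant (coeff f 0)
  ≺1⇒≈constant h .at zero    = A.refl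
  ≺1⇒≈constant h .at (suc n) = h .vanishes (suc n) (s≤s z≤n)

  -- The bound on the quotient is stated additively since deg 0 = -∞.
  divide : ∀ g d w → g ≺ suc d → w A.* coeff g d A.≈ A.1# → ∀ f →
    ∃[ q ] ∃[ r ] f ≈ r + g * q × r ≺ d × (∀ k → f ≺ d ℕ.+ k → q ≺ k)
  divide g d w g≺ wg≈1 [] = [] , [] , ≈-sym (*-[] g) , ≺-0 , λ _ _ → ≺-0
  divide g d w g≺ wg≈1 (b ∷ f) with divide g d w g≺ wg≈1 f
  ... | q , r , f≈ , r≺ , q≺ = c ∷ q , r′ , eq , r′≺ , q′≺
    where
    -- `t` is `b + X r`, with no coefficient beyond index `d`; `c` is chosen so that subtracting
    -- `c ⊛ g` removes the one at `d`.
    t r′ : Poly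
    t  = b ∷ r
    c  : A.Carrier
    c  = w A.* coeff t d
    r′ = t + - (c ⊛ g)
    coeff-r′ : ∀ m → coeff r′ m A.≈ coeff t m A.- c A.* coeff g m
    coeff-r′ m = A.trans (coeff-+ t (- (c ⊛ g)) m)
      (A.+-congˡ (A.trans (coeff-neg (c ⊛ g) m) (A.-‿cong (coeff-⊛ c g m))))
    c*lead : c A.* coeff g d A.≈ coeff t d
    c*lead = A.trans (A.*-congʳ (A.*-comm w _)) (A.trans (A.*-assoc _ w _)
      (A.trans (A.*-congˡ wg≈1) (A.*-identityʳ _)))
    r′≺ : r′ ≺ d
    r′≺ .vanishes m d≤m with ℕ.m≤n⇒m<n∨m≡n d≤m
    ... | inj₂ ≡.refl = A.trans (coeff-r′ m) (RingFacts.diff-refl A (A.sym c*lead))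
    ... | inj₁ d<m    = A.trans (coeff-r′ m) (RingFacts.diff-refl A (A.trans ((≺-∷ {b} r≺) .vanishes m d<m)
      (A.sym (A.trans (A.*-congˡ (g≺ .vanishes m d<m)) (A.zeroʳ c)))))
    eq : b ∷ f ≈ r′ + g * (c ∷ q)
    eq = begin
      b ∷ f                                       ≈⟨ shift-cong (A.sym (A.+-identityʳ b)) f≈ ⟩
      t + (A.0# ∷ g * q)                          ≈⟨ +-cong (//-rightDividesˡ (c ⊛ g) t) ≈-refl ⟨
      (r′ + (c ⊛ g)) + (A.0# ∷ g * q)             ≈⟨ +-assoc r′ (c ⊛ g) _ ⟩
      r′ + ((c ⊛ g) + (A.0# ∷ g * q))             ≈⟨ +-cong (≈-refl {r′}) (*-shiftʳ g c q) ⟨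
      r′ + g * (c ∷ q)                            ∎
      where
      open SetoidReasoning P.setoid
      open RingFacts (Polynomial.polyRing A) using (//-rightDividesˡ)
    q′≺ : ∀ k → b ∷ f ≺ d ℕ.+ k → c ∷ q ≺ k
    q′≺ (suc k) h = ≺-∷ (q≺ k (≺-tail (≡.subst (b ∷ f ≺_) (ℕ.+-suc d k) h)))
    -- Here `b ∷ f` already vanishes from index `d` on. So does `f`; hence `q` is zero and `f ≈ r`,
    -- and `c` is a multiple of a vanishing coefficient of `b ∷ f`.
    q′≺ zero    h = ≈[]⇒≺ (≈-trans (shift-cong c≈0 q≈0) shift-[])
      where
      f≺ : f ≺ d ℕ.+ 0
      f≺ .vanishes m k = h .vanishes (suc m) (ℕ.m≤n⇒m≤1+n k)
      q≈0 : q ≈ []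
      q≈0 = ≺0⇒≈[] (q≺ 0 f≺)
      f≈r : f ≈ r
      f≈r = ≈-trans f≈ (≈-trans (+-cong (≈-refl {r}) (≈-trans (*-congˡ g q≈0) (*-[] g))) (+-comm r []))
      c≈0 : c A.≈ A.0#
      c≈0 = A.trans (A.*-congˡ (A.trans (A.sym (shift-cong A.refl f≈r .at d)) (h .vanishes d (ℕ.≤-reflexive (ℕ.+-identityʳ d))))) (A.zeroʳ w)

  divideMonic : ∀ φ {n} → coeff φ n A.≈ A.1# → φ ≺ suc n → ∀ f →
    ∃[ q ] ∃[ r ] f ≈ r + φ * q × r ≺ n × (∀ k → f ≺ n ℕ.+ k → q ≺ k)
  divideMonic φ {n} lead φ≺ = divide φ n A.1# φ≺ (A.trans (A.*-identityˡ _) lead)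

  -- As `φ` has positive degree, each quotient has a smaller degree bound than the dividend, and
  -- that bound drives the recursion.
  φ-expansion : ∀ φ {n} → coeff φ (suc n) A.≈ A.1# → φ ≺ suc (suc n) → ∀ f → Expansion {R = polyRing} φ (_≺ suc n) f
  φ-expansion φ {n} lead φ≺ f = let k , h = ≺-length f in go k f h
    where
    go : ∀ k f → f ≺ k → Expansion {R = polyRing} φ (_≺ suc n) f
    go zero    f h = nil (≺0⇒≈[] h)
    go (suc k) f h = let q , r , f≈ , r≺ , q≺ = divideMonic φ lead φ≺ f
      in cons r≺ (go k q (q≺ k (≺-mono (s≤s (ℕ.m≤n+m k n)) h))) f≈

module Bezout {c ℓ : Level} (K : Field c ℓ) (K≈0? : ∀ a → Dec (Field._≈_ K a (Field.0# K))) where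
  private module K = Field K
  open Polynomial K.commutativeRing
  open DegreeBound K.commutativeRing
  private module P = CommutativeRing polyRing

  -- Euclid's algorithm in which φ is divided by smaller and smaller multiples of a modulo φ.
  inverse-mod : ∀ {φ n} → coeff φ n K.≈ K.1# → φ ≺ suc n →
    (∀ a b → a ≺ n → b ≺ n → ¬ φ ≈ a * b) →
    ∀ a → a ≺ n → ¬ a ≈ [] → ∃[ b ] ∃[ d ] b ≺ n × a * b ≈ constant K.1# + φ * d
  inverse-mod {φ} {n} lead φ≺ irreducible a a≺ a≉0 with go n a ℕ.≤-refl a≺ a≉0
    where
    open Quotient polyRing φ
    module Q = CommutativeRing ring/f
    module π = RingHom (QuotientProperties.quotientHom polyRing φ)
    -- The inverse is sought in the quotient ring, without control of its degree. The bound `k`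
    -- decreases either because the coefficient just below it vanishes or because `a` is replaced by
    -- a remainder.
    go : ∀ k a → k ℕ.≤ n → a ≺ k → ¬ a ≈ [] → ∃[ b ] [ a * b ]/ Q.≈ Q.1#
    go zero    a k≤n a≺ a≉0 = ⊥-elim (a≉0 (≺0⇒≈[] a≺))
    go (suc k) a k<n a≺ a≉0 with K≈0? (coeff a k)
    ... | yes h = go k a (ℕ.<⇒≤ k<n) smaller a≉0
      where
      smaller : a ≺ k
      smaller .vanishes m k≤m with ℕ.m≤n⇒m<n∨m≡n k≤m
      ... | inj₁ k<m    = a≺ .vanishes m k<m
      ... | inj₂ ≡.refl = h
    ... | no h with K.inverse (coeff a k) h
    ...   | w , wa≈1 , _ with divide a k w a≺ wa≈1 φ | k ℕ.≟ 0
    ...     | _ | yes ≡.refl = constant w , π.cong (≈-trans (*-cong (≺1⇒≈constant a≺) (≈-refl {constant w}))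
      (shift-cong (K.trans (K.+-identityʳ _) (K.trans (K.*-comm _ w) wa≈1)) ≈-refl))
    ...     | q , r , φ≈ , r≺ , q≺ | no k≢0 with all? k r r≺
      where
      all? : ∀ j r → r ≺ j → Dec (r ≈ [])
      all? j [] _ = yes ≈-refl
      all? j (d ∷ r) h with K≈0? d | all? j r (vanishing λ m j≤m → h .vanishes (suc m) (ℕ.m≤n⇒m≤1+n j≤m))
      ... | yes p | yes q = yes (≈-trans (shift-cong p q) shift-[])
      ... | no ¬p | _     = no λ e → ¬p (e .at 0)
      ... | _     | no ¬q = no λ e → ¬q (pointwise λ m → e .at (suc m))
    -- Then `φ ≈ a * q`. Since `a` has degree `k > 0`, also `q` has degree below `n`, contrary to
    -- irreducibility.
    ...       | yes r≈0 = ⊥-elim (irreducible a q (≺-mono k<n a≺) q≺n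
      (≈-trans φ≈ (+-cong r≈0 (≈-refl {a * q}))))
      where
      q≺n : q ≺ n
      q≺n = q≺ n (≺-mono (ℕ.+-monoˡ-≤ n (ℕ.n≢0⇒n>0 k≢0)) φ≺)
    ...       | no r≉0 with go k r (ℕ.<⇒≤ k<n) r≺ r≉0
    -- Modulo `φ` one has `a * q = - r`, so the inverse `b` of `r` yields the inverse `- (q * b)` of
    -- `a`.
    ...         | b , rb≈1 = q * (- b) , Q.trans (π.cong (≈-sym (*-assoc a q (- b))))
      (Q.trans (Q.*-congʳ {[ - b ]/} aq≈-r) (Q.trans (π.cong (-x*-y≈x*y r b)) rb≈1))
      where
      aq≈-r : [ a * q ]/ Q.≈ [ - r ]/
      aq≈-r = +-inverseʳ-unique [ r ]/ [ a * q ]/ (Q.trans (π.cong (≈-sym φ≈))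
        (QuotientProperties.relation≈0 polyRing φ))
        where open RingFacts ring/f using (+-inverseʳ-unique)
      -x*-y≈x*y : ∀ x y → (- x) * (- y) ≈ x * y
      -x*-y≈x*y x y = P.trans (P.sym (RingFacts.-‿distribˡ-* polyRing x (- y)))
        (P.trans (P.-‿cong (P.sym (RingFacts.-‿distribʳ-* polyRing x y))) (RingFacts.-‿involutive polyRing (x * y)))
  ... | b , modulo record { quotient = d ; equality = e } with divideMonic φ lead φ≺ b
  -- Only now is the degree bounded: passing from `b` to its remainder `r` subtracts `φ * (a * q)`
  -- from `a * b`, which is absorbed into `d`.
  ...   | q , r , b≈ , r≺ , _ = r , d + - (a * q) , r≺ , eq
    where
    open SetoidReasoning P.setoid
    open RingFacts polyRing using (//-rightDividesˡ; x[y-z]≈xy-xz; +-cancelʳ)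
    ab≈ : a * b ≈ constant K.1# + φ * d
    ab≈ = P.trans (P.sym (//-rightDividesˡ (constant K.1#) (a * b)))
      (P.trans (P.+-congʳ (P.sym e)) (P.trans (P.+-comm (d * φ) _) (P.+-congˡ {constant K.1#} (*-comm d φ))))
    eq : a * r ≈ constant K.1# + φ * (d + - (a * q))
    eq = +-cancelʳ (φ * (a * q)) (a * r) (constant K.1# + φ * (d + - (a * q))) (begin
      a * r + φ * (a * q)                                       ≈⟨ P.+-congˡ {a * r} (x∙yz≈y∙xz φ a q) ⟩
      a * r + a * (φ * q)                                       ≈⟨ *-distribˡ a r (φ * q) ⟨
      a * (r + φ * q)                                           ≈⟨ *-congˡ a b≈ ⟨
      a * b                                                     ≈⟨ ab≈ ⟩
      constant K.1# + φ * d                                     ≈⟨ P.+-congˡ {constant K.1#} (//-rightDividesˡ (φ * (a * q)) (φ * d)) ⟨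
      constant K.1# + ((φ * d + - (φ * (a * q))) + φ * (a * q)) ≈⟨ P.+-assoc (constant K.1#) (φ * d + - (φ * (a * q))) (φ * (a * q)) ⟨
      constant K.1# + (φ * d + - (φ * (a * q))) + φ * (a * q)   ≈⟨ P.+-congʳ (P.+-congˡ {constant K.1#} (x[y-z]≈xy-xz φ d (a * q))) ⟨
      constant K.1# + φ * (d + - (a * q)) + φ * (a * q)         ∎)
      where open CommutativeSemigroupProperties P.*-commutativeSemigroup using (x∙yz≈y∙xz)

-- Augmentation of a valuation.

module Comparison {c ℓ : Level} {R : CommutativeRing c ℓ} (V V′ : Valuation R)
  (V≤V′ : ∀ {f γ} → Valuation._∈𝒫_ V f γ → Valuation._∈𝒫_ V′ f γ) where
  open CommutativeRing R
  private
    module V = ValuationProperties V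
    module V′ = ValuationProperties V′

  𝒫⁺-≤ : ∀ {f γ} → f V.∈𝒫⁺ γ → f V′.∈𝒫⁺ γ
  𝒫⁺-≤ {f} {γ} h with V.val-split f
  ... | inj₁ e       = V′.0∈𝒫⁺ e
  ... | inj₂ (α , e) = V′.𝒫-<-𝒫⁺ (V.𝒫⁺⇒< e h) (V≤V′ (V.val⇒𝒫 e))

  unit-≤ : ∀ {f} → V.IsUnitMod⁺ f → V′.IsUnitMod⁺ f
  unit-≤ (g , h) = g , 𝒫⁺-≤ h

  -- Neither the value of `f` nor that of its inverse may drop, and they remain opposite to each
  -- other, so neither can rise.
  val-unit-≤ : ∀ {f α} → V.IsUnitMod⁺ f → V.val f ≡ [ α ] → V′.val f ≡ [ α ]
  val-unit-≤ {f} {α} u@(g , h) e =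
    let α′ , e′ = V′.val-nonzero (V′.unit-nonzero (unit-≤ u))
        α≤α′ : α ℚ.≤ α′
        α≤α′ = V′.𝒫⇒≤ e′ (V≤V′ (V.val⇒𝒫 e))
        -α≤-α′ : ℚ.- α ℚ.≤ ℚ.- α′
        -α≤-α′ = V′.𝒫⇒≤ (V′.unit-val e′ (𝒫⁺-≤ h)) (V≤V′ (V.val⇒𝒫 (V.unit-val e h)))
    in ≡.trans e′ (≡.cong [_] (ℚ.≤-antisym
         (≡.subst₂ ℚ._≤_ (neg-involutive α′) (neg-involutive α) (ℚ.neg-antimono-≤ -α≤-α′)) α≤α′))
    where open RingFacts ℚ.+-*-commutativeRing using () renaming (-‿involutive to neg-involutive)

module _ {c ℓ : Level} {K : Field c ℓ} where
  private module K = Field K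
  open Polynomial K.commutativeRing
  open DegreeBound K.commutativeRing

  monic-degree : ∀ φ (m : MonicOfPositiveDegree φ) → HasDegree φ (proj₁ m)
  monic-degree φ (n , _ , lead , above) = (λ e → K.1≉0 (K.trans (K.sym lead) e)) , above

  monic-nonzero : ∀ φ → MonicOfPositiveDegree φ → ¬ φ ≈ []
  monic-nonzero φ m h = proj₁ (monic-degree φ m) (h .at (proj₁ m))

  ≺⇒deg< : ∀ φ {f} (m : MonicOfPositiveDegree φ) → f ≺ proj₁ m → f deg< φ
  ≺⇒deg< φ m h = proj₁ m , monic-degree φ m , h .vanishes

module Augmentation {c ℓ : Level} {K : Field c ℓ} (v : DiscreteValuation K) (μ μ′ : 𝕍 v)
  (φ : Polynomial.Poly (Field.commutativeRing K)) (lam : ℚ) (0<lam : 0ℚ ℚ.< lam)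
  (key : IsKeyPolynomial v μ φ) (augmentation : IsAugmentation v μ φ lam μ′) where

  private
    module K = Field K
    V V′ : Valuation (Polynomial.polyRing K.commutativeRing)
    V  = 𝕍.valuation μ
    V′ = 𝕍.valuation μ′
  open Polynomial K.commutativeRing
  open DegreeBound K.commutativeRing
  open RingFacts polyRing using (xyx⁻¹≈y; -‿distribˡ-*)
  private
    module P = CommutativeRing polyRing
    module v = ValuationProperties (DiscreteValuation.valuation v)
    module V = ValuationProperties V
    module V′ = ValuationProperties V′
    module G = GradedProperties V
  open GradedRing V using (H)
  open RawSemiringDefinitions (Semiring.rawSemiring P.semiring) using (_^_)
  open RawSemiringDefinitions (Semiring.rawSemiring G.Gr.semiring) using (_∣_; Prime)
  open IsKeyPolynomial key

  n : ℕ
  n = proj₁ monic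

  lead : coeff φ n K.≈ K.1#
  lead = proj₁ (proj₂ (proj₂ monic))

  φ≺ : φ ≺ suc n
  φ≺ = vanishing (proj₂ (proj₂ (proj₂ monic)))

  φ≉0 : ¬ φ ≈ []
  φ≉0 = monic-nonzero {K = K} φ monic

  private
    1≺ : constant K.1# ≺ n
    1≺ = ≺-mono (proj₁ (proj₂ monic)) (≺-constant K.1#)

    small⇒deg< : ∀ {f} → f ≺ n → f deg< φ
    small⇒deg< = ≺⇒deg< {K = K} φ monic

    ∤ : ∀ {g} → ¬ g ≈ [] → g ≺ n → ¬ H φ ∣ H g
    ∤ {g} g≉0 h = minimal g g≉0 (small⇒deg< h)

  expand : ∀ f → Expansion {R = polyRing} φ (_≺ n) f
  expand = go n lead φ≺ (proj₁ (proj₂ monic))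
    where
    go : ∀ n → coeff φ n K.≈ K.1# → φ ≺ suc n → 0 ℕ.< n → ∀ f → Expansion {R = polyRing} φ (_≺ n) f
    go (suc n) lead φ≺ _ = φ-expansion φ lead φ≺

  expansion : ∀ {f} → Expansion {R = polyRing} φ (_≺ n) f → ∃[ gs ] IsExpansion φ f gs
  expansion (nil h) = [] , [] , h
  expansion (cons {a = a} s e h) = let gs , all , g≈ = expansion e
    in a ∷ gs , small⇒deg< s ∷ all , ≈-trans h (+-cong (≈-refl {a}) (*-congˡ φ g≈))

  private
    ⊓⊤ : ∀ w → w ⊓⁺ ⊤⁺ ≡ w
    ⊓⊤ [ _ ] = ≡.refl
    ⊓⊤ ⊤⁺    = ≡.refl

    +0 : ∀ w → w +⁺ [ fromℕ 0 ℚ.* lam ] ≡ w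
    +0 [ q ] = ≡.cong [_] (≡.trans (≡.cong (q ℚ.+_) (ℚ.*-zeroˡ lam)) (ℚ.+-identityʳ q))
    +0 ⊤⁺    = ≡.refl

    val-head : ∀ a → V.val (a * φ ^ 0) +⁺ [ fromℕ 0 ℚ.* lam ] ≡ V.val a
    val-head a = ≡.trans (+0 _) (V.val-cong (P.*-identityʳ a))

    augmented : ∀ a gs → augmentedValue v μ φ lam 0 (a ∷ gs) ≡ V.val a ⊓⁺ augmentedValue v μ φ lam 1 gs
    augmented a gs = ≡.cong (_⊓⁺ augmentedValue v μ φ lam 1 gs) (val-head a)

    deg<0 : [] deg< φ
    deg<0 = small⇒deg< ≺-0

  val-small : ∀ {a} → a ≺ n → V′.val a ≡ V.val a
  val-small {a} s = ≡.trans (augmentation a (a ∷ []) (small⇒deg< s ∷ [] ,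
    ≈-sym (≈-trans (+-cong (≈-refl {a}) (*-[] φ)) (+-comm a [])))) (≡.trans (augmented a []) (⊓⊤ _))

  -- The augmented value is a minimum over the expansion, and the expansion of `φ * g` is that of
  -- `a + φ * g` with first coefficient 0.
  split : ∀ {a} g → a ≺ n → V′.val (a + φ * g) ≡ V′.val a ⊓⁺ V′.val (φ * g)
  split {a} g s = let gs , all , g≈ = expansion (expand g) in ≡.trans
    (augmentation (a + φ * g) (a ∷ gs) (small⇒deg< s ∷ all , +-cong (≈-refl {a}) (*-congˡ φ g≈)))
    (≡.trans (augmented a gs) (≡.cong₂ _⊓⁺_ (≡.sym (val-small s)) (≡.sym (≡.trans
      (augmentation (φ * g) ([] ∷ gs) (deg<0 ∷ all , *-congˡ φ g≈))
      (≡.trans (augmented [] gs) (≡.cong (_⊓⁺ augmentedValue v μ φ lam 1 gs) V.val-0#))))))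

  val-φ : ∀ {β} → V.val φ ≡ [ β ] → V′.val φ ≡ [ β ℚ.+ lam ]
  val-φ {β} h = ≡.trans (augmentation φ ([] ∷ constant K.1# ∷ []) (deg<0 ∷ small⇒deg< 1≺ ∷ [] , φ≈))
    (≡.trans (augmented [] (constant K.1# ∷ [])) (≡.trans (≡.cong₂ _⊓⁺_ V.val-0# (⊓⊤ _))
      (≡.cong₂ _+⁺_ (≡.trans (V.val-cong (P.trans (P.*-identityˡ _) (P.*-identityʳ φ))) h) (≡.cong [_] (ℚ.*-identityˡ lam)))))
    where
    φ≈ : φ ≈ [] + φ * (constant K.1# + φ * [])
    φ≈ = P.trans (P.sym (P.*-identityʳ φ)) (P.*-congˡ {φ} (P.trans (P.sym (P.+-identityʳ (constant K.1#)))
      (P.+-congˡ {constant K.1#} (P.sym (*-[] φ)))))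

  -- This concerns the valuation before augmentation. If `a` had value below `γ`, it would agree
  -- with `- (φ * g)` in its own degree, so `φ` would divide it in the graded ring, against
  -- minimality.
  key-split : ∀ {a γ} g → a ≺ n → a + φ * g V.∈𝒫 γ → a V.∈𝒫 γ × φ * g V.∈𝒫 γ
  key-split {a} {γ} g s h = a∈ , V.𝒫-resp (xyx⁻¹≈y a (φ * g)) (V.𝒫-+ h (V.𝒫-‿ a∈))
    where
    a∈ : a V.∈𝒫 γ
    a∈ with V.val-split a
    ... | inj₁ e = V.0∈𝒫 e
    ... | inj₂ (α , e) with γ ℚ.≤? α
    ...   | yes p = V.≤⇒𝒫 e p
    ...   | no ¬p = ⊥-elim (∤ (V.val≢⊤ e) s (G.H-∣ {f = - g} e (V.𝒫⁺-resp (P.sym difference)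
      (V.𝒫⁺-‿ (V.𝒫-<-𝒫⁺ (ℚ.≰⇒> ¬p) h)))))
      where
      difference : (- g) * φ P.- a ≈ - (a + φ * g)
      difference = P.trans (P.+-congʳ (P.trans (P.sym (-‿distribˡ-* g φ)) (P.-‿cong (*-comm g φ))))
        (P.trans (RingFacts.-‿+-comm polyRing (φ * g) a) (P.-‿cong (+-comm (φ * g) a)))

  private
    β : ℚ
    β = proj₁ (V.val-nonzero φ≉0)

    val-φ≡β : V.val φ ≡ [ β ]
    val-φ≡β = proj₂ (V.val-nonzero φ≉0)

    -- The new value of `φ` is `β + lam`, and `lam > 0` makes the bound strict.
    φ*-𝒫⁺ : ∀ {g γ} → g V′.∈𝒫 γ ℚ.- β → φ * g V′.∈𝒫⁺ γ
    φ*-𝒫⁺ {g} {γ} h = V′.𝒫-<-𝒫⁺ γ<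
      (≡.subst (φ * g V′.∈𝒫_) ≡.refl (V′.𝒫-* (V′.val⇒𝒫 (val-φ val-φ≡β)) h))
      where
      open +-*-Solver
      γ< : γ ℚ.< (β ℚ.+ lam) ℚ.+ (γ ℚ.- β)
      γ< = ≡.subst₂ ℚ._<_ (ℚ.+-identityʳ γ)
        (solve 3 (λ β lam γ → γ :+ lam := (β :+ lam) :+ (γ :- β)) ≡.refl β lam γ) (ℚ.+-monoʳ-< γ 0<lam)

    cofactor : ∀ {g γ} → φ * g V.∈𝒫 γ → g V.∈𝒫 γ ℚ.- β
    cofactor {g} {γ} h = V.𝒫-cancel val-φ≡β (≡.subst (φ * g V.∈𝒫_) (≡.sym (x+[y-x]≡y β γ)) h)

    -- Old values split along the expansion by `key-split`; small coefficients keep their value and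
    -- `φ` gains.
    V≤V′-expansion : ∀ {f} → Expansion {R = polyRing} φ (_≺ n) f → ∀ {γ} → f V.∈𝒫 γ → f V′.∈𝒫 γ
    V≤V′-expansion (nil e) h = V′.0∈𝒫 e
    V≤V′-expansion (cons {g = g} s e eq) {γ} h = let a∈ , φg∈ = key-split g s (V.𝒫-resp eq h)
      in V′.𝒫-resp (P.sym eq) (V′.𝒫-+ (≡.subst (λ w → [ γ ] ≤⁺ w) (≡.sym (val-small s)) a∈)
           (V′.𝒫⁺⇒𝒫 (φ*-𝒫⁺ (V≤V′-expansion e (cofactor φg∈)))))

  V≤V′ : ∀ {f γ} → f V.∈𝒫 γ → f V′.∈𝒫 γ
  V≤V′ {f} = V≤V′-expansion (expand f)

  open Comparison V V′ V≤V′ public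

  -- The multiple of `φ` has old value at least `γ`, hence new value above `γ`. The bound on `f`
  -- must hold for the old valuation: under the new one `φ * g` could itself have value exactly `γ`.
  remainder-∼ : ∀ {f a γ} g → a ≺ n → f ≈ a + φ * g → f V.∈𝒫 γ → f V′.∼[ γ ] a
  remainder-∼ {f} {a} g s eq h = V′.𝒫⁺-resp (P.+-congʳ (P.sym eq))
    (V′.+-∼ a (φ*-𝒫⁺ (V≤V′ (cofactor (proj₂ (key-split g s (V.𝒫-resp eq h)))))))

  reduce : ∀ {f γ} → f V.∈𝒫 γ → ∃[ a ] a ≺ n × f V′.∼[ γ ] a
  reduce {f} h = let g , a , eq , s , _ = divideMonic φ lead φ≺ f in a , s , remainder-∼ g s eq h

  private
    ∤-* : ∀ {a b} → ¬ a ≈ [] → a ≺ n → ¬ b ≈ [] → b ≺ n → ¬ H φ ∣ H (a * b)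
    ∤-* {a} {b} a≉0 a≺ b≉0 b≺ h with Prime.split-∣ prime (∣-respʳ (G.H-* a b) h)
      where open import Algebra.Properties.Semiring.Divisibility G.Gr.semiring using (∣-respʳ)
    ... | inj₁ k = ∤ a≉0 a≺ k
    ... | inj₂ k = ∤ b≉0 b≺ k

    -- A factorisation of `φ` into small factors would make H(φ) divide a product of their classes;
    -- primality and minimality exclude this.
    irreducible : ∀ a b → a ≺ n → b ≺ n → ¬ φ ≈ a * b
    irreducible a b a≺ b≺ h = ∤-* a≉0 a≺ b≉0 b≺ (G.H-∣ {f = constant K.1#} (≡.trans (V.val-cong (P.sym h)) val-φ≡β)
      (V.∼-refl (P.trans (P.*-identityˡ φ) h)))
      where
      a≉0 : ¬ a ≈ []
      a≉0 e = φ≉0 (≈-trans h (P.trans (P.*-congʳ e) (P.zeroˡ b)))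
      b≉0 : ¬ b ≈ []
      b≉0 e = φ≉0 (≈-trans h (P.trans (P.*-congˡ {a} e) (P.zeroʳ a)))

  private
    -- If μ(ab) < 0 then ab ∼ -φd would be divisible by φ.
    bezout-bound : ∀ {a b d} → a ≺ n → ¬ a ≈ [] → b ≺ n → a * b ≈ constant K.1# + φ * d → a * b V.∈𝒫 0ℚ
    bezout-bound {a} {b} {d} a≺ a≉0 b≺ eq = go (V.val-split (a * b))
      where
      difference : a * b P.- d * φ ≈ constant K.1#
      difference = P.trans (P.+-cong eq (P.-‿cong (*-comm d φ)))
        (RingFacts.//-rightDividesʳ polyRing (φ * d) (constant K.1#))
      go : a * b ≈ [] ⊎ (∃[ α ] V.val (a * b) ≡ [ α ]) → a * b V.∈𝒫 0ℚ
      go (inj₁ e) = V.0∈𝒫 e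
      go (inj₂ (α , e)) with 0ℚ ℚ.≤? α
      ... | yes p = V.≤⇒𝒫 e p
      ... | no ¬p = ⊥-elim (∤-* a≉0 a≺ (λ k → V.val≢⊤ e (P.trans (P.*-congˡ {a} k) (P.zeroʳ a))) b≺
        (G.H-∣ {f = d} e (V.∼-sym {f = a * b} {g = d * φ} (V.𝒫⁺-resp (P.sym difference) (V.<⇒𝒫⁺ V.val-1# (ℚ.≰⇒> ¬p))))))

  -- Bézout gives `a * b ≈ 1 + φ * d`, an equation with remainder 1. To pass to classes it must hold
  -- in degree 0, which is what `bezout-bound` provides.
  small-inverse : ∀ {a} → a ≺ n → ¬ a ≈ [] → ∃[ b ] b ≺ n × a * b V′.∼[ 0ℚ ] constant K.1#
  small-inverse {a} a≺ a≉0 =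
    let b , d , b≺ , eq = Bezout.inverse-mod K v.≈0? lead φ≺ irreducible a a≺ a≉0
    in b , b≺ , remainder-∼ d 1≺ eq (bezout-bound {a} {b} {d} a≺ a≉0 b≺ eq)

  adapted : IsAdapted V′ φ (_≺ n)
  adapted = record
    { small-resp    = ≺-resp
    ; small-0       = ≺-0
    ; small-1       = 1≺
    ; small-+       = ≺-+
    ; small-neg     = ≺-neg
    ; small-*       = λ {a} {b} {γ} a≺ b≺ h → reduce (product a≺ b≺ h)
    ; small-inverse = small-inverse
    ; φ-nonzero     = φ≉0
    ; split         = split
    ; expand        = expand
    }
    where
    -- `reduce` asks for the old value of `a * b`; it equals the new one because both factors are
    -- small.
    product : ∀ {a b γ} → a ≺ n → b ≺ n → V′.val (a * b) ≡ [ γ ] → a * b V.∈𝒫 γ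
    product {a} {b} a≺ b≺ h = V.val⇒𝒫 (≡.trans (V.val-* a b)
      (≡.trans (≡.cong₂ _+⁺_ (≡.sym (val-small a≺)) (≡.sym (val-small b≺))) (≡.trans (≡.sym (V′.val-* a b)) h)))

-- The Gauss valuation as base case.

module Gauss {c ℓ : Level} {K : Field c ℓ} (v : DiscreteValuation K) (μ : 𝕍 v) (gauss : IsGauss v μ)
  (φ : Polynomial.Poly (Field.commutativeRing K))
  (φ≈X : Polynomial._≈_ (Field.commutativeRing K) φ (Polynomial.X (Field.commutativeRing K))) where
  private
    module K = Field K
    module v = ValuationProperties (DiscreteValuation.valuation v)
    V : Valuation (Polynomial.polyRing K.commutativeRing)
    V = 𝕍.valuation μ
    module V = ValuationProperties V
  open Polynomial K.commutativeRing
  open PolynomialProperties K.commutativeRing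
  open DegreeBound K.commutativeRing
  private module P = CommutativeRing polyRing

  val-constant : ∀ a → V.val (constant a) ≡ v.val a
  val-constant = 𝕍.extends μ

  val-∷ : ∀ a g → V.val (a ∷ g) ≡ v.val a ⊓⁺ V.val g
  val-∷ a g = ≡.trans (gauss (a ∷ g)) (≡.cong (v.val a ⊓⁺_) (≡.sym (gauss g)))

  val-shift : ∀ g → V.val (φ * g) ≡ V.val g
  val-shift g = ≡.trans (V.val-cong (P.trans (P.*-congʳ φ≈X) (X* g)))
    (≡.trans (val-∷ K.0# g) (≡.cong (_⊓⁺ V.val g) v.val-0#))

  val-φ : V.val φ ≡ [ 0ℚ ]
  val-φ = ≡.trans (V.val-cong (P.sym (P.*-identityʳ φ))) (≡.trans (val-shift (constant K.1#)) V.val-1#)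

  small-constant : ∀ {a} → a ≺ 1 → V.val a ≡ v.val (coeff a 0)
  small-constant {a} s = ≡.trans (V.val-cong (≺1⇒≈constant s)) (val-constant (coeff a 0))

  private
    constant-* : ∀ a b → constant (a K.* b) ≈ constant a * constant b
    constant-* = RingHom.*-homo constantHom

    split : ∀ {a} g → a ≺ 1 → V.val (a + φ * g) ≡ V.val a ⊓⁺ V.val (φ * g)
    split {a} g s = ≡.trans
      (V.val-cong (P.sym (P.trans (∷≈ (coeff a 0) g) (P.+-cong (P.sym (≺1⇒≈constant s)) (P.*-congʳ (P.sym φ≈X))))))
      (≡.trans (val-∷ (coeff a 0) g) (≡.cong₂ _⊓⁺_ (≡.sym (small-constant s)) (≡.sym (val-shift g))))

    expand : ∀ f → Expansion {R = polyRing} φ (_≺ 1) f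
    expand []      = nil ≈-refl
    expand (a ∷ f) = cons (≺-constant a) (expand f)
      (P.trans (∷≈ a f) (P.+-congˡ {constant a} (P.*-congʳ (P.sym φ≈X))))

    small-inverse : ∀ {a} → a ≺ 1 → ¬ a ≈ [] → ∃[ b ] b ≺ 1 × a * b V.∼[ 0ℚ ] constant K.1#
    small-inverse {a} s a≉0 = constant w , ≺-constant w , V.∼-refl (P.trans (P.*-congʳ (≺1⇒≈constant s))
      (P.trans (P.sym (constant-* (coeff a 0) w)) (RingHom.cong constantHom aw≈1)))
      where
      inv : ∃[ w ] coeff a 0 K.* w K.≈ K.1#
      inv = let w , _ , h = K.inverse (coeff a 0) (λ e → a≉0 (P.trans (≺1⇒≈constant s)
                  (P.trans (shift-cong e ≈-refl) shift-[]))) in w , h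
      w : K.Carrier
      w = proj₁ inv
      aw≈1 : coeff a 0 K.* w K.≈ K.1#
      aw≈1 = proj₂ inv

    small-* : ∀ {a b γ} → a ≺ 1 → b ≺ 1 → V.val (a * b) ≡ [ γ ] → ∃[ d ] d ≺ 1 × a * b V.∼[ γ ] d
    small-* {a} {b} s t _ = a * b , ≺-resp (P.sym (P.trans (P.*-cong (≺1⇒≈constant s) (≺1⇒≈constant t))
      (P.sym (constant-* (coeff a 0) (coeff b 0))))) (≺-constant _) , V.∼-refl {f = a * b} ≈-refl

  adapted : IsAdapted V φ (_≺ 1)
  adapted = record
    { small-resp    = ≺-resp
    ; small-0       = ≺-0
    ; small-1       = ≺-constant K.1#
    ; small-+       = ≺-+
    ; small-neg     = ≺-neg
    ; small-*       = λ {a} {b} {γ} → small-* {a} {b} {γ}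
    ; small-inverse = small-inverse
    ; φ-nonzero     = V.val≢⊤ val-φ
    ; split         = split
    ; expand        = expand
    }

-- Values of units and generators of the value group.

module ValueGroup {c ℓ : Level} {R : CommutativeRing c ℓ} (V : Valuation R) where
  open CommutativeRing R
  open ValuationProperties V
  open CommutativeSemigroupProperties *-commutativeSemigroup using (interchange)

  -- In contrast to the values of all polynomials these form a group, the inverse polynomial having
  -- the opposite value.
  UnitValue : ℚ → Set c
  UnitValue α = ∃[ f ] IsUnitMod⁺ f × val f ≡ [ α ]

  unit-value-0 : UnitValue 0ℚ
  unit-value-0 = 1# , (1# , ∼-refl (*-identityˡ 1#)) , val-1#

  unit-value-neg : ∀ {α} → UnitValue α → UnitValue (ℚ.- α)
  unit-value-neg (f , (g , h) , e) = g , (f , 𝒫⁺-resp (+-congʳ (*-comm f g)) h) , unit-val e h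

  unit-value-+ : ∀ {α β} → UnitValue α → UnitValue β → UnitValue (α ℚ.+ β)
  unit-value-+ (f , (g , h) , e) (f′ , (g′ , h′) , e′) = f * f′ , (g * g′ ,
    𝒫⁺-resp (+-cong (sym (interchange f f′ g g′)) (-‿cong (*-identityˡ 1#)))
      (∼-* {0ℚ} {0ℚ} (∼-𝒫 h 𝒫-1#) 𝒫-1# h h′)) , val-*ᵛ e e′

  module _ {φ : Carrier} {Small : Carrier → Set ℓ} (adapted : IsAdapted V φ Small) where
    open IsAdapted adapted

    -- By `split` the value of a polynomial is attained by one term of its expansion, hence is a
    -- small value plus a multiple of the value of `φ`.
    Γ-generated : ∀ {t} (T : ℚ → Set t) → (∀ {α β} → T α → T β → T (α ℚ.+ β)) → (∀ {α} → T α → T (ℚ.- α)) →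
      (∀ {a α} → Small a → val a ≡ [ α ] → T α) → (∀ {β} → val φ ≡ [ β ] → T β) → ∀ {α} → Γ α → T α
    Γ-generated T T-+ T-neg T-small T-φ (f , g , a , b , hf , hg , ≡.refl) =
      T-+ (values (expand f) hf) (T-neg (values (expand g) hg))
      where
      ⊓⁺-sel : ∀ {α} a b → a ⊓⁺ b ≡ [ α ] → a ≡ [ α ] ⊎ b ≡ [ α ]
      ⊓⁺-sel [ a ] [ b ] h with ℚ.⊓-sel a b
      ... | inj₁ e = inj₁ (≡.trans (≡.cong [_] (≡.sym e)) h)
      ... | inj₂ e = inj₂ (≡.trans (≡.cong [_] (≡.sym e)) h)
      ⊓⁺-sel [ a ] ⊤⁺    h = inj₁ h
      ⊓⁺-sel ⊤⁺    b     h = inj₂ h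
      values : ∀ {f} → Expansion φ Small f → ∀ {α} → val f ≡ [ α ] → T α
      values (nil e) h = ⊥-elim (val≢⊤ h e)
      values (cons {a = a} {g} s e eq) h with ⊓⁺-sel _ _ (≡.trans (≡.sym (split g s)) (≡.trans (val-cong (sym eq)) h))
      ... | inj₁ k = T-small s k
      ... | inj₂ k with val-nonzero φ-nonzero | val-split g
      ...   | _ , hφ | inj₁ g≈0 = ⊥-elim (val≢⊤ k (trans (*-congˡ g≈0) (zeroʳ φ)))
      ...   | _ , hφ | inj₂ (_ , hg) = ≡.subst T ([]-injective (≡.trans (≡.sym (val-*ᵛ hφ hg)) k)) (T-+ (T-φ hφ) (values e hg))

-- From one key polynomial to the next.

module _ {c ℓ : Level} {K : Field c ℓ} (v : DiscreteValuation K) where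
  private module K = Field K
  open Polynomial K.commutativeRing
  open DegreeBound K.commutativeRing

  module Successor (μ μ′ : 𝕍 v) (φ : Poly) (n : ℕ) (0<n : 0 ℕ.< n) (lead : coeff φ n K.≈ K.1#) (φ≺ : φ ≺ suc n)
    (adapted : IsAdapted (𝕍.valuation μ) φ (_≺ n)) (φ′ : Poly) (lam′ : ℚ) (0<lam′ : 0ℚ ℚ.< lam′)
    (key′ : IsKeyPolynomial v μ φ′) (augmentation′ : IsAugmentation v μ φ′ lam′ μ′)
    (φ′≁φ : ¬ GradedRing._≈_ (𝕍.valuation μ) (GradedRing.H (𝕍.valuation μ) φ′) (GradedRing.H (𝕍.valuation μ) φ)) where

    private
      module P = CommutativeRing polyRing
      module V = ValuationProperties (𝕍.valuation μ)
      module V′ = ValuationProperties (𝕍.valuation μ′)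
      module G = GradedProperties (𝕍.valuation μ)
      module A = IsAdapted adapted
      module Aug = Augmentation v μ μ′ φ′ lam′ 0<lam′ key′ augmentation′
    open RingFacts polyRing using (xyx⁻¹≈y; //-rightDividesˡ)

    private
      a : Poly
      a = φ′ P.- φ

      φ′≈a+φ : φ′ ≈ a + φ
      φ′≈a+φ = P.sym (//-rightDividesˡ φ φ′)

      ∤ : ∀ {g} → ¬ g ≈ [] → g ≺ Aug.n → ∀ {α q} → V.val g ≡ [ α ] → ¬ q * φ′ V.∼[ α ] g
      ∤ {g} g≉0 g≺ {q = q} e h = IsKeyPolynomial.minimal key′ g g≉0
        (≺⇒deg< {K = K} φ′ (IsKeyPolynomial.monic key′) g≺) (G.H-∣ {f = q} e h)

      -- Otherwise `φ′` would be small for `φ`, its class a unit, and `φ′` would divide 1, which has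
      -- smaller degree.
      n≤n′ : n ℕ.≤ Aug.n
      n≤n′ = ℕ.≮⇒≥ λ n′<n →
        let g , _ , h = A.small-inverse (≺-mono n′<n Aug.φ≺) Aug.φ≉0
        in ∤ {constant K.1#} (λ e → K.1≉0 (e .at 0)) (≺-mono (proj₁ (proj₂ (IsKeyPolynomial.monic key′))) (≺-constant K.1#))
             {q = g} V.val-1# (V.𝒫⁺-resp (P.+-congʳ (*-comm φ′ g)) h)

      a≺ : n ≡ Aug.n → a ≺ n
      a≺ n≡n′ .vanishes m n≤m with ℕ.m≤n⇒m<n∨m≡n n≤m
      ... | inj₁ n<m = ≺-+ (≺-mono (ℕ.≤-reflexive (≡.cong suc (≡.sym n≡n′))) Aug.φ≺) (≺-neg φ≺) .vanishes m n<m
      ... | inj₂ ≡.refl = K.trans (coeff-+ φ′ (- φ) n) (K.trans (K.+-congˡ (coeff-neg φ n))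
        (RingFacts.diff-refl K.commutativeRing (K.trans (K.trans (K.reflexive (≡.cong (coeff φ′) n≡n′)) Aug.lead) (K.sym lead))))

    Unit-φ : Set _
    Unit-φ = V′.IsUnitMod⁺ φ × (∀ {β} → V.val φ ≡ [ β ] → V′.val φ ≡ [ β ])

    private
      β : ℚ
      β = proj₁ (V.val-nonzero A.φ-nonzero)

      val-φ : V.val φ ≡ [ β ]
      val-φ = proj₂ (V.val-nonzero A.φ-nonzero)

      -- φ ∼ -a for μ′, and a is small for φ′.
      same-degree : n ≡ Aug.n → V.val a ≡ [ β ] → Unit-φ
      same-degree n≡n′ val-a = unit , λ h → ≡.trans val′-φ (≡.trans (≡.sym val-φ) h)
        where
        -a≺ : - a ≺ Aug.n
        -a≺ = ≡.subst (- a ≺_) n≡n′ (≺-neg (a≺ n≡n′))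
        val′-a : V′.val (- a) ≡ [ β ]
        val′-a = ≡.trans (Aug.val-small -a≺) (≡.trans (V.val-neg a) val-a)
        φ′∈ : φ′ V.∈𝒫 β
        φ′∈ = V.𝒫-resp (P.sym φ′≈a+φ) (V.𝒫-+ {x = a} (V.val⇒𝒫 val-a) (V.val⇒𝒫 val-φ))
        φ′∈⁺ : φ′ V′.∈𝒫⁺ β
        φ′∈⁺ with V.val-nonzero Aug.φ≉0
        ... | γ , e = V′.<⇒𝒫⁺ (Aug.val-φ e) (ℚ.≤-<-trans (V.𝒫⇒≤ e φ′∈)
          (≡.subst (ℚ._< γ ℚ.+ lam′) (ℚ.+-identityʳ γ) (ℚ.+-monoʳ-< γ 0<lam′)))
        φ∼-a : φ V′.∼[ β ] - a
        φ∼-a = V′.𝒫⁺-resp (P.trans φ′≈a+φ (P.trans (+-comm a φ) (P.+-congˡ {φ} (P.sym (RingFacts.-‿involutive polyRing a))))) φ′∈⁺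
        val′-φ : V′.val φ ≡ [ β ]
        val′-φ = V′.∼-val φ∼-a val′-a
        unit : V′.IsUnitMod⁺ φ
        unit =
          let b , _ , h = Aug.small-inverse -a≺ (V′.val≢⊤ val′-a)
              φb∼ : φ * b V′.∼[ 0ℚ ] (- a) * b
              φb∼ = ≡.subst (λ q → φ * b V′.∼[ q ] (- a) * b) (ℚ.+-inverseʳ β)
                (V′.∼-* {f = φ} {g = - a} {h = b} {k = b} (V′.val⇒𝒫 val′-φ) (V′.val⇒𝒫 (V′.unit-val val′-a h)) φ∼-a (V′.∼-refl {f = b} ≈-refl))
          in b , V′.∼-trans {f = φ * b} {g = (- a) * b} φb∼ h

    -- If deg φ < deg φ′, then `φ` is small for `φ′`. If the degrees agree, `a = φ′ - φ` is small,
    -- and its value must be that of `φ`: a larger one would give φ′ ∼ φ, a smaller one φ′ ∼ a and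
    -- hence divisibility of `a` by `φ′`.
    unit-φ : Unit-φ
    unit-φ with ℕ.m≤n⇒m<n∨m≡n n≤n′
    ... | inj₁ n<n′ = (let b , _ , h = Aug.small-inverse (≺-mono n<n′ φ≺) A.φ-nonzero in b , h) ,
      λ h → ≡.trans (Aug.val-small (≺-mono n<n′ φ≺)) h
    ... | inj₂ n≡n′ with V.𝒫⁺-dec a β
    ...   | inj₁ h = ⊥-elim (φ′≁φ (G.H-∼ {f = φ′} val-φ h))
    ...   | inj₂ (α , e , α≤β) with ℚ.<-cmp α β
    ...     | tri≈ _ ≡.refl _ = same-degree n≡n′ e
    ...     | tri> _ _ β<α    = ⊥-elim (ℚ.<-irrefl ≡.refl (ℚ.<-≤-trans β<α α≤β))
    ...     | tri< α<β _ _    = ⊥-elim (∤ {a} (V.val≢⊤ e) (≡.subst (a ≺_) n≡n′ (a≺ n≡n′)) {q = constant K.1#} e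
      (V.𝒫⁺-resp (P.sym difference) (V.<⇒𝒫⁺ val-φ α<β)))
      where
      difference : constant K.1# * φ′ P.- a ≈ φ
      difference = P.trans (P.+-congʳ (P.trans (P.*-identityˡ φ′) φ′≈a+φ)) (xyx⁻¹≈y a φ)

-- Induction along the chain.

module Chain {c ℓ : Level} {K : Field c ℓ} (v : DiscreteValuation K) (π : Field.Carrier K)
  (uniformizer : DiscreteValuation.IsUniformizer v π) {r : ℕ} (chain : MacLaneChain v r) where

  private module K = Field K
  private module v = ValuationProperties (DiscreteValuation.valuation v)
  open MacLaneChain chain
  open Polynomial K.commutativeRing
  open DegreeBound K.commutativeRing
  private module P = CommutativeRing polyRing

  V : ℕ → Valuation (K[x] v)
  V i = 𝕍.valuation (μ i)

  module V i = ValuationProperties (V i)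

  -- The degree of pᵢ, which will generate the degrees of the small classes at stage `i`.
  δ : ℕ → ℚ
  δ i = ((+ 1) / eμ₋₁ i) {{eμ₋₁≢0 i}}

  -- An element of value 1 is π b with b integral, so v(π) ≤ 1; and v(π) is a positive integer.
  val-π : v.val π ≡ [ ℚ.1ℚ ]
  val-π = go (v.val-split π)
    where
    π∈ : π v.∈𝒫⁺ 0ℚ
    π∈ = Equivalence.from (uniformizer π) (K.1# , v.𝒫-1# , K.sym (K.*-identityʳ π))
    one : ∃[ a ] v.val a ≡ [ ℚ.1ℚ ]
    one = Equivalence.from (DiscreteValuation.val-image v ℚ.1ℚ) (+ 1 , ≡.refl)
    cofactor : ∃[ b ] b v.∈𝒫 0ℚ × proj₁ one K.≈ π K.* b
    cofactor = Equivalence.to (uniformizer (proj₁ one)) (v.<⇒𝒫⁺ (proj₂ one) (ℚ.positive⁻¹ ℚ.1ℚ))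
    b : K.Carrier
    b = proj₁ cofactor
    go : π K.≈ K.0# ⊎ (∃[ α ] v.val π ≡ [ α ]) → v.val π ≡ [ ℚ.1ℚ ]
    go (inj₁ π≈0) = ⊥-elim (v.val≢⊤ (proj₂ one) (K.trans (proj₂ (proj₂ cofactor)) (K.trans (K.*-congʳ π≈0) (K.zeroˡ b))))
    go (inj₂ (α , e)) with Equivalence.to (DiscreteValuation.val-image v α) (π , e) | v.val-split b
    ... | n , ≡.refl | inj₁ b≈0 =
      ⊥-elim (v.val≢⊤ (proj₂ one) (K.trans (proj₂ (proj₂ cofactor)) (K.trans (K.*-congˡ b≈0) (K.zeroʳ π))))
    ... | n , ≡.refl | inj₂ (β , k) = ≡.trans e (≡.cong [_] (ℚ.≤-antisym n≤1 1≤n))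
      where
      n+β≡1 : fromℤ n ℚ.+ β ≡ ℚ.1ℚ
      n+β≡1 = []-injective (≡.trans (≡.sym (v.val-*ᵛ e k)) (≡.trans (v.val-cong (K.sym (proj₂ (proj₂ cofactor)))) (proj₂ one)))
      n≤1 : fromℤ n ℚ.≤ ℚ.1ℚ
      n≤1 = ≡.subst₂ ℚ._≤_ (ℚ.+-identityʳ (fromℤ n)) n+β≡1
        (ℚ.+-monoʳ-≤ (fromℤ n) (v.𝒫⇒≤ k (proj₁ (proj₂ cofactor))))
      0<n : 0ℚ ℚ.< fromℤ n
      0<n = v.𝒫⁺⇒< e π∈
      1≤n : ℚ.1ℚ ℚ.≤ fromℤ n
      1≤n = go′ n 0<n
        where
        go′ : ∀ n → 0ℚ ℚ.< fromℤ n → ℚ.1ℚ ℚ.≤ fromℤ n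
        go′ (+ zero)  h = ⊥-elim (ℚ.<-irrefl ≡.refl h)
        go′ (+ suc k) h = ≡.subst₂ ℚ._≤_ (ℚ.+-identityʳ ℚ.1ℚ) (≡.sym (fromℕ-suc k))
          (ℚ.+-monoʳ-≤ ℚ.1ℚ (ℚ.nonNegative⁻¹ (fromℕ k) {{ℚ.normalize-nonNeg k 1}}))
        go′ -[1+ k ]  h = ⊥-elim (ℚ.<-asym h (ℚ.neg-antimono-< (ℚ.positive⁻¹ (fromℕ (suc k)) {{ℚ.normalize-pos (suc k) 1}})))

  -- The polynomials whose value at stage i is already determined before stage i.
  Before : ℕ → Poly → ℚ → Set ℓ
  Before zero    f γ = f ≺ 1 × Valuation._∈𝒫_ (V 0) f γ
  Before (suc i) f γ = Lift ℓ (Valuation._∈𝒫_ (V i) f γ)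

  -- The induction hypothesis. `unit-value` puts 1/e(μᵢ₋₁) into Γ(μᵢ), which yields divisibility of
  -- the e(μᵢ); `reduce` and `before` identify the small classes with what survives from the
  -- preceding stage.
  record Stage (i : ℕ) : Set (c ⊔ ℓ) where
    field
      n          : ℕ
      0<n        : 0 ℕ.< n
      lead       : coeff (φ i) n K.≈ K.1#
      φ≺         : φ i ≺ suc n
      adapted    : IsAdapted (V i) (φ i) (_≺ n)
      reduce     : ∀ {f γ} → Before i f γ → ∃[ a ] a ≺ n × V._∼[_]_ i f γ a
      before     : ∀ {a γ} → a ≺ n → V._∈𝒫_ i a γ → Before i a γ
      unit-value : ValueGroup.UnitValue (V i) (δ i)
      small-val  : ∀ {a α} → a ≺ n → V.val i a ≡ [ α ] → ∃[ m ] α ≡ fromℤ m ℚ.* δ i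
      φ-val      : ∃[ m ] V.val i (φ i) ≡ [ lam i ℚ.+ fromℤ m ℚ.* δ i ]

  private module Gauss₀ = Gauss v (μ 0) μ-0 (φ 0) φ-0

  Γ₀⊆ℤ : ∀ {α} → V.Γ 0 α → ∃[ m ] α ≡ fromℤ m
  Γ₀⊆ℤ = ValueGroup.Γ-generated (V 0) Gauss₀.adapted (λ α → ∃[ m ] α ≡ fromℤ m)
    (λ { (m , ≡.refl) (n , ≡.refl) → m ℤ.+ n , ≡.sym (fromℤ-+ m n) })
    (λ { (m , ≡.refl) → ℤ.- m , ≡.sym (fromℤ-neg m) })
    (λ {a} s e → Equivalence.to (DiscreteValuation.val-image v _) (coeff a 0 , ≡.trans (≡.sym (Gauss₀.small-constant s)) e))
    (λ e → + 0 , []-injective (≡.trans (≡.sym e) Gauss₀.val-φ))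

  -- Γ(μ₀) contains 1/e(μ₀) and consists of integers, so e(μ₀) = 1.
  δ-0 : δ 0 ≡ ℚ.1ℚ
  δ-0 = ≡.trans (≡.sym (ℚ.*-identityˡ (δ 0))) (≡.trans (≡.cong (λ n → fromℕ n ℚ.* δ 0) (≡.sym eμ₀≡1)) (recip (eμ 0)))
    where
    instance
      e≢0 : ℕ.NonZero (eμ 0)
      e≢0 = 𝕍.e≢0 (μ 0)
    eμ₀≡1 : eμ 0 ≡ 1
    eμ₀≡1 =
      let m , δ≡ = Γ₀⊆ℤ (Equivalence.from (𝕍.eΓ≡ℤ (μ 0) (δ 0)) (+ 1 , recip (eμ 0)))
      in ℕ.m*n≡1⇒m≡1 (eμ 0) ℤ.∣ m ∣ (≡.trans (≡.sym (ℤ.abs-* (+ eμ 0) m)) (≡.cong ℤ.∣_∣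
           (fromℤ-injective (+ eμ 0 ℤ.* m) (+ 1) (≡.trans (fromℤ-* (+ eμ 0) m)
             (≡.trans (≡.cong (fromℕ (eμ 0) ℚ.*_) (≡.sym δ≡)) (recip (eμ 0)))))))

  stage-0 : Stage 0
  stage-0 = record
    { n          = 1
    ; 0<n        = s≤s z≤n
    ; lead       = φ-0 .at 1
    ; φ≺         = ≺-resp (≈-sym φ-0) (≺-∷ (≺-constant K.1#))
    ; adapted    = Gauss₀.adapted
    ; reduce     = λ { {f} (s , _) → f , s , V.∼-refl 0 {f = f} ≈-refl }
    ; before     = λ s h → s , h
    ; unit-value = unit
    ; small-val  = λ {a} _ e → integral (V.Γ-val 0 {x = a} e)
    ; φ-val      = + 0 , ≡.trans (Gauss₀.val-φ) (≡.cong [_] (≡.sym (≡.trans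
        (≡.cong₂ ℚ._+_ lam-0 (ℚ.*-zeroˡ (δ 0))) (ℚ.+-identityˡ 0ℚ))))
    }
    where
    instance
      e≢0 : ℕ.NonZero (eμ 0)
      e≢0 = 𝕍.e≢0 (μ 0)
    integral : ∀ {α} → V.Γ 0 α → ∃[ m ] α ≡ fromℤ m ℚ.* δ 0
    integral {α} h = let m , k = Equivalence.to (𝕍.eΓ≡ℤ (μ 0) α) h in m , scale-cancel {eμ 0} α k
    unit : ValueGroup.UnitValue (V 0) (δ 0)
    unit =
      let m , δ≡ = Γ₀⊆ℤ (Equivalence.from (𝕍.eΓ≡ℤ (μ 0) (δ 0)) (+ 1 , recip (eμ 0)))
          a , e = Equivalence.from (DiscreteValuation.val-image v (δ 0)) (m , δ≡)
          val-a = ≡.trans (Gauss₀.val-constant a) e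
          b , _ , h = IsAdapted.small-inverse Gauss₀.adapted (≺-constant a) (V.val≢⊤ 0 {f = constant a} val-a)
      in constant a , (b , h) , val-a

  module Aug i (i<r : i ℕ.< r) = Augmentation v (μ i) (μ (suc i)) (φ (suc i)) (lam (suc i)) (lam>0 i i<r) (key i i<r) (augmentation i i<r)

  module Succ j (j+1<r : suc j ℕ.< r) (st : Stage (suc j)) = Successor v (μ (suc j)) (μ (suc (suc j)))
    (φ (suc j)) (Stage.n st) (Stage.0<n st) (Stage.lead st) (Stage.φ≺ st) (Stage.adapted st)
    (φ (suc (suc j))) (lam (suc (suc j))) (lam>0 (suc j) j+1<r) (key (suc j) j+1<r) (augmentation (suc j) j+1<r) (≁ (suc j) (s≤s z≤n) j+1<r)

  module _ {i : ℕ} (i<r : i ℕ.< r) where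
    open Aug i i<r using (unit-≤; val-unit-≤)

    unit-value-≤ : ∀ {α} → ValueGroup.UnitValue (V i) α → ValueGroup.UnitValue (V (suc i)) α
    unit-value-≤ (f , u , e) = f , unit-≤ {f} u , val-unit-≤ {f} u e

  -- The condition φᵢ₊₁ ≁ φᵢ starts at i = 1, so x may remain a non-unit for μ₁; but its value 0 is
  -- also the value of the unit 1.
  φ-unit-value : ∀ i (i<r : i ℕ.< r) → Stage i → ∀ {β} → V.val i (φ i) ≡ [ β ] → ValueGroup.UnitValue (V (suc i)) β
  φ-unit-value zero    i<r st e = ≡.subst (ValueGroup.UnitValue (V 1))
    ([]-injective (≡.trans (≡.sym (Gauss₀.val-φ)) e)) (ValueGroup.unit-value-0 (V 1))
  φ-unit-value (suc j) i<r st e = φ (suc j) , proj₁ (Succ.unit-φ j i<r st) , proj₂ (Succ.unit-φ j i<r st) e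

  Γ⊆unit-values : ∀ {i} (i<r : i ℕ.< r) → Stage i → ∀ {α} → V.Γ i α → ValueGroup.UnitValue (V (suc i)) α
  Γ⊆unit-values {i} i<r st = ValueGroup.Γ-generated (V i) (Stage.adapted st) (ValueGroup.UnitValue (V (suc i)))
    (ValueGroup.unit-value-+ (V (suc i))) (ValueGroup.unit-value-neg (V (suc i)))
    (λ {a} s e → unit-value-≤ i<r (a , (let b , _ , h = IsAdapted.small-inverse (Stage.adapted st) s (V.val≢⊤ i {f = a} e) in b , h) , e))
    (φ-unit-value i i<r st)

  φ-integral : ∀ i → i ℕ.< r → ∃[ m ] V.val i (φ (suc i)) ≡ [ fromℤ m ℚ.* δ (suc i) ]
  φ-integral i i<r =
    let β , e = V.val-nonzero i (Aug.φ≉0 i i<r)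
        m , k = Equivalence.to (𝕍.eΓ≡ℤ (μ i) β) (V.Γ-val i {x = φ (suc i)} e)
    in m , ≡.trans e (≡.cong [_] (scale-cancel {eμ i} β {{𝕍.e≢0 (μ i)}} k))

  stage-suc : ∀ {i} → i ℕ.< r → Stage i → Stage (suc i)
  stage-suc {i} i<r st = record
    { n          = A.n
    ; 0<n        = proj₁ (proj₂ (IsKeyPolynomial.monic (key i i<r)))
    ; lead       = A.lead
    ; φ≺         = A.φ≺
    ; adapted    = A.adapted
    ; reduce     = λ { {f} (lift h) → A.reduce {f} h }
    ; before     = λ {a} {γ} s h → lift (≡.subst (λ w → [ γ ] ≤⁺ w) (A.val-small s) h)
    ; unit-value = Γ⊆unit-values i<r st (Equivalence.from (𝕍.eΓ≡ℤ (μ i) (δ (suc i))) (+ 1 , recip (eμ i)))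
    ; small-val  = λ {a} {α} s e → let m , k = Equivalence.to (𝕍.eΓ≡ℤ (μ i) α) (V.Γ-val i {x = a} (≡.trans (≡.sym (A.val-small s)) e))
        in m , scale-cancel {eμ i} α k
    ; φ-val      = let m , e = φ-integral i i<r in
        m , ≡.trans (A.val-φ e) (≡.cong [_] (ℚ.+-comm (fromℤ m ℚ.* δ (suc i)) (lam (suc i))))
    }
    where
    module A = Aug i i<r
    instance
      e≢0 : ℕ.NonZero (eμ i)
      e≢0 = 𝕍.e≢0 (μ i)

  stage : ∀ i → i ℕ.≤ r → Stage i
  stage zero    _   = stage-0
  stage (suc i) i<r = stage-suc i<r (stage i (ℕ.<⇒≤ i<r))

-- The integers e, h, ℓ, s and u.

module Arithmetic {c ℓ : Level} {K : Field c ℓ} (v : DiscreteValuation K) (π : Field.Carrier K)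
  (uniformizer : DiscreteValuation.IsUniformizer v π) {r : ℕ} (chain : MacLaneChain v r) where

  private module K = Field K
  open MacLaneChain chain
  open Chain v π uniformizer chain
  open Polynomial K.commutativeRing
  open DegreeBound K.commutativeRing
  open +-*-Solver using (solve; _:=_; _:+_; _:*_; _:-_; :-_; con)

  -- The equations are guarded by `i ≤ r` because chain data are functions on all of ℕ; beyond `r`
  -- they are filled with zeros.
  record Indices (i : ℕ) : Set where
    field
      e h l : ℕ
      l′    : ℤ
      e-def : i ℕ.≤ r → eμ i ≡ e ℕ.* eμ₋₁ i
      h-def : i ℕ.≤ r → fromℕ (eμ i) ℚ.* lam i ≡ fromℕ h
      l-def : i ℕ.≤ r → + l ℤ.* + h ℤ.+ l′ ℤ.* + e ≡ ℤ.1ℤ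
      l<e   : i ℕ.≤ r → l ℕ.< e

  0≤lam : ∀ i → i ℕ.≤ r → 0ℚ ℚ.≤ lam i
  0≤lam zero    _   = ℚ.≤-reflexive (≡.sym lam-0)
  0≤lam (suc i) i<r = ℚ.<⇒≤ (lam>0 i i<r)

  module _ (i : ℕ) (i≤r : i ℕ.≤ r) where
    private
      module S = Stage (stage i i≤r)
      instance
        eμ≢0 : ℕ.NonZero (eμ i)
        eμ≢0 = 𝕍.e≢0 (μ i)
        eμ₋₁≢0′ : ℕ.NonZero (eμ₋₁ i)
        eμ₋₁≢0′ = eμ₋₁≢0 i

      to : ∀ {α} → V.Γ i α → ∃[ m ] fromℕ (eμ i) ℚ.* α ≡ fromℤ m
      to {α} = Equivalence.to (𝕍.eΓ≡ℤ (μ i) α)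

      from : ∀ {α m} → fromℕ (eμ i) ℚ.* α ≡ fromℤ m → V.Γ i α
      from {α} {m} h = Equivalence.from (𝕍.eΓ≡ℤ (μ i) α) (m , h)

      -- This integer is eᵢ = e(μᵢ)/e(μᵢ₋₁) itself.
      δ-integral : ∃[ m ] fromℕ (eμ i) ℚ.* δ i ≡ fromℤ m
      δ-integral = let f , _ , k = S.unit-value in to (V.Γ-val i {x = f} k)

      eμ≡ : let m = proj₁ δ-integral in fromℤ (+ eμ i) ≡ fromℤ (m ℤ.* + eμ₋₁ i)
      eμ≡ = let m , k = δ-integral in ≡.trans (≡.sym (≡.trans (≡.cong (fromℕ (eμ i) ℚ.*_) (≡.trans (ℚ.*-comm (δ i) (fromℕ (eμ₋₁ i))) (recip (eμ₋₁ i))))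
        (ℚ.*-identityʳ _))) (≡.trans (≡.sym (ℚ.*-assoc (fromℕ (eμ i)) (δ i) (fromℕ (eμ₋₁ i))))
          (≡.trans (≡.cong (ℚ._* fromℕ (eμ₋₁ i)) k) (≡.sym (fromℤ-* m (+ eμ₋₁ i)))))

      e : ℕ
      e = ℤ.∣ proj₁ δ-integral ∣

      eμ≡e*eμ₋₁ : eμ i ≡ e ℕ.* eμ₋₁ i
      eμ≡e*eμ₋₁ = ≡.trans (≡.cong ℤ.∣_∣ (fromℤ-injective (+ eμ i) (proj₁ δ-integral ℤ.* + eμ₋₁ i) eμ≡)) (ℤ.abs-* (proj₁ δ-integral) (+ eμ₋₁ i))

      e≢0 : ℕ.NonZero e
      e≢0 = ℕ.≢-nonZero λ e≡0 → ℕ.≢-nonZero⁻¹ (eμ i) (≡.trans eμ≡e*eμ₋₁ (≡.cong (ℕ._* eμ₋₁ i) e≡0))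

      eμ*δ≡e : fromℕ (eμ i) ℚ.* δ i ≡ fromℕ e
      eμ*δ≡e = multiple-scale e (eμ₋₁ i) eμ≡e*eμ₋₁

      lam-integral : ∃[ m ] fromℕ (eμ i) ℚ.* lam i ≡ fromℤ m
      lam-integral =
        let m , k = S.φ-val
            n , k′ = to (V.Γ-val i {x = φ i} k)
        in n ℤ.- m ℤ.* + e , (begin
          fromℕ (eμ i) ℚ.* lam i
            ≡⟨ solve 4 (λ E lam m δ → E :* lam := E :* (lam :+ m :* δ) :- m :* (E :* δ)) ≡.refl (fromℕ (eμ i)) (lam i) (fromℤ m) (δ i) ⟩
          fromℕ (eμ i) ℚ.* (lam i ℚ.+ fromℤ m ℚ.* δ i) ℚ.- fromℤ m ℚ.* (fromℕ (eμ i) ℚ.* δ i)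
            ≡⟨ ≡.cong₂ (λ a b → a ℚ.- fromℤ m ℚ.* b) k′ eμ*δ≡e ⟩
          fromℤ n ℚ.- fromℤ m ℚ.* fromℕ e
            ≡⟨ ≡.cong (λ q → fromℤ n ℚ.- q) (fromℤ-* m (+ e)) ⟨
          fromℤ n ℚ.- fromℤ (m ℤ.* + e)
            ≡⟨ ≡.cong (fromℤ n ℚ.+_) (fromℤ-neg (m ℤ.* + e)) ⟨
          fromℤ n ℚ.+ fromℤ (ℤ.- (m ℤ.* + e))
            ≡⟨ fromℤ-+ n (ℤ.- (m ℤ.* + e)) ⟨
          fromℤ (n ℤ.- m ℤ.* + e) ∎)
        where open ≡-Reasoning

      h : ℕ
      h = ℤ.∣ proj₁ lam-integral ∣

      eμ*lam≡h : fromℕ (eμ i) ℚ.* lam i ≡ fromℕ h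
      eμ*lam≡h = ≡.trans (proj₂ lam-integral) (≡.sym (fromℤ-nonNegative (proj₁ lam-integral) (≡.subst (0ℚ ℚ.≤_) (proj₂ lam-integral)
        (≡.subst (ℚ._≤ fromℕ (eμ i) ℚ.* lam i) (ℚ.*-zeroʳ (fromℕ (eμ i)))
          (ℚ.*-monoˡ-≤-nonNeg (fromℕ (eμ i)) {{ℚ.normalize-nonNeg (eμ i) 1}} (0≤lam i i≤r))))))

      Combination : ℚ → Set
      Combination α = ∃[ k ] ∃[ m ] α ≡ fromℤ k ℚ.* δ i ℚ.+ fromℤ m ℚ.* lam i

      Γ⊆combinations : ∀ {α} → V.Γ i α → Combination α
      Γ⊆combinations = ValueGroup.Γ-generated (V i) S.adapted Combination
        (λ { (k , m , ≡.refl) (k′ , m′ , ≡.refl) → k ℤ.+ k′ , m ℤ.+ m′ , ≡.sym (≡.trans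
          (≡.cong₂ (λ a b → a ℚ.* δ i ℚ.+ b ℚ.* lam i) (fromℤ-+ k k′) (fromℤ-+ m m′))
          (solve 6 (λ k k′ m m′ δ lam → (k :+ k′) :* δ :+ (m :+ m′) :* lam := (k :* δ :+ m :* lam) :+ (k′ :* δ :+ m′ :* lam)) ≡.refl
            (fromℤ k) (fromℤ k′) (fromℤ m) (fromℤ m′) (δ i) (lam i))) })
        (λ { (k , m , ≡.refl) → ℤ.- k , ℤ.- m , ≡.sym (≡.trans
          (≡.cong₂ (λ a b → a ℚ.* δ i ℚ.+ b ℚ.* lam i) (fromℤ-neg k) (fromℤ-neg m))
          (solve 4 (λ k m δ lam → (:- k) :* δ :+ (:- m) :* lam := :- (k :* δ :+ m :* lam)) ≡.refl (fromℤ k) (fromℤ m) (δ i) (lam i))) })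
        (λ s k → let m , α≡ = S.small-val s k in m , + 0 , ≡.trans α≡
          (solve 2 (λ mδ lam → mδ := mδ :+ con 0ℚ :* lam) ≡.refl (fromℤ m ℚ.* δ i) (lam i)))
        (λ k → let m , k′ = S.φ-val in m , + 1 , ≡.trans ([]-injective (≡.trans (≡.sym k) k′))
          (solve 2 (λ mδ lam → lam :+ mδ := mδ :+ con ℚ.1ℚ :* lam) ≡.refl (fromℤ m ℚ.* δ i) (lam i)))

      -- Since 1/e(μᵢ) lies in Γ(μᵢ), it is a combination of δᵢ and λᵢ; multiplying by e(μᵢ) turns
      -- these into eᵢ and hᵢ.
      bezout : ∃[ k ] ∃[ m ] m ℤ.* + h ℤ.+ k ℤ.* + e ≡ ℤ.1ℤ
      bezout =
        let k , m , α≡ = Γ⊆combinations (from {(+ 1) / eμ i} {+ 1} (recip (eμ i)))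
        in k , m , fromℤ-injective (m ℤ.* + h ℤ.+ k ℤ.* + e) ℤ.1ℤ (begin
          fromℤ (m ℤ.* + h ℤ.+ k ℤ.* + e)
            ≡⟨ ≡.trans (fromℤ-+ (m ℤ.* + h) (k ℤ.* + e)) (≡.cong₂ ℚ._+_ (fromℤ-* m (+ h)) (fromℤ-* k (+ e))) ⟩
          fromℤ m ℚ.* fromℕ h ℚ.+ fromℤ k ℚ.* fromℕ e
            ≡⟨ ≡.cong₂ (λ a b → fromℤ m ℚ.* a ℚ.+ fromℤ k ℚ.* b) eμ*lam≡h eμ*δ≡e ⟨
          fromℤ m ℚ.* (fromℕ (eμ i) ℚ.* lam i) ℚ.+ fromℤ k ℚ.* (fromℕ (eμ i) ℚ.* δ i)
            ≡⟨ solve 5 (λ m E lam k δ → m :* (E :* lam) :+ k :* (E :* δ) := E :* (k :* δ :+ m :* lam)) ≡.refl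
                 (fromℤ m) (fromℕ (eμ i)) (lam i) (fromℤ k) (δ i) ⟩
          fromℕ (eμ i) ℚ.* (fromℤ k ℚ.* δ i ℚ.+ fromℤ m ℚ.* lam i)
            ≡⟨ ≡.cong (fromℕ (eμ i) ℚ.*_) α≡ ⟨
          fromℕ (eμ i) ℚ.* ((+ 1) / eμ i)
            ≡⟨ recip (eμ i) ⟩
          ℚ.1ℚ ∎)
        where open ≡-Reasoning

    indices-at : Indices i
    indices-at = record
      { e = e ; h = h
      -- To meet `l < e`, the coefficient of `h` is reduced modulo `e` and the quotient is moved to
      -- the coefficient of `e`.
      ; l = m ℤ.%ℕ e
      ; l′ = k ℤ.+ (m ℤ./ℕ e) ℤ.* + h
      ; e-def = λ _ → eμ≡e*eμ₋₁
      ; h-def = λ _ → eμ*lam≡h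
      ; l-def = λ _ → ≡.trans (reduced (+ (m ℤ.%ℕ e)) (m ℤ./ℕ e) (+ e) (+ h) k)
          (≡.trans (≡.cong (λ m → m ℤ.* + h ℤ.+ k ℤ.* + e) (≡.sym (ℤ.a≡a%ℕn+[a/ℕn]*n m e))) (proj₂ (proj₂ bezout)))
      ; l<e = λ _ → ℤ.n%ℕd<d m e
      }
      where
      instance
        nonZero : ℕ.NonZero e
        nonZero = e≢0
      k m : ℤ
      k = proj₁ bezout
      m = proj₁ (proj₂ bezout)
      reduced : ∀ l q e h k → l ℤ.* h ℤ.+ (k ℤ.+ q ℤ.* h) ℤ.* e ≡ (l ℤ.+ q ℤ.* e) ℤ.* h ℤ.+ k ℤ.* e
      reduced = ℤS.solve 5 (λ l q e h k → l ℤS.:* h ℤS.:+ (k ℤS.:+ q ℤS.:* h) ℤS.:* e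
        ℤS.:= (l ℤS.:+ q ℤS.:* e) ℤS.:* h ℤS.:+ k ℤS.:* e) ≡.refl
        where module ℤS = Data.Integer.Solver.+-*-Solver

  indices : ∀ i → Indices i
  indices i with i ℕ.≤? r
  ... | yes i≤r = indices-at i i≤r
  ... | no  i≰r = record
    { e = 0 ; h = 0 ; l = 0 ; l′ = + 0
    ; e-def = λ i≤r → ⊥-elim (i≰r i≤r)
    ; h-def = λ i≤r → ⊥-elim (i≰r i≤r)
    ; l-def = λ i≤r → ⊥-elim (i≰r i≤r)
    ; l<e   = λ i≤r → ⊥-elim (i≰r i≤r)
    }

  slope : ∀ i → Σ[ V ∈ ℤ ] (i ℕ.< r → fromℕ (eμ i) ·⁺ 𝕍.val (μ i) (φ (suc i)) ≡ [ fromℤ V ])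
  slope i with i ℕ.<? r
  ... | no  i≮r = + 0 , λ i<r → ⊥-elim (i≮r i<r)
  ... | yes i<r = let m , k = φ-integral i i<r
    in m , λ _ → ≡.trans (≡.cong (fromℕ (eμ i) ·⁺_) k) (≡.cong [_] (scale (eμ i) (fromℤ m) {{𝕍.e≢0 (μ i)}}))

  module _ (α : ℚ) where
    private
      module I = Indices (indices r)
      instance
        nonZero : ℕ.NonZero I.e
        nonZero = ℕ.>-nonZero (ℕ.≤-<-trans z≤n (I.l<e ℕ.≤-refl))

      -- `s` and `u` must be defined for every rational `α`. The numerator is the integer e(μᵣ)α
      -- whenever `α` lies in Γ.
      a : ℤ
      a = ℚ.↥ (fromℕ (eμ r) ℚ.* α)

      aˡ : ℤ
      aˡ = a ℤ.* + I.l

    -- Multiplying ℓh + ℓ′e = 1 by `a` gives a solution with coefficient `a * l` of `h`; reducing it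
    -- modulo `e` gives the solution with 0 ≤ s < e.
    s-of : ℕ
    s-of = aˡ ℤ.%ℕ I.e

    u-of : ℤ
    u-of = (aˡ ℤ./ℕ I.e) ℤ.* + I.h ℤ.+ a ℤ.* I.l′

    s-of<e : s-of ℕ.< I.e
    s-of<e = ℤ.n%ℕd<d aˡ I.e

    s-u-of : V.Γ r α → fromℤ u-of ℚ.* fromℕ I.e ℚ.+ fromℕ s-of ℚ.* fromℕ I.h ≡ fromℕ (eμ r) ℚ.* α
    s-u-of Γα = begin
      fromℤ u-of ℚ.* fromℕ I.e ℚ.+ fromℕ s-of ℚ.* fromℕ I.h
        ≡⟨ ≡.cong₂ ℚ._+_ (fromℤ-* u-of (+ I.e)) (fromℤ-* (+ s-of) (+ I.h)) ⟨
      fromℤ (u-of ℤ.* + I.e) ℚ.+ fromℤ (+ s-of ℤ.* + I.h)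
        ≡⟨ fromℤ-+ (u-of ℤ.* + I.e) (+ s-of ℤ.* + I.h) ⟨
      fromℤ (u-of ℤ.* + I.e ℤ.+ + s-of ℤ.* + I.h)
        ≡⟨ ≡.cong fromℤ (≡.trans (collect (aˡ ℤ./ℕ I.e) (+ I.h) a I.l′ (+ I.e) (+ s-of))
             (≡.trans (≡.cong (λ b → b ℤ.* + I.h ℤ.+ a ℤ.* (I.l′ ℤ.* + I.e)) (≡.sym (ℤ.a≡a%ℕn+[a/ℕn]*n aˡ I.e)))
             (≡.trans (factor a (+ I.l) (+ I.h) (I.l′ ℤ.* + I.e)) (≡.trans (≡.cong (a ℤ.*_) (I.l-def ℕ.≤-refl)) (ℤ.*-identityʳ a))))) ⟩
      fromℤ a
        ≡⟨ integral (Equivalence.to (𝕍.eΓ≡ℤ (μ r) α) Γα) ⟩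
      fromℕ (eμ r) ℚ.* α ∎
      where
      open ≡-Reasoning
      module ℤS = Data.Integer.Solver.+-*-Solver
      integral : (∃[ m ] fromℕ (eμ r) ℚ.* α ≡ fromℤ m) → fromℤ a ≡ fromℕ (eμ r) ℚ.* α
      integral (m , k) = ≡.trans (≡.cong fromℤ (≡.trans (≡.cong ℚ.↥_ k) (numerator-fromℤ m))) (≡.sym k)
      collect : ∀ q h a l′ e s → (q ℤ.* h ℤ.+ a ℤ.* l′) ℤ.* e ℤ.+ s ℤ.* h ≡ (s ℤ.+ q ℤ.* e) ℤ.* h ℤ.+ a ℤ.* (l′ ℤ.* e)
      collect = ℤS.solve 6 (λ q h a l′ e s → (q ℤS.:* h ℤS.:+ a ℤS.:* l′) ℤS.:* e ℤS.:+ s ℤS.:* h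
        ℤS.:= (s ℤS.:+ q ℤS.:* e) ℤS.:* h ℤS.:+ a ℤS.:* (l′ ℤS.:* e)) ≡.refl
      factor : ∀ a l h t → (a ℤ.* l) ℤ.* h ℤ.+ a ℤ.* t ≡ a ℤ.* (l ℤ.* h ℤ.+ t)
      factor = ℤS.solve 4 (λ a l h t → (a ℤS.:* l) ℤS.:* h ℤS.:+ a ℤS.:* t ℤS.:= a ℤS.:* (l ℤS.:* h ℤS.:+ t)) ≡.refl

module GradedUnits {c ℓ : Level} {R : CommutativeRing c ℓ} (V : Valuation R) where
  open ValuationProperties V
  open GradedProperties V
  open GradedRing V using (H; gradedRing)
  open Units gradedRing using (IsUnit)
  open Gr using (_≈_; _*_)

  H-unit : ∀ {f} → IsUnitMod⁺ f → IsUnit (H f)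
  H-unit {f} (g , h) = H g , Gr.trans (Gr.*-comm (H g) (H f)) Hf*Hg≈1 , Hf*Hg≈1
    where
    Hf*Hg≈1 : H f * H g ≈ Gr.1#
    Hf*Hg≈1 = Gr.trans (Gr.sym (H-* f g)) (Gr.trans (H-∼ {f = CommutativeRing._*_ R f g} val-1# h)
      (class-unique (H-class val-1#) 1-class (∼-refl (CommutativeRing.refl R))))

-- Existence of the chain data.

module ChainDataExists {c ℓ : Level} {K : Field c ℓ} (v : DiscreteValuation K) (π : Field.Carrier K)
  (uniformizer : DiscreteValuation.IsUniformizer v π) {r : ℕ} (chain : MacLaneChain v r) where

  private module K = Field K
  open MacLaneChain chain
  open Chain v π uniformizer chain
  open Arithmetic v π uniformizer chain
  open Polynomial K.commutativeRing
  open DegreeBound K.commutativeRing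

  record Persists (k j : ℕ) : Set (c ⊔ ℓ) where
    field
      value : ∀ {β} → V.val k (φ k) ≡ [ β ] → V.val j (φ k) ≡ [ β ]
      unit  : k ℕ.< j → V.IsUnitMod⁺ j (φ k)

  -- `Successor` makes φₖ a unit of unchanged value at stage k + 1; from then on a unit stays a unit
  -- and keeps its value.
  φ-persists : ∀ k j → 1 ℕ.≤ k → k ℕ.≤ j → j ℕ.≤ r → Persists k j
  φ-persists k zero    1≤k k≤j _ = ⊥-elim (ℕ.<-irrefl ≡.refl (ℕ.≤-trans 1≤k k≤j))
  φ-persists k (suc j) 1≤k k≤j j<r with ℕ.m≤n⇒m<n∨m≡n k≤j
  ... | inj₂ ≡.refl = record { value = λ e → e ; unit = λ k<k → ⊥-elim (ℕ.<-irrefl ≡.refl k<k) }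
  ... | inj₁ (s≤s k≤j′) with ℕ.m≤n⇒m<n∨m≡n k≤j′
  ...   | inj₁ k<j = record
    { value = λ e → val-unit-≤ {φ k} (Persists.unit before k<j) (Persists.value before e)
    ; unit  = λ _ → unit-≤ {φ k} (Persists.unit before k<j)
    }
    where
    open Aug j j<r using (unit-≤; val-unit-≤)
    before : Persists k j
    before = φ-persists k j 1≤k k≤j′ (ℕ.<⇒≤ j<r)
  φ-persists (suc k) (suc .(suc k)) 1≤k k≤j j<r | inj₁ (s≤s k≤j′) | inj₂ ≡.refl =
    record { value = proj₂ unit-φ ; unit = λ _ → proj₁ unit-φ }
    where open Succ k j<r (stage (suc k) (ℕ.<⇒≤ j<r)) using (unit-φ)

  π-unit : V.IsUnitMod⁺ r (constant π)
  π-unit = let w , _ , h = K.inverse π (ValuationProperties.val≢⊤ (DiscreteValuation.valuation v) val-π)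
    in constant w , V.∼-refl r {f = constant π * constant w} (shift-cong (K.trans (K.+-identityʳ _) h) ≈-refl)

  chainData : ChainData v π chain
  chainData = record
    { e = λ i → Indices.e (indices i)
    ; h = λ i → Indices.h (indices i)
    ; l = λ i → Indices.l (indices i)
    ; l′ = λ i → Indices.l′ (indices i)
    -- The equations for V begin at index 1, so the entry at 0 is a filler.
    ; V = λ { zero → + 0 ; (suc i) → proj₁ (slope i) }
    ; e-def = λ i → Indices.e-def (indices i)
    ; h-def = λ i → Indices.h-def (indices i)
    ; V-def = λ i → proj₂ (slope i)
    ; l-def = λ i → Indices.l-def (indices i)
    ; l<e = λ i → Indices.l<e (indices i)
    ; s = s-of
    ; u = u-of
    ; s-u-def = s-u-of
    ; s<e = λ α _ → s-of<e α
    ; π-unit = GradedUnits.H-unit (V r) {constant π} π-unit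
    ; φ-unit = λ k 1≤k k<r → GradedUnits.H-unit (V r) {φ k} (Persists.unit (φ-persists k r 1≤k (ℕ.<⇒≤ k<r) ℕ.≤-refl) k<r)
    }

-- Degrees of the distinguished elements.

module Degrees {c ℓ : Level} {K : Field c ℓ} (v : DiscreteValuation K) (π : Field.Carrier K)
  (uniformizer : DiscreteValuation.IsUniformizer v π) {r : ℕ} (chain : MacLaneChain v r) (d : ChainData v π chain) where

  private module K = Field K
  open MacLaneChain chain
  open Chain v π uniformizer chain
  open ChainDataExists v π uniformizer chain using (Persists; φ-persists)
  open Polynomial K.commutativeRing using (constant)
  open DegreeBound K.commutativeRing
  module d = ChainData d
  module S = Stage (stage r ℕ.≤-refl)
  open GradedRing (𝕍.valuation (μ r)) using (Gr; H; gradedRing)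
  open GradedProperties (𝕍.valuation (μ r))
  open Homogeneity {V = 𝕍.valuation (μ r)} S.adapted public
  open Units gradedRing
  open +-*-Solver using (solve; _:=_; _:+_; _:*_; _:-_; :-_; con)

  ⁻¹-small : ∀ {α} (w : Unit) → IsSmallClass α (proj₁ w) → IsSmallClass (ℚ.- α) (proj₁ (w ⁻¹))
  ⁻¹-small (a , b , _ , ab≈1) h = small-class-inverse h ab≈1

  ^ᵘ-small : ∀ {α} {w : Unit} n → IsSmallClass α (proj₁ w) → IsSmallClass (fromℕ n ℚ.* α) (proj₁ (w ^ᵘ n))
  ^ᵘ-small {α} zero    h = small-class-degree (≡.sym (ℚ.*-zeroˡ α)) small-class-1
  ^ᵘ-small {α} (suc n) h = small-class-degree (≡.trans
    (solve 2 (λ n q → q :+ n :* q := (con ℚ.1ℚ :+ n) :* q) ≡.refl (fromℕ n) α)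
    (≡.cong (ℚ._* α) (≡.sym (fromℕ-suc n)))) (small-class-* h (^ᵘ-small n h))

  ^ᶻ-small : ∀ {α} {w : Unit} n → IsSmallClass α (proj₁ w) → IsSmallClass (fromℤ n ℚ.* α) (proj₁ (w ^ᶻ n))
  ^ᶻ-small         (+ n)    h = ^ᵘ-small n h
  ^ᶻ-small {α} {w} -[1+ n ] h = small-class-degree
    (≡.trans (solve 2 (λ n δ → n :* (:- δ) := (:- n) :* δ) ≡.refl (fromℕ (suc n)) α) (≡.cong (ℚ._* α) (≡.sym (fromℤ-neg (+ suc n)))))
    (^ᵘ-small (suc n) (⁻¹-small w h))

  private
    ·⁺-cancel : ∀ n .{{_ : ℕ.NonZero n}} {w q} → fromℕ n ·⁺ w ≡ [ q ] → w ≡ [ q ℚ.* ((+ 1) / n) ]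
    ·⁺-cancel n {[ p ]} h = ≡.cong [_] (scale-cancel {n} p ([]-injective h))

    -- The degree of πᵢ₊₁ = Φᵢ^ℓ πᵢ^ℓ′. The multiples of V cancel, as Φᵢ has degree λᵢ, and ℓλ + ℓ′δ
    -- = (ℓh + ℓ′e)/E.
    bezout-degree : ∀ E .{{_ : ℕ.NonZero E}} l l′ e h V δ lam →
      fromℕ E ℚ.* δ ≡ fromℕ e → fromℕ E ℚ.* lam ≡ fromℕ h → + l ℤ.* + h ℤ.+ l′ ℤ.* + e ≡ ℤ.1ℤ →
      fromℕ l ℚ.* ((fromℤ V ℚ.* δ ℚ.+ lam) ℚ.+ fromℤ (ℤ.- V) ℚ.* δ) ℚ.+ fromℤ l′ ℚ.* δ ≡ (+ 1) / E
    bezout-degree E l l′ e h V δ lam Eδ≡e Elam≡h lh+l′e≡1 = ≡.trans (≡.trans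
      (≡.cong (λ q → fromℕ l ℚ.* ((fromℤ V ℚ.* δ ℚ.+ lam) ℚ.+ q ℚ.* δ) ℚ.+ fromℤ l′ ℚ.* δ) (fromℤ-neg V))
      (solve 5 (λ l V δ lam l′ → l :* ((V :* δ :+ lam) :+ (:- V) :* δ) :+ l′ :* δ := l :* lam :+ l′ :* δ) ≡.refl
        (fromℕ l) (fromℤ V) δ lam (fromℤ l′)))
      (≡.trans (scale-cancel {E} (fromℕ l ℚ.* lam ℚ.+ fromℤ l′ ℚ.* δ) scaled) (ℚ.*-identityˡ ((+ 1) / E)))
      where
      open ≡-Reasoning
      scaled : fromℕ E ℚ.* (fromℕ l ℚ.* lam ℚ.+ fromℤ l′ ℚ.* δ) ≡ ℚ.1ℚ
      scaled = begin
        fromℕ E ℚ.* (fromℕ l ℚ.* lam ℚ.+ fromℤ l′ ℚ.* δ)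
          ≡⟨ solve 5 (λ E l δ lam l′ → E :* (l :* lam :+ l′ :* δ) := l :* (E :* lam) :+ l′ :* (E :* δ)) ≡.refl
               (fromℕ E) (fromℕ l) δ lam (fromℤ l′) ⟩
        fromℕ l ℚ.* (fromℕ E ℚ.* lam) ℚ.+ fromℤ l′ ℚ.* (fromℕ E ℚ.* δ)
          ≡⟨ ≡.cong₂ (λ a b → fromℕ l ℚ.* a ℚ.+ fromℤ l′ ℚ.* b) Elam≡h Eδ≡e ⟩
        fromℕ l ℚ.* fromℕ h ℚ.+ fromℤ l′ ℚ.* fromℕ e
          ≡⟨ ≡.cong₂ ℚ._+_ (fromℤ-* (+ l) (+ h)) (fromℤ-* l′ (+ e)) ⟨
        fromℤ (+ l ℤ.* + h) ℚ.+ fromℤ (l′ ℤ.* + e)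
          ≡⟨ fromℤ-+ (+ l ℤ.* + h) (l′ ℤ.* + e) ⟨
        fromℤ (+ l ℤ.* + h ℤ.+ l′ ℤ.* + e)
          ≡⟨ ≡.cong fromℤ lh+l′e≡1 ⟩
        ℚ.1ℚ ∎

  φ-value : ∀ i → i ℕ.< r → V.val (suc i) (φ (suc i)) ≡ [ fromℤ (d.V (suc i)) ℚ.* δ (suc i) ℚ.+ lam (suc i) ]
  φ-value i i<r = Aug.val-φ i i<r (·⁺-cancel (eμ i) {{𝕍.e≢0 (μ i)}} (d.V-def i i<r))

  private
    before-φ : ∀ i k {β} → i ℕ.≤ r → 1 ℕ.≤ k → k ℕ.< i → V.val k (φ k) ≡ [ β ] → Before i (φ k) β
    before-φ (suc j) k j<r 1≤k (s≤s k≤j) e =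
      lift (V.val⇒𝒫 j {f = φ k} (Persists.value (φ-persists k j 1≤k k≤j (ℕ.<⇒≤ j<r)) e))

  -- φₖ may have the same degree as φᵣ and then is not small; its remainder modulo φᵣ represents the
  -- same class.
  Hφ-small : ∀ k {β} → 1 ℕ.≤ k → k ℕ.< r → V.val k (φ k) ≡ [ β ] → IsSmallClass β (H (φ k))
  Hφ-small k 1≤k k<r e =
    let val-φ = Persists.value (φ-persists k r 1≤k (ℕ.<⇒≤ k<r) ℕ.≤-refl) e
        a , a≺ , φ∼a = S.reduce {φ k} (before-φ r k ℕ.≤-refl 1≤k k<r e)
    in smallClass a≺ (V.∼-val r {f = a} {g = φ k} (V.∼-sym r {f = φ k} {g = a} φ∼a) val-φ) (class-∼ (H-class val-φ) φ∼a)

  Hconstant-π-small : IsSmallClass ℚ.1ℚ (H (constant π))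
  Hconstant-π-small = small-H (≺-mono S.0<n (≺-constant π)) (≡.trans (𝕍.extends (μ r) π) val-π)

  eδ : ∀ i → i ℕ.≤ r → fromℕ (eμ i) ℚ.* δ i ≡ fromℕ (d.e i)
  eδ i i≤r = multiple-scale (d.e i) (eμ₋₁ i) {{eμ₋₁≢0 i}} (d.e-def i i≤r)

  Hπ-small : ∀ i (i≤r : i ℕ.≤ r) → IsSmallClass (δ i) (proj₁ (d.Hπ i i≤r))
  Hπ-small zero          _   = small-class-degree (≡.sym δ-0) Hconstant-π-small
  Hπ-small (suc zero)    _   = small-class-degree (≡.sym δ-0) Hconstant-π-small
  Hπ-small (suc (suc i)) i<r = small-class-degree degrees (small-class-*
    {fromℕ (d.l (suc i)) ℚ.* ((fromℤ (d.V (suc i)) ℚ.* δ (suc i) ℚ.+ lam (suc i)) ℚ.+ fromℤ (ℤ.- d.V (suc i)) ℚ.* δ (suc i))}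
    {fromℤ (d.l′ (suc i)) ℚ.* δ (suc i)}
    (^ᵘ-small (d.l (suc i)) (small-class-* {fromℤ (d.V (suc i)) ℚ.* δ (suc i) ℚ.+ lam (suc i)} {fromℤ (ℤ.- d.V (suc i)) ℚ.* δ (suc i)}
      (Hφ-small (suc i) (s≤s z≤n) i<r (φ-value i (ℕ.<⇒≤ i<r)))
      (^ᶻ-small (ℤ.- d.V (suc i)) (Hπ-small (suc i) (ℕ.<⇒≤ i<r)))))
    (^ᶻ-small (d.l′ (suc i)) (Hπ-small (suc i) (ℕ.<⇒≤ i<r))))
    where
    degrees : fromℕ (d.l (suc i)) ℚ.* ((fromℤ (d.V (suc i)) ℚ.* δ (suc i) ℚ.+ lam (suc i)) ℚ.+ fromℤ (ℤ.- d.V (suc i)) ℚ.* δ (suc i))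
      ℚ.+ fromℤ (d.l′ (suc i)) ℚ.* δ (suc i) ≡ δ (suc (suc i))
    degrees = bezout-degree (eμ (suc i)) {{𝕍.e≢0 (μ (suc i))}} (d.l (suc i)) (d.l′ (suc i)) (d.e (suc i)) (d.h (suc i)) (d.V (suc i))
      (δ (suc i)) (lam (suc i)) (eδ (suc i) (ℕ.<⇒≤ i<r)) (d.h-def (suc i) (ℕ.<⇒≤ i<r)) (d.l-def (suc i) (ℕ.<⇒≤ i<r))

  -- `IsGenerator` with a free index in place of `r`: Φ is defined by cases on the index, while the
  -- graded ring stays that of μᵣ.
  record Generates (i : ℕ) (x : Gr) : Set (c ⊔ ℓ) where
    field
      {β γ}     : ℚ
      {g g⁻¹}   : Gr
      val-φ     : V.val i (φ i) ≡ [ β ]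
      g-small   : IsSmallClass γ g
      g*g⁻¹≈1   : g Gr.* g⁻¹ Gr.≈ Gr.1#
      x≈φ*g     : x Gr.≈ H (φ i) Gr.* g
      lam≡      : lam i ≡ β ℚ.+ γ

  HΦ-generates : ∀ i (i≤r : i ℕ.≤ r) → Generates i (d.HΦ i i≤r)
  HΦ-generates zero    _   = record
    { val-φ = Gauss.val-φ v (μ 0) μ-0 (φ 0) φ-0 ; g = Gr.1# ; g⁻¹ = Gr.1# ; g-small = small-class-1
    ; g*g⁻¹≈1 = Gr.*-identityˡ Gr.1# ; x≈φ*g = Gr.sym (Gr.*-identityʳ (H (φ 0)))
    ; lam≡ = ≡.trans lam-0 (≡.sym (ℚ.+-identityˡ 0ℚ)) }
  HΦ-generates (suc i) i<r = record
    { val-φ = φ-value i i<r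
    ; g = proj₁ (d.Hπ (suc i) i<r ^ᶻ (ℤ.- d.V (suc i)))
    ; g⁻¹ = proj₁ (proj₂ (d.Hπ (suc i) i<r ^ᶻ (ℤ.- d.V (suc i))))
    ; g-small = ^ᶻ-small {w = d.Hπ (suc i) i<r} (ℤ.- d.V (suc i)) (Hπ-small (suc i) i<r)
    ; g*g⁻¹≈1 = proj₂ (proj₂ (proj₂ (d.Hπ (suc i) i<r ^ᶻ (ℤ.- d.V (suc i)))))
    ; x≈φ*g = Gr.refl
    ; lam≡ = ≡.trans (solve 3 (λ V δ lam → lam := (V :* δ :+ lam) :+ (:- V) :* δ) ≡.refl (fromℤ (d.V (suc i))) (δ (suc i)) (lam (suc i)))
        (≡.cong (λ q → (fromℤ (d.V (suc i)) ℚ.* δ (suc i) ℚ.+ lam (suc i)) ℚ.+ q ℚ.* δ (suc i)) (≡.sym (fromℤ-neg (d.V (suc i)))))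
    }

  private
    module Gen = Generates (HΦ-generates r ℕ.≤-refl)

  generator : IsGenerator Gen.β Gen.γ (lam r) d.xᵣ Gen.g Gen.g⁻¹
  generator = record
    { val-φ = Gen.val-φ ; d-small = Gen.g-small ; d*d⁻¹≈1 = Gen.g*g⁻¹≈1 ; x≈φ*d = Gen.x≈φ*g ; lam≡ = Gen.lam≡ }

  eλ≡hδ : fromℕ (d.e r) ℚ.* lam r ≡ fromℕ (d.h r) ℚ.* δ r
  eλ≡hδ = ≡.trans (≡.cong (ℚ._* lam r) (≡.sym (eδ r ℕ.≤-refl)))
    (≡.trans (solve 3 (λ E δ lam → (E :* δ) :* lam := (E :* lam) :* δ) ≡.refl (fromℕ (eμ r)) (δ r) (lam r))
      (≡.cong (ℚ._* δ r) (d.h-def r ℕ.≤-refl)))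

  module _ {α : ℚ} (Γα : V.Γ r α) where
    private
      instance
        eμ≢0 : ℕ.NonZero (eμ r)
        eμ≢0 = 𝕍.e≢0 (μ r)

      E : ℚ
      E = fromℕ (eμ r)

      combination : ∀ n m → E ℚ.* (fromℕ n ℚ.* lam r ℚ.+ fromℤ m ℚ.* δ r) ≡ fromℤ (m ℤ.* + d.e r ℤ.+ + n ℤ.* + d.h r)
      combination n m = begin
        E ℚ.* (fromℕ n ℚ.* lam r ℚ.+ fromℤ m ℚ.* δ r)
          ≡⟨ solve 5 (λ E n lam m δ → E :* (n :* lam :+ m :* δ) := m :* (E :* δ) :+ n :* (E :* lam)) ≡.refl
               E (fromℕ n) (lam r) (fromℤ m) (δ r) ⟩
        fromℤ m ℚ.* (E ℚ.* δ r) ℚ.+ fromℕ n ℚ.* (E ℚ.* lam r)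
          ≡⟨ ≡.cong₂ (λ a b → fromℤ m ℚ.* a ℚ.+ fromℕ n ℚ.* b) (eδ r ℕ.≤-refl) (d.h-def r ℕ.≤-refl) ⟩
        fromℤ m ℚ.* fromℕ (d.e r) ℚ.+ fromℕ n ℚ.* fromℕ (d.h r)
          ≡⟨ ≡.cong₂ ℚ._+_ (fromℤ-* m (+ d.e r)) (fromℤ-* (+ n) (+ d.h r)) ⟨
        fromℤ (m ℤ.* + d.e r) ℚ.+ fromℤ (+ n ℤ.* + d.h r)
          ≡⟨ fromℤ-+ (m ℤ.* + d.e r) (+ n ℤ.* + d.h r) ⟨
        fromℤ (m ℤ.* + d.e r ℤ.+ + n ℤ.* + d.h r) ∎
        where open ≡-Reasoning

      s-u : E ℚ.* α ≡ fromℤ (d.u α ℤ.* + d.e r ℤ.+ + d.s α ℤ.* + d.h r)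
      s-u = ≡.trans (≡.sym (d.s-u-def α Γα)) (≡.sym (≡.trans (fromℤ-+ (d.u α ℤ.* + d.e r) (+ d.s α ℤ.* + d.h r))
        (≡.cong₂ ℚ._+_ (fromℤ-* (d.u α) (+ d.e r)) (fromℤ-* (+ d.s α) (+ d.h r)))))

    degree-φᵣ : fromℕ (d.s α) ℚ.* lam r ℚ.+ fromℤ (d.u α) ℚ.* δ r ≡ α
    degree-φᵣ = scale-injective (eμ r) (fromℕ (d.s α) ℚ.* lam r ℚ.+ fromℤ (d.u α) ℚ.* δ r) α
      (≡.trans (combination (d.s α) (d.u α)) (≡.sym s-u))

    -- h is invertible modulo e, so n h + m e = s h + u e forces n ≡ s modulo e.
    s-least : ∀ n {z} → IsSmallClass (α ℚ.- fromℕ n ℚ.* lam r) z → d.s α ℕ.≤ n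
    s-least n k =
      let m , degree≡ = S.small-val (IsSmallClass.small k) (IsSmallClass.val-f k)
          α≡ : α ≡ fromℕ n ℚ.* lam r ℚ.+ fromℤ m ℚ.* δ r
          α≡ = ≡.trans (solve 2 (λ α t → α := t :+ (α :- t)) ≡.refl α (fromℕ n ℚ.* lam r)) (≡.cong (fromℕ n ℚ.* lam r ℚ.+_) degree≡)
      in least (d.u α ℤ.- m) (congruent m (fromℤ-injective _ (d.u α ℤ.* + d.e r ℤ.+ + d.s α ℤ.* + d.h r)
           (≡.trans (≡.sym (combination n m)) (≡.trans (≡.cong (E ℚ.*_) (≡.sym α≡)) s-u))))
      where
      module ℤS = Data.Integer.Solver.+-*-Solver
      e h l l′ : ℤ
      e = + d.e r
      h = + d.h r
      l = + d.l r
      l′ = d.l′ r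
      s : ℕ
      s = d.s α
      q : ℤ → ℤ
      q t = l ℤ.* t ℤ.+ (+ n ℤ.- + s) ℤ.* l′
      congruent : ∀ m → m ℤ.* e ℤ.+ + n ℤ.* h ≡ d.u α ℤ.* e ℤ.+ + s ℤ.* h → + n ≡ + s ℤ.+ q (d.u α ℤ.- m) ℤ.* e
      congruent m k = begin
        + n
          ≡⟨ ℤS.solve 2 (λ n s → n ℤS.:= s ℤS.:+ (n ℤS.:- s) ℤS.:* ℤS.con ℤ.1ℤ) ≡.refl (+ n) (+ s) ⟩
        + s ℤ.+ (+ n ℤ.- + s) ℤ.* ℤ.1ℤ
          ≡⟨ ≡.cong (λ t → + s ℤ.+ (+ n ℤ.- + s) ℤ.* t) (≡.sym (d.l-def r ℕ.≤-refl)) ⟩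
        + s ℤ.+ (+ n ℤ.- + s) ℤ.* (l ℤ.* h ℤ.+ l′ ℤ.* e)
          ≡⟨ ℤS.solve 7 (λ n s l h l′ e m → s ℤS.:+ (n ℤS.:- s) ℤS.:* (l ℤS.:* h ℤS.:+ l′ ℤS.:* e) ℤS.:=
               s ℤS.:+ (l ℤS.:* ((m ℤS.:* e ℤS.:+ n ℤS.:* h) ℤS.:- (m ℤS.:* e ℤS.:+ s ℤS.:* h)) ℤS.:+ (n ℤS.:- s) ℤS.:* l′ ℤS.:* e)) ≡.refl
               (+ n) (+ s) l h l′ e m ⟩
        + s ℤ.+ (l ℤ.* ((m ℤ.* e ℤ.+ + n ℤ.* h) ℤ.- (m ℤ.* e ℤ.+ + s ℤ.* h)) ℤ.+ (+ n ℤ.- + s) ℤ.* l′ ℤ.* e)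
          ≡⟨ ≡.cong (λ t → + s ℤ.+ (l ℤ.* (t ℤ.- (m ℤ.* e ℤ.+ + s ℤ.* h)) ℤ.+ (+ n ℤ.- + s) ℤ.* l′ ℤ.* e)) k ⟩
        + s ℤ.+ (l ℤ.* ((d.u α ℤ.* e ℤ.+ + s ℤ.* h) ℤ.- (m ℤ.* e ℤ.+ + s ℤ.* h)) ℤ.+ (+ n ℤ.- + s) ℤ.* l′ ℤ.* e)
          ≡⟨ ℤS.solve 8 (λ n s l h l′ e m u → s ℤS.:+ (l ℤS.:* ((u ℤS.:* e ℤS.:+ s ℤS.:* h) ℤS.:- (m ℤS.:* e ℤS.:+ s ℤS.:* h)) ℤS.:+ (n ℤS.:- s) ℤS.:* l′ ℤS.:* e) ℤS.:=
               s ℤS.:+ (l ℤS.:* (u ℤS.:- m) ℤS.:+ (n ℤS.:- s) ℤS.:* l′) ℤS.:* e) ≡.refl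
               (+ n) (+ s) l h l′ e m (d.u α) ⟩
        + s ℤ.+ q (d.u α ℤ.- m) ℤ.* e ∎
        where open ≡-Reasoning
      least : ∀ t → + n ≡ + s ℤ.+ q t ℤ.* e → s ℕ.≤ n
      least t k with q t
      ... | + j      = ≡.subst (s ℕ.≤_) (≡.sym (ℤ.+-injective (≡.trans k (≡.trans (≡.cong (λ t → + s ℤ.+ t) (≡.sym (ℤ.pos-* j (d.e r)))) (≡.sym (ℤ.pos-+ s (j ℕ.* d.e r)))))))
        (ℕ.m≤m+n s (j ℕ.* d.e r))
      -- A negative quotient would give `s = n + (j + 1) e`, which is at least `e`.
      ... | -[1+ j ] = ⊥-elim (ℕ.<-irrefl ≡.refl (ℕ.<-≤-trans (d.s<e α Γα) (ℕ.≤-trans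
        (ℕ.≤-trans (ℕ.m≤m+n (d.e r) (j ℕ.* d.e r)) (ℕ.m≤n+m (suc j ℕ.* d.e r) n)) (ℕ.≤-reflexive sum))))
        where
        sum : n ℕ.+ suc j ℕ.* d.e r ≡ s
        sum = ℤ.+-injective (≡.trans (ℤ.pos-+ n (suc j ℕ.* d.e r)) (≡.trans (≡.cong₂ ℤ._+_ k (ℤ.pos-* (suc j) (d.e r)))
          (ℤS.solve 3 (λ s j e → (s ℤS.:+ (ℤS.:- j) ℤS.:* e) ℤS.:+ j ℤS.:* e ℤS.:= s) ≡.refl (+ s) (+ suc j) e)))

-- The coefficient field and the conclusion.

module ResidueEmbedding {c ℓ c′ ℓ′ : Level} {R : CommutativeRing c ℓ} {S : CommutativeRing c′ ℓ′} (V : Valuation R) (W : Valuation S)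
  (f : CommutativeRing.Carrier R → CommutativeRing.Carrier S)
  (f-homo : IsRingHomomorphism (CommutativeRing.rawRing R) (CommutativeRing.rawRing S) f) where

  open ResidueImage V W f f-homo using (image)
  open GradedRing W using (gradedRing; degree₀)
  open GradedProperties W
  open ValuationProperties W
  private
    module S = CommutativeRing S
    module I = CommutativeRing image

    minus-0 : ∀ x → x S.- S.0# S.≈ x
    minus-0 x = S.trans (S.+-congˡ (RingFacts.-0#≈0# S)) (S.+-identityʳ x)

  embedding : RingHom image gradedRing
  embedding = record
    { ⟦_⟧    = λ b → degree₀ (proj₁ b)
    ; cong   = λ { {x} {y} (modulo (modulo h)) → class-unique (degree₀-class (proj₁ x)) (degree₀-class (proj₁ y))
        (𝒫⁺-resp (minus-0 _) h) }
    ; +-homo = λ x y → class-unique (degree₀-class (proj₁ (x I.+ y)))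
        (class-+ (degree₀-class (proj₁ x)) (degree₀-class (proj₁ y))) (∼-refl S.refl)
    ; *-homo = λ x y → class-unique (degree₀-class (proj₁ (x I.* y)))
        (class-degree (ℚ.+-identityˡ 0ℚ) (class-* (degree₀-class (proj₁ x)) (degree₀-class (proj₁ y)))) (∼-refl S.refl)
    ; 1-homo = class-unique (degree₀-class (proj₁ I.1#)) 1-class (∼-refl S.refl)
    }

  embedding-injective : ∀ b → RingHom.⟦_⟧ embedding b Gr.≈ [] → b I.≈ I.0#
  embedding-injective b h = modulo (modulo (𝒫⁺-resp (S.trans (S.sym (minus-0 _)) (S.+-congʳ (S.sym (minus-0 _))))
    (∼-𝒫⁺ (∼-sym (class-component (degree₀-class (proj₁ b)))) (≈[]⇒ 0ℚ h))))

presentedAlgebra-isPresentation : ∀ {c ℓ : Level} {K : Field c ℓ} {v : DiscreteValuation K} {π : Field.Carrier K} {r : ℕ}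
  (chain : MacLaneChain v r) (d : ChainData v π chain) →
  IsPresentation {F = MacLaneChain.𝔽 chain r} (ChainData.presentedAlgebra d) (ChainData.e d r) (ChainData.h d r)
    (((+ 1) / MacLaneChain.eμ₋₁ chain r) {{MacLaneChain.eμ₋₁≢0 chain r}}) (MacLaneChain.lam chain r)
presentedAlgebra-isPresentation chain d = presentation ≡.refl

module _ {c ℓ : Level} {K : Field c ℓ} (v : DiscreteValuation K) (π : Field.Carrier K)
  (uniformizer : DiscreteValuation.IsUniformizer v π) {r : ℕ} (chain : MacLaneChain v r) (d : ChainData v π chain) where

  private
    module K = Field K
    module D = Degrees v π uniformizer chain d
  open GradedProperties (𝕍.valuation (MacLaneChain.μ chain r))
  open DegreeBound K.commutativeRing

  -- GrAlgebra≡ holds by computation only after a case distinction on r.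
  record CoefficientField : Set (lsuc c ⊔ lsuc ℓ) where
    field
      ι           : RingHom (MacLaneChain.𝔽 chain r) (GradedRing.gradedRing (𝕍.valuation (MacLaneChain.μ chain r)))
      ι-injective : ∀ k → RingHom.⟦_⟧ ι k Gr.≈ [] →
        CommutativeRing._≈_ (MacLaneChain.𝔽 chain r) k (CommutativeRing.0# (MacLaneChain.𝔽 chain r))
      ι-class     : ∀ k → ∃[ a ] a ≺ D.S.n × IsClass 0ℚ a (RingHom.⟦_⟧ ι k)
      class-ι     : ∀ {a b} → a ≺ D.S.n → IsClass 0ℚ a b → ∃[ k ] RingHom.⟦_⟧ ι k Gr.≈ b
      GrAlgebra≡  : ChainData.GrAlgebra d ≡ record
        { commutativeRing = GradedRing.gradedRing (𝕍.valuation (MacLaneChain.μ chain r))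
        ; algebraMap      = RingHom.⟦_⟧ ι
        ; Homogeneous     = GradedRing.Homogeneous (𝕍.valuation (MacLaneChain.μ chain r))
        }

  module Presented (coefficients : CoefficientField) where

    open CoefficientField coefficients
    open GradedRing (𝕍.valuation (MacLaneChain.μ chain r)) using (gradedRing)
    open Units gradedRing
    private
      module d = ChainData d
      p p⁻¹ x : Gr.Carrier
      p   = proj₁ d.pᵣ
      p⁻¹ = proj₁ (proj₂ d.pᵣ)
      x   = d.xᵣ

      p*p⁻¹≈1 : p Gr.* p⁻¹ Gr.≈ Gr.1#
      p*p⁻¹≈1 = proj₂ (proj₂ (proj₂ d.pᵣ))

      coordinates : Coordinates D.S.adapted ι
        (((+ 1) / MacLaneChain.eμ₋₁ chain r) {{MacLaneChain.eμ₋₁≢0 chain r}}) (MacLaneChain.lam chain r)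
      coordinates = record
        { ι-injective = ι-injective ; ι-class = ι-class ; class-ι = class-ι
        ; 0<δ = 0<recip (MacLaneChain.eμ₋₁ chain r) {{MacLaneChain.eμ₋₁≢0 chain r}}
        ; p = p ; p⁻¹ = p⁻¹ ; p-small = D.Hπ-small r ℕ.≤-refl ; p*p⁻¹≈1 = p*p⁻¹≈1
        ; small-val = D.S.small-val ; x = x ; generator = D.generator
        }

    Gr≡⨁φᵣΔ : d.Gr≡⨁φᵣΔ
    Gr≡⨁φᵣΔ α Γα a = mk⇔
      (Structure.multiple-of-homogeneous D.S.adapted coordinates (d.s α) u-small u*u⁻¹≈1 (D.degree-φᵣ Γα) Γα (D.s-least Γα) a)
      (λ { (δ , a≈) → pure⇒homogeneous (pure-resp (Gr.sym a≈) (homogeneous⇒pure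
        (Structure.homogeneous-multiple D.S.adapted coordinates
          (d.s α) u-small u*u⁻¹≈1 (D.degree-φᵣ Γα) Γα (D.s-least Γα) δ))) })
      where
      u-small : D.IsSmallClass (fromℤ (d.u α) ℚ.* ((+ 1) / MacLaneChain.eμ₋₁ chain r) {{MacLaneChain.eμ₋₁≢0 chain r}}) (proj₁ (d.pᵣ ^ᶻ d.u α))
      u-small = D.^ᶻ-small {w = d.pᵣ} (d.u α) (D.Hπ-small r ℕ.≤-refl)
      u*u⁻¹≈1 : proj₁ (d.pᵣ ^ᶻ d.u α) Gr.* proj₁ (proj₂ (d.pᵣ ^ᶻ d.u α)) Gr.≈ Gr.1#
      u*u⁻¹≈1 = proj₂ (proj₂ (proj₂ (d.pᵣ ^ᶻ d.u α)))

    conclusion : ChainData.Gr≡⨁φᵣΔ d × GradedIsomorphism (ChainData.GrAlgebra d) (ChainData.presentedAlgebra d)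
    conclusion = Gr≡⨁φᵣΔ , StructurePresentation.isomorphic-to D.S.adapted coordinates (ChainData.e d r) (ChainData.h d r) D.eλ≡hδ
      (ChainData.GrAlgebra d) (ChainData.presentedAlgebra d) GrAlgebra≡ (presentedAlgebra-isPresentation chain d)

coefficients-0 : ∀ {c ℓ : Level} {K : Field c ℓ} (v : DiscreteValuation K) (π : Field.Carrier K)
  (uniformizer : DiscreteValuation.IsUniformizer v π) (chain : MacLaneChain v 0) (d : ChainData v π chain) → CoefficientField v π uniformizer chain d
coefficients-0 {K = K} v π uniformizer chain d = record
  { ι = ι ; ι-injective = E.embedding-injective ; ι-class = ι-class ; class-ι = class-ι ; GrAlgebra≡ = ≡.refl }
  where
  open Polynomial (Field.commutativeRing K)
  open DegreeBound (Field.commutativeRing K)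
  open GradedProperties (𝕍.valuation (MacLaneChain.μ chain 0))

  module v = ValuationProperties (DiscreteValuation.valuation v)
  module V = ValuationProperties (𝕍.valuation (MacLaneChain.μ chain 0))
  module E = ResidueEmbedding (DiscreteValuation.valuation v) (𝕍.valuation (MacLaneChain.μ chain 0)) constant constant-isRingHomomorphism

  ι : RingHom (MacLaneChain.𝔽 chain 0) (GradedRing.gradedRing (𝕍.valuation (MacLaneChain.μ chain 0)))
  ι = E.embedding

  ι-class : ∀ k → ∃[ a ] a ≺ 1 × IsClass 0ℚ a (RingHom.⟦_⟧ ι k)
  ι-class (g , (a , _) , h) = constant a , ≺-constant a , class-∼ (degree₀-class g) (V.∼-sym {f = constant a} {g = proj₁ g} h)

  class-ι : ∀ {a b} → a ≺ 1 → IsClass 0ℚ a b → ∃[ k ] RingHom.⟦_⟧ ι k Gr.≈ b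
  class-ι {a} s h with class-degree₀ h
  ... | g , b≈ , ≡.refl = (g , (coeff a 0 , a∈) , V.∼-refl {f = constant (coeff a 0)} {g = a} (≈-sym (≺1⇒≈constant s))) , Gr.sym b≈
    where
    a∈ : coeff a 0 v.∈𝒫 0ℚ
    a∈ = ≡.subst (λ w → [ 0ℚ ] ≤⁺ w) (𝕍.extends (MacLaneChain.μ chain 0) (coeff a 0)) (V.𝒫-resp (≺1⇒≈constant s) (class-∈𝒫 h))

coefficients-suc : ∀ {c ℓ : Level} {K : Field c ℓ} (v : DiscreteValuation K) (π : Field.Carrier K)
  (uniformizer : DiscreteValuation.IsUniformizer v π) {r : ℕ} (chain : MacLaneChain v (suc r)) (d : ChainData v π chain) → CoefficientField v π uniformizer chain d
coefficients-suc {K = K} v π uniformizer {r} chain d = record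
  { ι = ι ; ι-injective = E.embedding-injective ; ι-class = ι-class ; class-ι = class-ι ; GrAlgebra≡ = ≡.refl }
  where
  open Polynomial (Field.commutativeRing K)
  open DegreeBound (Field.commutativeRing K)
  open GradedProperties (𝕍.valuation (MacLaneChain.μ chain (suc r)))

  module V = ValuationProperties (𝕍.valuation (MacLaneChain.μ chain (suc r)))
  module S = Chain.Stage (Chain.stage v π uniformizer chain (suc r) ℕ.≤-refl)
  module E = ResidueEmbedding (𝕍.valuation (MacLaneChain.μ chain r)) (𝕍.valuation (MacLaneChain.μ chain (suc r))) id
    (Identity.isRingHomomorphism (CommutativeRing.rawRing (K[x] v)) (CommutativeRing.refl (K[x] v)))

  ι : RingHom (MacLaneChain.𝔽 chain (suc r)) (GradedRing.gradedRing (𝕍.valuation (MacLaneChain.μ chain (suc r))))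
  ι = E.embedding

  -- An element of 𝔽ᵣ comes from a polynomial integral for μᵣ₋₁, exactly the bound under which its
  -- remainder modulo φᵣ has the same class.
  ι-class : ∀ k → ∃[ a ] a ≺ S.n × IsClass 0ℚ a (RingHom.⟦_⟧ ι k)
  ι-class (g , (f , f∈) , h) = let a , s , k = S.reduce {f} (lift f∈) in a , s ,
    class-∼ (degree₀-class g) (V.∼-trans {f = proj₁ g} {g = f} {h = a} (V.∼-sym {f = f} {g = proj₁ g} h) k)

  -- A small polynomial has the same value for μᵣ₋₁ and μᵣ, so its class already comes from Δᵣ₋₁.
  class-ι : ∀ {a b} → a ≺ S.n → IsClass 0ℚ a b → ∃[ k ] RingHom.⟦_⟧ ι k Gr.≈ b
  class-ι {a} s h with class-degree₀ h | S.before {a} s (class-∈𝒫 h)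
  ... | g , b≈ , ≡.refl | lift a∈ = (g , (a , a∈) , V.∼-refl {f = a} ≈-refl) , Gr.sym b≈

coefficientField : ∀ {c ℓ : Level} {K : Field c ℓ} (v : DiscreteValuation K) (π : Field.Carrier K)
  (uniformizer : DiscreteValuation.IsUniformizer v π) (r : ℕ) (chain : MacLaneChain v r) (d : ChainData v π chain) →
  CoefficientField v π uniformizer chain d
coefficientField v π uniformizer zero    = coefficients-0 v π uniformizer
coefficientField v π uniformizer (suc r) = coefficients-suc v π uniformizer

-- This holds for whichever chain data are supplied, so only their existence remains to be added.
presented : ∀ {c ℓ : Level} {K : Field c ℓ} (v : DiscreteValuation K) (π : Field.Carrier K) →
  DiscreteValuation.IsUniformizer v π → (r : ℕ) (chain : MacLaneChain v r) → ChainData v π chain →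
  Σ (ChainData v π chain) λ d →
  ChainData.Gr≡⨁φᵣΔ d × GradedIsomorphism (ChainData.GrAlgebra d) (ChainData.presentedAlgebra d)
presented v π uniformizer r chain d = d , Presented.conclusion v π uniformizer chain d (coefficientField v π uniformizer r chain d)

theorem4p13 : ∀ {c ℓ : Level} (K : Field c ℓ) (v : DiscreteValuation K)
    (π : Field.Carrier K) → DiscreteValuation.IsUniformizer v π →
    (r : ℕ) (chain : MacLaneChain v r) →
    Σ (ChainData v π chain) λ d →
    ChainData.Gr≡⨁φᵣΔ d × GradedIsomorphism (ChainData.GrAlgebra d) (ChainData.presentedAlgebra d)
theorem4p13 K v π uniformizer r chain = presented v π uniformizer r chain (ChainDataExists.chainData v π uniformizer chain)
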